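{- There is an algorithm which, given any instance of $n$ jobs as described in the context (common integer length $p\ge 1$, and for each job $j$ integers $r_j$, $d_j$, $w_j\ge 0$), computes a maximum-weight feasible set of jobs (equivalently, together with an earliest-deadline schedule of that set, a preemptive schedule of maximum weighted throughput), and runs in time $O(n^4)$.
   Context: Scheduling problem $1|r_j;\,p_j=p;\,\text{pmtn}|\sum w_jU_j$. We are given $n$ jobs $1,\dots,n$, all of the same integer processing length $p\ge 1$; each job $j$ has an integer release time $r_j$, integer deadline $d_j$ and integer weight $w_j\ge 0$. A time unit $t$ (an integer) denotes the interval $[t,t+1)$. A preemptive schedule $S$ assigns to each job $j$ a set $S(j)$ of time units such that $S(j)\subseteq[r_j,d_j)$ for every $j$ and $S(i)\cap S(j)=\emptyset$ for $i\neq j$ (single machine; the time units assigned to a job need not be consecutive). The schedule completes job $j$ if $|S(j)|=p$. The weighted throughput of $S$ is $\sum_{j:\,|S(j)|=p} w_j$, and the goal is to maximize it. A set $\mathcal{J}$ of jobs is feasible if some schedule completes every job in $\mathcal{J}$; its weight is $w(\mathcal{J})=\sum_{j\in\mathcal{J}}w_j$. A maximum-weight feasible set is a feasible set of largest weight; its weight equals the maximum weighted throughput over all schedules. Running time is measured with unit-cost arithmetic and comparisons on the input integers. -}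

module Defs where

open import Data.Bool using (Bool; true; false; if_then_else_; not)
open import Data.Nat as ℕ using (ℕ; zero; suc)
open import Data.Integer as ℤ using (ℤ; +_; 0ℤ; ∣_∣)
open import Data.Fin using (Fin; toℕ)
open import Data.Fin.Subset using (Subset; _∈_)
open import Data.List using (List; []; _∷_; length; foldr; map; concatMap)
open import Data.List.Base using (allFin)
open import Data.Vec using (tabulate)
open import Data.Product using (Σ; _×_; _,_)
open import Relation.Binary.PropositionalEquality using (_≡_; _≢_)
open import Relation.Nullary using (¬_)
open import Data.Unit using (⊤)
open import Data.Empty using (⊥)
import Data.List.Membership.Propositional as LM
open import Data.List.Relation.Unary.Unique.Propositional using (Unique)
open import Data.List.Relation.Unary.All using (All)

record Job : Set where
  constructor job
  field
    r : ℤ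
    d : ℤ
    w : ℤ
open Job public

-- Preemptive schedules.
-- A schedule assigns to every job j a finite list S j of time units
-- (time unit t = interval [t,t+1)), without repetition (so the list is
-- the set S(j) and |S(j)| = length (S j)), each inside [r_j, d_j), and
-- the sets of distinct jobs are disjoint.  (S(j) ⊆ [r_j,d_j) is finite,
-- so representing it by a duplicate-free list loses nothing.)

record Schedule (n : ℕ) (jobs : Fin n → Job) : Set where
  field
    S        : Fin n → List ℤ
    unique   : ∀ j → Unique (S j)
    inWindow : ∀ j → All (λ t → (r (jobs j) ℤ.≤ t) × (t ℤ.< d (jobs j))) (S j)
    disjoint : ∀ i j → i ≢ j → ∀ t → t LM.∈ S i → ¬ (t LM.∈ S j)
open Schedule public

Completes : ∀ {n jobs} → ℕ → Schedule n jobs → Fin n → Set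
Completes p σ j = length (S σ j) ≡ p

Feasible : (n p : ℕ) (jobs : Fin n → Job) → Subset n → Set
Feasible n p jobs J = Σ (Schedule n jobs) λ σ → ∀ j → j ∈ J → Completes p σ j

weight : (n : ℕ) (jobs : Fin n → Job) → Subset n → ℤ
weight n jobs J =
  foldr ℤ._+_ 0ℤ (map (λ j → if Data.Vec.lookup J j then w (jobs j) else 0ℤ) (allFin n))

MaxWeightFeasible : (n p : ℕ) (jobs : Fin n → Job) → Subset n → Set
MaxWeightFeasible n p jobs J =
  Feasible n p jobs J × (∀ J′ → Feasible n p jobs J′ → weight n jobs J′ ℤ.≤ weight n jobs J)

-- Unit-cost RAM model (integer registers, unit cost per instruction).
-- Memory: registers indexed by ℕ, each holding an integer.

data Instr : Set where
  const : ℕ → ℤ → Instr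
  add   : ℕ → ℕ → ℕ → Instr
  sub   : ℕ → ℕ → ℕ → Instr
  load  : ℕ → ℕ → Instr
  store : ℕ → ℕ → Instr
  jle   : ℕ → ℕ → ℕ → Instr
  halt  : Instr

Program : Set
Program = List Instr

record Config : Set where
  constructor cfg
  field
    pc  : ℕ
    mem : ℕ → ℤ
open Config public

fetch : Program → ℕ → Instr
fetch []       _       = halt      -- falling off the program = halting
fetch (i ∷ is) zero    = i
fetch (i ∷ is) (suc k) = fetch is k

update : (ℕ → ℤ) → ℕ → ℤ → (ℕ → ℤ)
update m a v i = if i ℕ.≡ᵇ a then v else m i

exec : Instr → Config → Config
exec (const a c)   (cfg k m) = cfg (suc k) (update m a c)
exec (add a b c)   (cfg k m) = cfg (suc k) (update m a (m b ℤ.+ m c))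
exec (sub a b c)   (cfg k m) = cfg (suc k) (update m a (m b ℤ.- m c))
exec (load a b)    (cfg k m) = cfg (suc k) (update m a (m ∣ m b ∣))
exec (store a b)   (cfg k m) = cfg (suc k) (update m ∣ m a ∣ (m b))
exec (jle a b l)   (cfg k m) = if m a ℤ.≤ᵇ m b then cfg l m else cfg (suc k) m
exec halt          c         = c

step : Program → Config → Config
step P c = exec (fetch P (pc c)) c

run : Program → ℕ → Config → Config
run P zero    c = c
run P (suc t) c = run P t (step P c)

isHalt : Instr → Set
isHalt halt = ⊤
isHalt _    = ⊥

Halted : Program → Config → Set
Halted P c = isHalt (fetch P (pc c))

nth : List ℤ → ℕ → ℤ
nth []       _       = 0ℤ
nth (x ∷ xs) zero    = x
nth (x ∷ xs) (suc k) = nth xs k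

-- Input encoding: R[0] = n, R[1] = p, R[2+3j] = r_j, R[3+3j] = d_j,
-- R[4+3j] = w_j, all other registers 0; execution starts at pc 0.
inputList : (n p : ℕ) → (Fin n → Job) → List ℤ
inputList n p jobs =
  + n ∷ + p ∷ concatMap (λ j → r (jobs j) ∷ d (jobs j) ∷ w (jobs j) ∷ []) (allFin n)

initConfig : (n p : ℕ) → (Fin n → Job) → Config
initConfig n p jobs = cfg 0 (nth (inputList n p jobs))

outSet : (n : ℕ) → (ℕ → ℤ) → Subset n
outSet n m = tabulate λ j → not (isZero (m (2 ℕ.+ 3 ℕ.* n ℕ.+ toℕ j)))
  where
  isZero : ℤ → Bool
  isZero (+ zero) = true
  isZero _        = false

-- A feasible set of jobs splits into blocks: a block (a , i) starts at the release time r_a, ends at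
-- r_a + i p, and i of its jobs fill it completely.  In a block whose job j of latest deadline is
-- preempted by all the others, j is run in the idle time left by them.  If that begins at r_a + h p, the
-- other jobs form one chain of blocks before this time and one chain after it, and r_a ≤ r_j ≤ r_a + h p.
-- Conversely the jobs of two such chains always leave p idle units from r_a + h p on, for want of room for
-- more than i - h - 1 jobs in the second chain; and the two chains cannot share a job, since the release
-- time of each job of a block lies within the block.  So with the jobs taken in deadline order, tables of
-- the best blocks (n^2 entries) and of the best chains with given start and end (n^3 entries) determine each
-- other: each of the n rounds costs n^3 for the chains, by extending a prefix maximum along the sorted
-- grid points r_a + i p, and n^3 for the blocks, by trying all h.  Table entries carry the chosen set as a
-- bit mask.  Chains obtained from a feasible set by inserting the jobs one at a time have completely filled
-- blocks, so that by counting time units each block ends before its latest deadline.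
--
-- The random access program is compiled from a small structured language whose loops run over the jobs or
-- the grid points, so that the exponent of the running time can be read off the syntax.
module Submission where

open import Defs
open import Data.Nat using (ℕ; zero; suc; _≤_; _<_; _+_; _*_; _∸_; _^_; z≤n; s≤s; _≡ᵇ_; _⊔_)
import Data.Nat as Nat
import Data.Nat.Properties as NP
import Data.Nat.Tactic.RingSolver as NatSolver
import Data.Integer.Tactic.RingSolver as IntSolver
open import Data.Integer using (ℤ; +_; 0ℤ; 1ℤ; ∣_∣; +≤+; +<+) renaming
  (_≤_ to _≤ℤ_; _<_ to _<ℤ_; _+_ to _+ℤ_; _*_ to _*ℤ_; _-_ to _-ℤ_; suc to sucℤ; _≤ᵇ_ to _≤ᵇℤ_)
import Data.Integer as Int
import Data.Integer.Properties as ZP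
open import Data.Bool using (Bool; true; false; if_then_else_; not; _∧_; _∨_; T)
open import Data.Fin using (Fin; toℕ; fromℕ<; #_)
import Data.Bool.Properties as Bool
import Data.Fin as Fin
import Data.Fin.Properties as FP
open import Data.Fin.Subset using (Subset)
import Data.Vec as Vec
import Data.Vec.Properties as VP
open import Data.List using (List; []; _∷_; _++_; length; map; filter; concatMap; upTo; take; foldr; allFin)
import Data.List
import Data.List.Properties as LP
open import Data.List.Relation.Unary.All using (All; []; _∷_)
import Data.List.Relation.Unary.All as All
import Data.List.Relation.Unary.All.Properties as AllP
open import Data.List.Relation.Unary.Any using (here; there)
open import Data.List.Relation.Unary.AllPairs using ([]; _∷_)
open import Data.List.Relation.Unary.Unique.Propositional using (Unique)
import Data.List.Relation.Unary.Unique.Propositional.Properties as UniqueP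
open import Data.List.Membership.Propositional using (_∈_; _∉_)
import Data.List.Membership.Propositional.Properties as MemP
open import Data.List.Relation.Binary.Permutation.Propositional using (_↭_; ↭-sym; ↭-trans; prep; ↭-reflexive)
import Data.List.Relation.Binary.Permutation.Propositional as Perm
import Data.List.Relation.Binary.Permutation.Propositional.Properties as PermP
import Data.List.Relation.Binary.Permutation.Setoid.Properties as PermS
open import Data.Product using (Σ; _×_; _,_; proj₁; proj₂; ∃-syntax)
open import Data.Sum using (_⊎_; inj₁; inj₂)
open import Data.Empty using (⊥; ⊥-elim)
open import Data.Unit using (⊤; tt)
open import Function using (id; case_of_)
open import Relation.Nullary using (¬_; Dec; does; yes; no; contradiction)
open import Relation.Nullary.Decidable using (¬?; _×-dec_; dec-true; dec-false)
open import Relation.Binary.Definitions using (tri<; tri≈; tri>; DecidableEquality)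
open import Relation.Binary.PropositionalEquality
  using (_≡_; _≢_; refl; setoid; sym; trans; cong; cong₂; subst; subst₂; module ≡-Reasoning)
import Algebra.Properties.AbelianGroup ZP.+-0-abelianGroup as ℤGroup

-- Duplicate-free lists and ranks

-- The recursion appears in two forms because the two directions need different data. `Chain` and
-- `Block` contain only conditions that a table can test, so their blocks may be underfull; this
-- suffices to build schedules. `Tight` also demands full blocks, without which `val a i ≤ dl j`
-- could not be derived from a given schedule. Distinct grid points may denote the same time. The
-- scan uses the strict order `pos`, ties broken by number, so that each step adds exactly one
-- possible last block; the limits of chains are counts `top` that include all ties. Then
-- `pos a i < top b k` says exactly `val a i ≤ val b k`. The machine only adds, subtracts and
-- compares. Masks need no more: the lists joined in an entry are disjoint, so their masks add, and
-- the final mask is decoded by subtraction. Registers 0 to 4 all hold input at the start. The base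
-- address is therefore accumulated on top of `p` in register 1, without a free register; `p + 5 n`
-- leaves room for input and output, and `p` comes back by subtracting `n` five times.

unique-takeˡ : ∀ {A : Set} (xs : List A) {ys} → Unique (xs ++ ys) → Unique xs
unique-takeˡ [] u = []
unique-takeˡ (x ∷ xs) (q ∷ u) = AllP.++⁻ˡ xs q ∷ unique-takeˡ xs u

unique-dropˡ : ∀ {A : Set} (xs : List A) {ys} → Unique (xs ++ ys) → Unique ys
unique-dropˡ [] u = u
unique-dropˡ (x ∷ xs) (_ ∷ u) = unique-dropˡ xs u

unique-disjoint : ∀ {A : Set} (xs : List A) {ys t} → Unique (xs ++ ys) → t ∈ xs → t ∉ ys
unique-disjoint (x ∷ xs) (q ∷ u) (here refl) t∈ = All.lookup (AllP.++⁻ʳ xs q) t∈ refl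
unique-disjoint (x ∷ xs) (q ∷ u) (there p) t∈ = unique-disjoint xs u p t∈

module Removal {A : Set} (_≟_ : DecidableEquality A) where

  _≢?_ : (x y : A) → Dec (y ≢ x)
  x ≢? y = ¬? (y ≟ x)

  length-remove : ∀ x V → Unique V → length V ≤ suc (length (filter (x ≢?_) V))
  length-remove x [] _ = z≤n
  length-remove x (v ∷ V) (v∉ ∷ u) with v ≟ x
  ... | yes refl = s≤s (NP.≤-reflexive (cong length (sym (LP.filter-all (x ≢?_) (All.map (λ q e → q (sym e)) v∉)))))
  ... | no  _    = s≤s (length-remove x V u)

  _∖_ : List A → List A → List A
  V ∖ []      = V
  V ∖ (x ∷ U) = filter (x ≢?_) V ∖ U

  length-∖ : ∀ V U → Unique V → length V ≤ length (V ∖ U) + length U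
  length-∖ V []      u = NP.≤-reflexive (sym (NP.+-identityʳ _))
  length-∖ V (x ∷ U) u = NP.≤-trans (length-remove x V u) (NP.≤-trans
    (s≤s (length-∖ (filter (x ≢?_) V) U (UniqueP.filter⁺ (x ≢?_) u)))
    (NP.≤-reflexive (sym (NP.+-suc _ _))))

  unique-∖ : ∀ V U → Unique V → Unique (V ∖ U)
  unique-∖ V []      u = u
  unique-∖ V (x ∷ U) u = unique-∖ (filter (x ≢?_) V) U (UniqueP.filter⁺ (x ≢?_) u)

  ∈-∖⁻ : ∀ V U {t} → t ∈ V ∖ U → t ∈ V × t ∉ U
  ∈-∖⁻ V [] t∈ = t∈ , λ ()
  ∈-∖⁻ V (x ∷ U) t∈ with ∈-∖⁻ (filter (x ≢?_) V) U t∈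
  ... | t∈f , t∉U with MemP.∈-filter⁻ (x ≢?_) {xs = V} t∈f
  ...   | t∈V , t≢x = t∈V , λ { (here e) → t≢x e ; (there q) → t∉U q }

  length-⊆ : ∀ V U → Unique V → (∀ {t} → t ∈ V → t ∈ U) → length V ≤ length U
  length-⊆ V U u V⊆U = subst (λ k → length V ≤ k + length U) (empty (V ∖ U) refl) (length-∖ V U u)
    where
    empty : ∀ W → W ≡ V ∖ U → length (V ∖ U) ≡ 0
    empty [] e = cong length (sym e)
    empty (t ∷ W) e with ∈-∖⁻ V U (subst (t ∈_) e (here refl))
    ... | t∈V , t∉U = contradiction (V⊆U t∈V) t∉U

module Removalℤ = Removal ZP._≟_
module Removalℕ = Removal NP._≟_
open Removalℤ using (_∖_) public

range : ℤ → ℕ → List ℤ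
range x N = map (λ i → x +ℤ + i) (upTo N)

length-range : ∀ x N → length (range x N) ≡ N
length-range x N = trans (LP.length-map _ (upTo N)) (LP.length-upTo N)

unique-range : ∀ x N → Unique (range x N)
unique-range x N = UniqueP.map⁺ (λ e → ZP.+-injective (ℤGroup.∙-cancelˡ x _ _ e)) (UniqueP.upTo⁺ N)

∈-range⁻ : ∀ {x N t} → t ∈ range x N → x ≤ℤ t × t <ℤ x +ℤ + N
∈-range⁻ {x} {N} t∈ with MemP.∈-map⁻ (λ i → x +ℤ + i) t∈
... | i , i∈ , refl = ZP.i≤i+j x (+ i) , ZP.+-monoʳ-< x (+<+ (MemP.∈-upTo⁻ i∈))

≤⇒offset : ∀ {x y} → x ≤ℤ y → ∃[ i ] y ≡ x +ℤ + i
≤⇒offset {x} {y} x≤y = ∣ y -ℤ x ∣ , sym (begin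
  x +ℤ + ∣ y -ℤ x ∣  ≡⟨ cong (x +ℤ_) (ZP.0≤i⇒+∣i∣≡i (ZP.i≤j⇒0≤j-i x≤y)) ⟩
  x +ℤ (y -ℤ x)      ≡⟨ cancel x y ⟩
  y                  ∎)
  where
  open ≡-Reasoning
  cancel : ∀ x y → x +ℤ (y -ℤ x) ≡ y
  cancel = IntSolver.solve-∀

∈-range⁺ : ∀ {x N t} → x ≤ℤ t → t <ℤ x +ℤ + N → t ∈ range x N
∈-range⁺ {x} {N} x≤t t<N with ≤⇒offset x≤t
... | i , refl = MemP.∈-map⁺ (λ i → x +ℤ + i) (MemP.∈-upTo⁺ (NP.≰⇒> λ N≤i → ZP.<⇒≱ t<N (ZP.+-monoʳ-≤ x (+≤+ N≤i))))

length-window : ∀ {x N ts} → Unique ts → All (λ t → x ≤ℤ t × t <ℤ x +ℤ + N) ts → length ts ≤ N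
length-window {x} {N} {ts} u w = subst (length ts ≤_) (length-range x N)
  (Removalℤ.length-⊆ ts (range x N) u (λ t∈ → ∈-range⁺ (proj₁ (All.lookup w t∈)) (proj₂ (All.lookup w t∈))))

-- A member of `ts` forces `x ≤ y`, so that `y` is `x` plus a natural number and the counting bound
-- applies. For the empty list the claim would fail when `y < x`.
length-window-≤ : ∀ {x y ts} → 1 ≤ length ts → Unique ts → All (λ t → x ≤ℤ t × t <ℤ y) ts →
  x +ℤ + length ts ≤ℤ y
length-window-≤ {x} {y} {t ∷ ts} _ u w@((x≤t , t<y) ∷ _) with ≤⇒offset (ZP.≤-trans x≤t (ZP.<⇒≤ t<y))
... | N , refl = ZP.+-monoʳ-≤ x (+≤+ (length-window u w))

length-bounded : ∀ {n L} → Unique L → All (_< n) L → length L ≤ n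
length-bounded {n} {L} u b = subst (length L ≤_) (LP.length-upTo n)
  (Removalℕ.length-⊆ L (upTo n) u (λ t∈ → MemP.∈-upTo⁺ (All.lookup b t∈)))

count : ℕ → (ℕ → Bool) → ℕ
count zero    P = 0
count (suc N) P = (if P N then 1 else 0) + count N P

count-≤ : ∀ N P → count N P ≤ N
count-≤ zero P = z≤n
count-≤ (suc N) P with P N
... | true  = s≤s (count-≤ N P)
... | false = NP.m≤n⇒m≤1+n (count-≤ N P)

count-mono : ∀ N {P Q} → (∀ g → g < N → T (P g) → T (Q g)) → count N P ≤ count N Q
count-mono zero h = z≤n
count-mono (suc N) {P} {Q} h with P N | Q N | h N NP.≤-refl | count-mono N {P} {Q} (λ g g<N → h g (NP.m<n⇒m<1+n g<N))
... | false | false | _ | ih = ih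
... | false | true  | _ | ih = NP.m≤n⇒m≤1+n ih
... | true  | true  | _ | ih = s≤s ih
... | true  | false | q | _  = ⊥-elim (q tt)

count-strict : ∀ N {P Q} e → e < N → ¬ T (P e) → T (Q e) → (∀ g → g < N → T (P g) → T (Q g)) →
  count N P < count N Q
count-strict (suc N) {P} {Q} e e<N np q h with NP.m≤n⇒m<n∨m≡n (NP.≤-pred e<N)
... | inj₂ refl with P N | Q N
...   | true  | _     = ⊥-elim (np tt)
...   | false | true  = s≤s (count-mono N (λ g g<N → h g (NP.m<n⇒m<1+n g<N)))
...   | false | false = ⊥-elim q
count-strict (suc N) {P} {Q} e e<N np q h | inj₁ e<N′
  with P N | Q N | h N NP.≤-refl | count-strict N {P} {Q} e e<N′ np q (λ g g<N → h g (NP.m<n⇒m<1+n g<N))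
... | false | false | _ | ih = ih
... | false | true  | _ | ih = NP.m≤n⇒m≤1+n ih
... | true  | true  | _ | ih = s≤s ih
... | true  | false | q′ | _ = ⊥-elim (q′ tt)

-- g comes before e in the order of the keys, ties being broken by the index.
precedes : (ℕ → ℤ) → ℕ → ℕ → Bool
precedes κ e g = if κ g ≤ᵇℤ κ e then (if κ e ≤ᵇℤ κ g then not (e Nat.≤ᵇ g) else true) else false

rank : (ℕ → ℤ) → ℕ → ℕ → ℕ
rank κ N e = count N (precedes κ e)

countUpTo : (ℕ → ℤ) → ℕ → ℕ → ℕ
countUpTo κ N e = count N (λ g → κ g ≤ᵇℤ κ e)

module Rank (κ : ℕ → ℤ) (N : ℕ) where

  precedes⇒≤ : ∀ e g → T (precedes κ e g) → κ g ≤ℤ κ e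
  precedes⇒≤ e g q with κ g ≤ᵇℤ κ e in eq
  ... | true = ZP.≤ᵇ⇒≤ (subst T (sym eq) tt)

  precedes-irrefl : ∀ e → ¬ T (precedes κ e e)
  precedes-irrefl e q with κ e ≤ᵇℤ κ e | e Nat.≤ᵇ e | NP.≤⇒≤ᵇ (NP.≤-refl {e})
  ... | true | true | _ = q

  <⇒precedes : ∀ e g → κ g <ℤ κ e → T (precedes κ e g)
  <⇒precedes e g lt with κ g ≤ᵇℤ κ e | ZP.≤⇒≤ᵇ (ZP.<⇒≤ lt) | κ e ≤ᵇℤ κ g in eq
  ... | true | _ | false = tt
  ... | true | _ | true  = contradiction (ZP.≤ᵇ⇒≤ (subst T (sym eq) tt)) (ZP.<⇒≱ lt)

  ≡⇒precedes : ∀ e g → κ g ≡ κ e → g < e → T (precedes κ e g)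
  ≡⇒precedes e g eq lt with κ g ≤ᵇℤ κ e | ZP.≤⇒≤ᵇ (ZP.≤-reflexive eq) | κ e ≤ᵇℤ κ g | ZP.≤⇒≤ᵇ (ZP.≤-reflexive (sym eq)) | e Nat.≤ᵇ g in le
  ... | true | _ | true | _ | false = tt
  ... | true | _ | true | _ | true  = contradiction (NP.≤ᵇ⇒≤ e g (subst T (sym le) tt)) (NP.<⇒≱ lt)

  precedes-≡⇒< : ∀ e g → κ g ≡ κ e → T (precedes κ e g) → g < e
  precedes-≡⇒< e g eq q with κ g ≤ᵇℤ κ e | κ e ≤ᵇℤ κ g | ZP.≤⇒≤ᵇ (ZP.≤-reflexive (sym eq)) | e Nat.≤ᵇ g in le
  ... | true | true | _ | false = NP.≰⇒> (λ e≤g → subst T le (NP.≤⇒≤ᵇ e≤g))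

  precedes-trans : ∀ e f g → T (precedes κ e f) → T (precedes κ f g) → T (precedes κ e g)
  precedes-trans e f g q q′ with ZP.<-cmp (κ g) (κ e)
  ... | tri< lt _ _ = <⇒precedes e g lt
  ... | tri> _ _ gt = contradiction (ZP.≤-trans (precedes⇒≤ f g q′) (precedes⇒≤ e f q)) (ZP.<⇒≱ gt)
  ... | tri≈ _ eq _ = ≡⇒precedes e g eq (NP.<-trans (precedes-≡⇒< f g (trans eq (sym fe)) q′) (precedes-≡⇒< e f fe q))
    where
    fe : κ f ≡ κ e
    fe = ZP.≤-antisym (precedes⇒≤ e f q) (ZP.≤-trans (ZP.≤-reflexive (sym eq)) (precedes⇒≤ f g q′))

  precedes⇒rank< : ∀ e g → g < N → T (precedes κ e g) → rank κ N g < rank κ N e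
  precedes⇒rank< e g g<N q = count-strict N g g<N (precedes-irrefl g) q (λ h _ q′ → precedes-trans e g h q q′)

  rank<⇒≤ : ∀ e g → e < N → rank κ N g < rank κ N e → κ g ≤ℤ κ e
  rank<⇒≤ e g e<N lt with ZP.<-cmp (κ g) (κ e)
  ... | tri< l _ _ = ZP.<⇒≤ l
  ... | tri≈ _ e≡ _ = ZP.≤-reflexive e≡
  ... | tri> _ _ gt = contradiction (precedes⇒rank< g e e<N (<⇒precedes g e gt)) (NP.<-asym lt)

  rank-injective : ∀ e g → e < N → g < N → rank κ N e ≡ rank κ N g → e ≡ g
  rank-injective e g e<N g<N eq with ZP.<-cmp (κ g) (κ e)
  ... | tri< l _ _ = contradiction (sym eq) (NP.<⇒≢ (precedes⇒rank< e g g<N (<⇒precedes e g l)))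
  ... | tri> _ _ l = contradiction eq (NP.<⇒≢ (precedes⇒rank< g e e<N (<⇒precedes g e l)))
  ... | tri≈ _ κ≡ _ with NP.<-cmp g e
  ...   | tri< l _ _ = contradiction (sym eq) (NP.<⇒≢ (precedes⇒rank< e g g<N (≡⇒precedes e g κ≡ l)))
  ...   | tri≈ _ q _ = sym q
  ...   | tri> _ _ l = contradiction eq (NP.<⇒≢ (precedes⇒rank< g e e<N (≡⇒precedes g e (sym κ≡) l)))

  rank<N : ∀ e → e < N → rank κ N e < N
  rank<N e e<N = NP.<-≤-trans
    (count-strict N {Q = λ _ → true} e e<N (precedes-irrefl e) tt (λ _ _ _ → tt)) (count-≤ N _)

  -- If `κ f < κ e`, every key counted for `f` precedes `e`, so the count for `f` cannot exceed the
  -- rank of `e`.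
  rank<countUpTo⇒≤ : ∀ e f → rank κ N e < countUpTo κ N f → κ e ≤ℤ κ f
  rank<countUpTo⇒≤ e f lt with ZP.<-cmp (κ e) (κ f)
  ... | tri< l _ _ = ZP.<⇒≤ l
  ... | tri≈ _ e≡ _ = ZP.≤-reflexive e≡
  ... | tri> _ _ gt = contradiction (count-mono N (λ g _ q → <⇒precedes e g (ZP.≤-<-trans (ZP.≤ᵇ⇒≤ q) gt))) (NP.<⇒≱ lt)

  -- Whatever precedes `e` is counted for `f` as well, and `e` itself is counted for `f` but not in
  -- its own rank; hence the strict inequality.
  ≤⇒rank<countUpTo : ∀ e f → e < N → κ e ≤ℤ κ f → rank κ N e < countUpTo κ N f
  ≤⇒rank<countUpTo e f e<N le = count-strict N e e<N (precedes-irrefl e) (ZP.≤⇒≤ᵇ le)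
    (λ g _ q → ZP.≤⇒≤ᵇ (ZP.≤-trans (precedes⇒≤ e g q) le))

  countUpTo≤N : ∀ f → countUpTo κ N f ≤ N
  countUpTo≤N f = count-≤ N _

-- Chains of blocks, and how to schedule them

record Instance : Set where
  field
    n p     : ℕ
    0<p     : 0 < p
    rel dl  : ℕ → ℤ

  val : ℕ → ℕ → ℤ
  val a i = rel a +ℤ + (i * p)

-- The grid point val a i = rel a + i p is addressed by (a , i); pos is its position in the sorted
-- order of the grid points and top the number of grid points that are ≤ it.  jrk is the position
-- of a job in deadline order.
record Order (I : Instance) : Set where
  open Instance I public
  field
    pos top : ℕ → ℕ → ℕ
    jrk     : ℕ → ℕ
    M       : ℕ
    pos<top⇒≤ : ∀ a i b k → a < n → i ≤ n → b < n → k ≤ n → pos a i < top b k → val a i ≤ℤ val b k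
    ≤⇒pos<top : ∀ a i b k → a < n → i ≤ n → b < n → k ≤ n → val a i ≤ℤ val b k → pos a i < top b k
    pos<M     : ∀ a i → a < n → i ≤ n → pos a i < M
    jrk<n     : ∀ j → j < n → jrk j < n
    jrk⇒≤     : ∀ i j → i < n → j < n → jrk i < jrk j → dl i ≤ℤ dl j
    jrk-inj   : ∀ i j → i < n → j < n → jrk i ≡ jrk j → i ≡ j

module Blocks {I : Instance} (O : Order I) where
  open Order O

  val-zero : ∀ a → val a 0 ≡ rel a
  val-zero a = ZP.+-identityʳ (rel a)

  val-mono-≤ : ∀ a {i k} → i ≤ k → val a i ≤ℤ val a k
  val-mono-≤ a i≤k = ZP.+-monoʳ-≤ (rel a) (+≤+ (NP.*-monoˡ-≤ p i≤k))

  val-mono-< : ∀ a {i k} → i < k → val a i <ℤ val a k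
  val-mono-< a i<k = ZP.+-monoʳ-< (rel a) (+<+ (NP.*-monoˡ-< p {{Nat.>-nonZero 0<p}} i<k))

  rel≤val : ∀ a i → rel a ≤ℤ val a i
  rel≤val a i = ZP.i≤i+j (rel a) (+ (i * p))

  val-+ : ∀ a i k → val a (i + k) ≡ val a i +ℤ + (k * p)
  val-+ a i k = trans (cong (λ q → rel a +ℤ + q) (NP.*-distribʳ-+ p i k))
    (trans (cong (rel a +ℤ_) (ZP.pos-+ (i * p) (k * p))) (sym (ZP.+-assoc (rel a) (+ (i * p)) (+ (k * p)))))

  mutual
    -- Sets of jobs of deadline rank < k that fill disjoint blocks, each starting at a release time
    -- ≥ x and ending at a grid point of position < s.
    data Chain (k : ℕ) (x : ℤ) (s : ℕ) : List ℕ → Set where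
      []   : Chain k x s []
      snoc : ∀ {a i L L′} → a < n → 0 < i → i ≤ n → x ≤ℤ rel a → pos a i < s →
             Chain k x (top a 0) L → Block k a i L′ → Chain k x s (L ++ L′)

    -- Sets of jobs that can be run between rel a and val a i.  The job j of latest deadline is
    -- preempted by all the others; it uses the idle time, which begins at val a h.
    data Block (k a i : ℕ) : List ℕ → Set where
      empty : Block k a i []
      block : ∀ {j h J K} → j < n → jrk j < k → h < i → rel a ≤ℤ rel j → rel j ≤ℤ val a h → val a i ≤ℤ dl j →
              Chain (jrk j) (rel a) (top a h) J → Chain (jrk j) (sucℤ (val a h)) (top a i) K →
              Block k a i (j ∷ J ++ K)

  -- The end of a chain is a position in the grid order and not a time. This is the corresponding
  -- upper limit for a time unit or a release time.
  Before : ℕ → ℤ → Set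
  Before s t = ∃[ a ] ∃[ i ] a < n × i ≤ n × pos a i < s × t <ℤ val a i

  before-top : ∀ {b k t} → b < n → k ≤ n → Before (top b k) t → t <ℤ val b k
  before-top {b} {k} b<n k≤n (a , i , a<n , i≤n , lt , t<) = ZP.<-≤-trans t< (pos<top⇒≤ a i b k a<n i≤n b<n k≤n lt)

  before-start : ∀ {a t} → a < n → Before (top a 0) t → t <ℤ rel a
  before-start {a} a<n bt = subst (_ <ℤ_) (val-zero a) (before-top a<n z≤n bt)

  InChain : ℕ → ℤ → ℕ → ℕ → Set
  InChain k x s j = j < n × jrk j < k × x ≤ℤ rel j × Before s (rel j)

  InBlock : ℕ → ℕ → ℕ → ℕ → Set
  InBlock k a i j = j < n × jrk j < k × rel a ≤ℤ rel j × rel j <ℤ val a i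

  suc≤⇒< : ∀ {x y} → sucℤ x ≤ℤ y → x <ℤ y
  suc≤⇒< = ZP.suc[i]≤j⇒i<j

  mutual
    chain-jobs : ∀ {k x s L} → Chain k x s L → All (InChain k x s) L
    chain-jobs [] = []
    chain-jobs {k} {x} {s} (snoc {a} {i} a<n 0<i i≤n x≤a lt C B) = AllP.++⁺
      (All.map (λ { (j<n , j<k , x≤j , bj) → j<n , j<k , x≤j ,
          (a , i , a<n , i≤n , lt , ZP.<-≤-trans (before-start a<n bj) (rel≤val a i)) }) (chain-jobs C))
      (All.map (λ { (j<n , j<k , a≤j , j<i) → j<n , j<k , ZP.≤-trans x≤a a≤j , (a , i , a<n , i≤n , lt , j<i) })
        (block-jobs a<n i≤n B))

    block-jobs : ∀ {k a i L} → a < n → i ≤ n → Block k a i L → All (InBlock k a i) L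
    block-jobs a<n i≤n empty = []
    block-jobs {k} {a} {i} a<n i≤n (block {j} {h} j<n j<k h<i a≤j j≤h i≤d CJ CK) =
      (j<n , j<k , a≤j , ZP.≤-<-trans j≤h (val-mono-< a h<i)) ∷ AllP.++⁺
      (All.map (λ { (l<n , l<j , a≤l , bl) → l<n , NP.<-trans l<j j<k , a≤l ,
          ZP.<-trans (before-top a<n (NP.≤-trans (NP.<⇒≤ h<i) i≤n) bl) (val-mono-< a h<i) }) (chain-jobs CJ))
      (All.map (λ { (l<n , l<j , h≤l , bl) → l<n , NP.<-trans l<j j<k ,
          ZP.≤-trans (rel≤val a h) (ZP.<⇒≤ (suc≤⇒< h≤l)) , before-top a<n i≤n bl }) (chain-jobs CK))

  mutual
    -- The release times of the two lists being joined lie on different sides of a grid point, and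
    -- the job `j` of a block has a larger deadline rank than the rest. Distinctness is what turns
    -- the sums of powers of two in the tables into bit masks.
    chain-unique : ∀ {k x s L} → Chain k x s L → Unique L
    chain-unique [] = []
    chain-unique (snoc {a} {i} a<n _ i≤n _ _ C B) = UniqueP.++⁺ (chain-unique C) (block-unique a<n i≤n B)
      (λ { (l∈ , l∈′) → ZP.<⇒≱ (before-start a<n (proj₂ (proj₂ (proj₂ (All.lookup (chain-jobs C) l∈)))))
           (proj₁ (proj₂ (proj₂ (All.lookup (block-jobs a<n i≤n B) l∈′)))) })

    block-unique : ∀ {k a i L} → a < n → i ≤ n → Block k a i L → Unique L
    block-unique a<n i≤n empty = []
    block-unique {a = a} a<n i≤n (block {j} {h} j<n j<k h<i a≤j j≤h i≤d CJ CK) =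
      AllP.++⁺ (All.map (λ q e → NP.<⇒≢ (proj₁ (proj₂ q)) (cong jrk (sym e))) (chain-jobs CJ))
               (All.map (λ q e → NP.<⇒≢ (proj₁ (proj₂ q)) (cong jrk (sym e))) (chain-jobs CK))
      ∷ UniqueP.++⁺ (chain-unique CJ) (chain-unique CK)
        (λ { (l∈ , l∈′) → ZP.<-asym
          (before-top a<n (NP.≤-trans (NP.<⇒≤ h<i) i≤n) (proj₂ (proj₂ (proj₂ (All.lookup (chain-jobs CJ) l∈)))))
          (suc≤⇒< (proj₁ (proj₂ (proj₂ (All.lookup (chain-jobs CK) l∈′))))) })

  -- E lists the jobs with their time units.
  record Scheduled (x : ℤ) (Hi : ℤ → Set) (E : List (ℕ × List ℤ)) : Set where
    field
      entries : All (λ e → length (proj₂ e) ≡ p × All (λ t → rel (proj₁ e) ≤ℤ t × t <ℤ dl (proj₁ e) × x ≤ℤ t × Hi t) (proj₂ e)) E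
      units-unique : Unique (concatMap proj₂ E)
  open Scheduled

  Schedulable : ℤ → (ℤ → Set) → List ℕ → Set
  Schedulable x Hi L = ∃[ E ] map proj₁ E ≡ L × Scheduled x Hi E

  units-window : ∀ {x Hi E} → Scheduled x Hi E → All (λ t → x ≤ℤ t × Hi t) (concatMap proj₂ E)
  units-window {E = []} σ = []
  units-window {E = e ∷ E} σ with entries σ
  ... | (_ , w) ∷ es = AllP.++⁺ (All.map (λ q → proj₂ (proj₂ q)) w)
    (units-window {E = E} record { entries = es ; units-unique = unique-dropˡ (proj₂ e) (units-unique σ) })

  length-units : ∀ {x Hi E} → Scheduled x Hi E → length (concatMap proj₂ E) ≡ length E * p
  length-units {E = E} σ = go (All.map proj₁ (entries σ))
    where
    go : ∀ {E : List (ℕ × List ℤ)} → All (λ e → length (proj₂ e) ≡ p) E → length (concatMap proj₂ E) ≡ length E * p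
    go [] = refl
    go {e ∷ E} (q ∷ es) = trans (LP.length-++ (proj₂ e)) (cong₂ _+_ q (go es))

  schedule-++ : ∀ {x Hi x₁ Hi₁ x₂ Hi₂ E₁ E₂} → Scheduled x₁ Hi₁ E₁ → Scheduled x₂ Hi₂ E₂ →
    (∀ {t} → x₁ ≤ℤ t → Hi₁ t → x ≤ℤ t × Hi t) → (∀ {t} → x₂ ≤ℤ t → Hi₂ t → x ≤ℤ t × Hi t) →
    (∀ {t} → Hi₁ t → x₂ ≤ℤ t → ⊥) → Scheduled x Hi (E₁ ++ E₂)
  schedule-++ {E₁ = E₁} {E₂} σ₁ σ₂ f₁ f₂ disj = record
    { entries = AllP.++⁺ (All.map (λ { (q , w) → q , All.map (λ { (a , b , c , d) → a , b , f₁ c d }) w }) (entries σ₁))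
                         (All.map (λ { (q , w) → q , All.map (λ { (a , b , c , d) → a , b , f₂ c d }) w }) (entries σ₂))
    ; units-unique = subst Unique (sym (LP.concatMap-++ proj₂ E₁ E₂))
        (UniqueP.++⁺ (units-unique σ₁) (units-unique σ₂)
          (λ { (t∈ , t∈′) → disj (proj₂ (All.lookup (units-window σ₁) t∈)) (proj₁ (All.lookup (units-window σ₂) t∈′)) }))
    }

  mutual
    chain-schedulable : ∀ {k x s L} → Chain k x s L → Schedulable x (Before s) L
    chain-schedulable [] = [] , refl , record { entries = [] ; units-unique = [] }
    chain-schedulable {k} {x} {s} (snoc {a} {i} {L} {L′} a<n 0<i i≤n x≤a lt C B)
      with chain-schedulable C | block-schedulable a<n i≤n B
    ... | E₁ , refl , σ₁ | E₂ , refl , σ₂ = E₁ ++ E₂ , LP.map-++ proj₁ E₁ E₂ , schedule-++ σ₁ σ₂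
      (λ x≤t bt → x≤t , a , i , a<n , i≤n , lt , ZP.<-≤-trans (before-start a<n bt) (rel≤val a i))
      (λ a≤t t<i → ZP.≤-trans x≤a a≤t , a , i , a<n , i≤n , lt , t<i)
      (λ bt a≤t → ZP.<⇒≱ (before-start a<n bt) a≤t)

    -- Only the second chain competes with `j`, because the first one is finished by `val a h`. So
    -- `j` takes the first `p` units from `val a h` on that the second chain leaves free; the work
    -- is to count that there are `p` of them before `val a i`.
    block-schedulable : ∀ {k a i L} → a < n → i ≤ n → Block k a i L → Schedulable (rel a) (_<ℤ val a i) L
    block-schedulable a<n i≤n empty = [] , refl , record { entries = [] ; units-unique = [] }
    block-schedulable {k} {a} {i} a<n i≤n (block {j} {h} {J} {K} j<n j<k h<i a≤j j≤h i≤d CJ CK)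
      with chain-schedulable CJ | chain-schedulable CK
    ... | E₁ , refl , σ₁ | E₂ , refl , σ₂ = (j , units) ∷ E₁ ++ E₂ , cong (j ∷_) (LP.map-++ proj₁ E₁ E₂) , record
      { entries = (length-units-j , AllP.take⁺ p (All.tabulate free-window)) ∷ entries σ₁₂
      ; units-unique = UniqueP.++⁺ (UniqueP.take⁺ p (Removalℤ.unique-∖ R U₂ (unique-range (val a h) N))) (units-unique σ₁₂)
          (λ { (t∈ , t∈′) → units-disjoint (MemP.∈-++⁻ U₁ (subst (_ ∈_) (LP.concatMap-++ proj₂ E₁ E₂) t∈′)) (take-⊆ p t∈) }) }
      where
      h≤n : h ≤ n
      h≤n = NP.≤-trans (NP.<⇒≤ h<i) i≤n
      N = (i ∸ h) * p
      R = range (val a h) N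
      U₁ = concatMap proj₂ E₁
      U₂ = concatMap proj₂ E₂
      free = R ∖ U₂
      units = take p free
      take-⊆ : ∀ m {xs : List ℤ} {t} → t ∈ take m xs → t ∈ xs
      take-⊆ (suc m) {x ∷ xs} (here e) = here e
      take-⊆ (suc m) {x ∷ xs} (there q) = there (take-⊆ m q)
      end : val a h +ℤ + N ≡ val a i
      end = trans (sym (val-+ a h (i ∸ h))) (cong (val a) (NP.m+[n∸m]≡n (NP.<⇒≤ h<i)))
      window₂ : All (λ t → sucℤ (val a h) ≤ℤ t × t <ℤ val a i) U₂
      window₂ = All.map (λ { (a , b) → a , before-top a<n i≤n b }) (units-window σ₂)
      -- The unit `val a h` is idle too, since the second chain starts only after it. Dividing this
      -- strict inequality by `p` bounds the number of jobs of the second chain by `i - h - 1`.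
      |U₂|<N : suc (length U₂) ≤ N
      |U₂|<N = length-window {val a h} {N} {val a h ∷ U₂}
        (All.map (λ { (q , _) e → ZP.<⇒≢ (suc≤⇒< q) e }) window₂ ∷ units-unique σ₂)
        ((ZP.≤-refl , subst (val a h <ℤ_) (sym end) (val-mono-< a h<i)) ∷
          All.map (λ { (q , q′) → ZP.<⇒≤ (suc≤⇒< q) , subst (_ <ℤ_) (sym end) q′ }) window₂)
      |E₂|<i-h : suc (length E₂) ≤ i ∸ h
      |E₂|<i-h = NP.*-cancelʳ-< p (length E₂) (i ∸ h) (subst (_< N) (length-units σ₂) |U₂|<N)
      p≤free : p ≤ length free
      p≤free = NP.+-cancelʳ-≤ (length E₂ * p) p (length free) (begin
        p + length E₂ * p        ≤⟨ NP.*-monoˡ-≤ p |E₂|<i-h ⟩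
        N                        ≡⟨ sym (length-range (val a h) N) ⟩
        length R                 ≤⟨ Removalℤ.length-∖ R U₂ (unique-range (val a h) N) ⟩
        length free + length U₂  ≡⟨ cong (λ q → length free + q) (length-units σ₂) ⟩
        length free + length E₂ * p ∎)
        where open NP.≤-Reasoning
      length-units-j : length units ≡ p
      length-units-j = trans (LP.length-take p free) (NP.m≤n⇒m⊓n≡m p≤free)
      free-window : ∀ {t} → t ∈ free → rel j ≤ℤ t × t <ℤ dl j × rel a ≤ℤ t × t <ℤ val a i
      free-window {t} t∈ with ∈-range⁻ {val a h} {N} (proj₁ (Removalℤ.∈-∖⁻ R U₂ t∈))
      ... | h≤t , t<N = ZP.≤-trans j≤h h≤t , ZP.<-≤-trans t<i i≤d , ZP.≤-trans (rel≤val a h) h≤t , t<i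
        where
        t<i : t <ℤ val a i
        t<i = subst (t <ℤ_) end t<N
      units-disjoint : ∀ {t} → t ∈ U₁ ⊎ t ∈ U₂ → t ∈ free → ⊥
      units-disjoint (inj₁ t∈) t∈f = ZP.<⇒≱ (before-top a<n h≤n (proj₂ (All.lookup (units-window σ₁) t∈)))
        (proj₁ (∈-range⁻ {val a h} {N} (proj₁ (Removalℤ.∈-∖⁻ R U₂ t∈f))))
      units-disjoint (inj₂ t∈) t∈f = proj₂ (Removalℤ.∈-∖⁻ R U₂ t∈f) t∈
      σ₁₂ : Scheduled (rel a) (_<ℤ val a i) (E₁ ++ E₂)
      σ₁₂ = schedule-++ σ₁ σ₂
        (λ a≤t bt → a≤t , ZP.<-trans (before-top a<n h≤n bt) (val-mono-< a h<i))
        (λ h<t bt → ZP.≤-trans (rel≤val a h) (ZP.<⇒≤ (suc≤⇒< h<t)) , before-top a<n i≤n bt)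
        (λ bt h<t → ZP.<-asym (before-top a<n h≤n bt) (suc≤⇒< h<t))

-- Every feasible set of jobs forms a chain

module Completeness {I : Instance} (O : Order I) where
  open Order O
  open Blocks O

  block-mono : ∀ {k k′ a i L} → k ≤ k′ → Block k a i L → Block k′ a i L
  block-mono k≤ empty = empty
  block-mono k≤ (block j<n j<k h<i a≤j j≤h i≤d CJ CK) = block j<n (NP.<-≤-trans j<k k≤) h<i a≤j j≤h i≤d CJ CK

  -- Chains of completely filled blocks, ending at a time ≤ y.
  data Tight (k : ℕ) (x y : ℤ) : List ℕ → Set where
    []   : Tight k x y []
    snoc : ∀ {a i L L′} → a < n → 0 < i → i ≤ n → x ≤ℤ rel a → val a i ≤ℤ y →
           Tight k x (rel a) L → Block k a i L′ → length L′ ≡ i → Tight k x y (L ++ L′)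

  tight-mono : ∀ {k k′ x y L} → k ≤ k′ → Tight k x y L → Tight k′ x y L
  tight-mono k≤ [] = []
  tight-mono k≤ (snoc a<n 0<i i≤n x≤a i≤y C B e) = snoc a<n 0<i i≤n x≤a i≤y (tight-mono k≤ C) (block-mono k≤ B) e

  tight-end : ∀ {k x y y′ L} → y ≤ℤ y′ → Tight k x y L → Tight k x y′ L
  tight-end y≤ [] = []
  tight-end y≤ (snoc a<n 0<i i≤n x≤a i≤y C B e) = snoc a<n 0<i i≤n x≤a (ZP.≤-trans i≤y y≤) C B e

  tight-start : ∀ {k x x′ y L} → x′ ≤ℤ x → Tight k x y L → Tight k x′ y L
  tight-start x≤ [] = []
  tight-start x≤ (snoc a<n 0<i i≤n x≤a i≤y C B e) = snoc a<n 0<i i≤n (ZP.≤-trans x≤ x≤a) i≤y (tight-start x≤ C) B e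

  tight-nonempty : ∀ {k x y L} → Tight k x y L → L ≡ [] ⊎ x <ℤ y
  tight-nonempty [] = inj₁ refl
  tight-nonempty (snoc {a} {i} a<n 0<i i≤n x≤a i≤y C B e) =
    inj₂ (ZP.≤-<-trans x≤a (ZP.<-≤-trans (subst (_<ℤ val a i) (val-zero a) (val-mono-< a 0<i)) i≤y))

  tight-empty : ∀ {k x y L} → y ≤ℤ x → Tight k x y L → L ≡ []
  tight-empty y≤x C with tight-nonempty C
  ... | inj₁ e = e
  ... | inj₂ lt = contradiction lt (ZP.≤⇒≯ y≤x)

  tight-++ : ∀ {k x y z L L′} → x ≤ℤ y → y ≤ℤ z → Tight k x y L → Tight k y z L′ → Tight k x z (L ++ L′)
  tight-++ {k} {x} {y} {z} {L} x≤y y≤z C [] = subst (Tight k x z) (sym (LP.++-identityʳ L)) (tight-end y≤z C)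
  tight-++ {k} {x} {y} {z} {L} x≤y y≤z C (snoc {L = L₁} {L′ = L₂} a<n 0<i i≤n y≤a i≤z D B e) =
    subst (Tight k x z) (LP.++-assoc L L₁ L₂) (snoc a<n 0<i i≤n (ZP.≤-trans x≤y y≤a) i≤z (tight-++ x≤y y≤a C D) B e)

  -- Fullness of the blocks is forgotten here, and the end time `y` is traded for a position `s`
  -- beyond every grid point that is at most `y`.
  tight⇒chain : ∀ {k x y s L} → Tight k x y L → (∀ a i → a < n → i ≤ n → val a i ≤ℤ y → pos a i < s) → Chain k x s L
  tight⇒chain [] f = []
  tight⇒chain (snoc {a} {i} a<n 0<i i≤n x≤a i≤y C B e) f = snoc a<n 0<i i≤n x≤a (f a i a<n i≤n i≤y)
    (tight⇒chain C (λ b k b<n k≤n le → ≤⇒pos<top b k a 0 b<n k≤n a<n z≤n (subst (val b k ≤ℤ_) (sym (val-zero a)) le))) B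

  tight⇒chain-top : ∀ {k x y a i L} → a < n → i ≤ n → y ≤ℤ val a i → Tight k x y L → Chain k x (top a i) L
  tight⇒chain-top {a = a} {i} a<n i≤n y≤ C =
    tight⇒chain C (λ b k b<n k≤n le → ≤⇒pos<top b k a i b<n k≤n a<n i≤n (ZP.≤-trans le y≤))

  -- The outcome of adding the job j to a chain: a new block starts at rel a, absorbs the jobs J that
  -- precede the first idle time after rel j as well as the jobs K after it, and leaves the rest untouched.
  record Insertion (k : ℕ) (x y : ℤ) (j : ℕ) (L : List ℕ) : Set where
    field
      {P J K U} : List ℕ
      a h i : ℕ
      e    : ℤ
      a<n  : a < n
      x≤a  : x ≤ℤ rel a
      a≤j  : rel a ≤ℤ rel j
      j≤h  : rel j ≤ℤ val a h
      h≤y  : val a h ≤ℤ y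
      e≤i  : e ≤ℤ val a i
      e≤y  : e ≤ℤ y
      prefix   : Tight k x (rel a) P
      partJ    : Tight k (rel a) (val a h) J
      partK    : Tight k (sucℤ (val a h)) e K
      suffix   : Tight k (val a i) y U
      |J|≡h    : length J ≡ h
      i≡       : i ≡ suc (h + length K)
      L≡       : L ≡ P ++ J ++ K ++ U

  -- Recursion from the last block backwards. If this block ends by `rel j`, then `j` opens a block
  -- of its own; if it contains `rel j`, it grows by `j`; if it starts later, `j` goes among the
  -- earlier blocks, and the last block is absorbed only if the grown block overruns its start.
  insert-job : ∀ {k x y j L} → j < n → x ≤ℤ rel j → rel j ≤ℤ y → Tight k x y L → Insertion k x y j L
  insert-job {k} {x} {y} {j} j<n x≤j j≤y [] = record
    { a = j ; h = 0 ; i = 1 ; e = rel j ; a<n = j<n ; x≤a = x≤j ; a≤j = ZP.≤-refl ; j≤h = rel≤val j 0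
    ; h≤y = subst (_≤ℤ y) (sym (val-zero j)) j≤y ; e≤i = rel≤val j 1 ; e≤y = j≤y
    ; prefix = [] ; partJ = [] ; partK = [] ; suffix = [] ; |J|≡h = refl ; i≡ = refl ; L≡ = refl }
  insert-job {k} {x} {y} {j} j<n x≤j j≤y (snoc {b} {q} {L} {L′} b<n 0<q q≤n x≤b q≤y C B |L′|)
    with val b q ZP.≤? rel j | rel b ZP.≤? rel j
  ... | yes q≤j | _ = record
    { P = L ++ L′ ; J = [] ; K = [] ; U = []
    ; a = j ; h = 0 ; i = 1 ; e = rel j ; a<n = j<n ; x≤a = x≤j ; a≤j = ZP.≤-refl ; j≤h = rel≤val j 0
    ; h≤y = subst (_≤ℤ y) (sym (val-zero j)) j≤y ; e≤i = rel≤val j 1 ; e≤y = j≤y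
    ; prefix = snoc b<n 0<q q≤n x≤b q≤j C B |L′| ; partJ = [] ; partK = [] ; suffix = [] ; |J|≡h = refl ; i≡ = refl
    ; L≡ = sym (LP.++-identityʳ (L ++ L′)) }
  ... | no q≰j | yes b≤j = record
    { P = L ; J = L′ ; K = [] ; U = []
    ; a = b ; h = q ; i = suc q ; e = rel b ; a<n = b<n ; x≤a = x≤b ; a≤j = b≤j ; j≤h = ZP.<⇒≤ (ZP.≰⇒> q≰j)
    ; h≤y = q≤y ; e≤i = rel≤val b (suc q) ; e≤y = ZP.≤-trans (rel≤val b q) q≤y
    ; prefix = C ; partJ = snoc b<n 0<q q≤n ZP.≤-refl ZP.≤-refl [] B |L′| ; partK = [] ; suffix = []
    ; |J|≡h = |L′| ; i≡ = cong suc (sym (NP.+-identityʳ q)) ; L≡ = cong (L ++_) (sym (LP.++-identityʳ L′)) }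
  ... | no q≰j | no b≰j = extend (insert-job j<n x≤j (ZP.<⇒≤ (ZP.≰⇒> b≰j)) C)
    where
    b≤y : rel b ≤ℤ y
    b≤y = ZP.≤-trans (rel≤val b q) q≤y
    extend : Insertion k x (rel b) j L → Insertion k x y j (L ++ L′)
    extend ι = go (val a i ZP.≤? rel b) (ZP.<-cmp (val a h) (rel b))
      where
      open Insertion ι
      end : ∀ c → rel b <ℤ val a c → val b q ≤ℤ val a (c + q)
      end c b<c = subst (val b q ≤ℤ_) (sym (val-+ a c q)) (ZP.+-monoˡ-≤ (+ (q * p)) (ZP.<⇒≤ b<c))
      L≡′ : ∀ W → U ≡ [] → W ≡ P ++ J ++ K ++ L′ → L ++ L′ ≡ W
      L≡′ W e e′ = begin
        L ++ L′                       ≡⟨ cong (_++ L′) L≡ ⟩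
        (P ++ J ++ K ++ U) ++ L′      ≡⟨ cong (λ z → (P ++ J ++ K ++ z) ++ L′) e ⟩
        (P ++ J ++ K ++ []) ++ L′     ≡⟨ cong (λ z → (P ++ J ++ z) ++ L′) (LP.++-identityʳ K) ⟩
        (P ++ J ++ K) ++ L′           ≡⟨ LP.++-assoc P (J ++ K) L′ ⟩
        P ++ (J ++ K) ++ L′           ≡⟨ cong (P ++_) (LP.++-assoc J K L′) ⟩
        P ++ J ++ K ++ L′             ≡⟨ sym e′ ⟩
        W                             ∎
        where open ≡-Reasoning
      go : Dec (val a i ≤ℤ rel b) → _ → Insertion k x y j (L ++ L′)
      go (yes i≤b) _ = record
        { P = P ; J = J ; K = K ; U = U ++ L′
        ; a = a ; h = h ; i = i ; e = e ; a<n = a<n ; x≤a = x≤a ; a≤j = a≤j ; j≤h = j≤h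
        ; h≤y = ZP.≤-trans h≤y b≤y ; e≤i = e≤i ; e≤y = ZP.≤-trans e≤y b≤y
        ; prefix = prefix ; partJ = partJ ; partK = partK ; suffix = snoc b<n 0<q q≤n i≤b q≤y suffix B |L′|
        ; |J|≡h = |J|≡h ; i≡ = i≡
        ; L≡ = trans (cong (_++ L′) L≡) (trans (LP.++-assoc P _ L′) (cong (P ++_)
            (trans (LP.++-assoc J _ L′) (cong (J ++_) (LP.++-assoc K U L′))))) }
      go (no i≰b) (tri> _ _ b<h) = contradiction h≤y (ZP.<⇒≱ b<h)
      -- The unit `val a h` stays idle before this block, so its jobs join `K`. The new end
      -- `val a (i + q)` covers `val b q` because `rel b` lies before `val a i`.
      go (no i≰b) (tri< h<b _ _) = record
        { P = P ; J = J ; K = K ++ L′ ; U = []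
        ; a = a ; h = h ; i = i + q ; e = val b q ; a<n = a<n ; x≤a = x≤a ; a≤j = a≤j ; j≤h = j≤h
        ; h≤y = ZP.≤-trans h≤y b≤y ; e≤i = end i (ZP.≰⇒> i≰b) ; e≤y = q≤y
        ; prefix = prefix ; partJ = partJ
        ; partK = snoc b<n 0<q q≤n (ZP.i<j⇒suc[i]≤j h<b) ZP.≤-refl (tight-end e≤y partK) B |L′| ; suffix = []
        ; |J|≡h = |J|≡h
        ; i≡ = trans (cong (_+ q) i≡) (cong suc (trans (NP.+-assoc h (length K) q)
            (cong (λ z → h + z) (trans (cong (λ z → length K + z) (sym |L′|)) (sym (LP.length-++ K))))))
        ; L≡ = L≡′ _ (tight-empty (ZP.<⇒≤ (ZP.≰⇒> i≰b)) suffix) (cong (λ z → P ++ J ++ z) (LP.++-identityʳ (K ++ L′))) }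
      -- The block follows `J` without a gap, so it prolongs `J` and the idle time moves on to
      -- `val a (h + q)`. The old `K` is empty, since it would have to lie strictly after `val a h`
      -- and end by `rel b`, which are the same time.
      go (no i≰b) (tri≈ _ h≡b _) = record
        { P = P ; J = J ++ L′ ; K = [] ; U = []
        ; a = a ; h = h + q ; i = suc (h + q) ; e = rel b ; a<n = a<n ; x≤a = x≤a ; a≤j = a≤j
        ; j≤h = ZP.≤-trans j≤h (val-mono-≤ a (NP.m≤m+n h q))
        ; h≤y = subst (_≤ℤ y) h+q q≤y
        ; e≤i = ZP.≤-trans (ZP.≤-reflexive (sym h≡b)) (val-mono-≤ a (NP.≤-trans (NP.m≤m+n h q) (NP.n≤1+n _))) ; e≤y = b≤y
        ; prefix = prefix
        ; partJ = snoc b<n 0<q q≤n (subst (rel a ≤ℤ_) h≡b (rel≤val a h)) (ZP.≤-reflexive h+q)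
                    (subst (λ z → Tight k (rel a) z J) h≡b partJ) B |L′|
        ; partK = [] ; suffix = []
        ; |J|≡h = trans (LP.length-++ J) (cong₂ _+_ |J|≡h |L′|)
        ; i≡ = cong suc (sym (NP.+-identityʳ (h + q)))
        ; L≡ = L≡′ _ (tight-empty (ZP.<⇒≤ (ZP.≰⇒> i≰b)) suffix)
            (trans (cong (P ++_) (trans (LP.++-identityʳ (J ++ L′)) refl))
              (cong (λ z → P ++ J ++ z ++ L′) (sym K≡[]))) }
        where
        h+q : val b q ≡ val a (h + q)
        h+q = trans (cong (_+ℤ + (q * p)) (sym h≡b)) (sym (val-+ a h q))
        K≡[] : K ≡ []
        K≡[] = tight-empty (ZP.≤-trans e≤y (ZP.≤-trans (ZP.≤-reflexive (sym h≡b)) (ZP.i≤suc[i] (val a h)))) partK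

  record Completing (Q : ℕ → Set) : Set where
    field
      units     : ℕ → List ℤ
      |units|   : ∀ j → Q j → length (units j) ≡ p
      units-unique : ∀ j → Q j → Unique (units j)
      window    : ∀ j → Q j → All (λ t → rel j ≤ℤ t × t <ℤ dl j) (units j)
      units-disjoint : ∀ i j → Q i → Q j → i ≢ j → ∀ {t} → t ∈ units i → t ∉ units j

  module FromSchedule {Q : ℕ → Set} (Q? : ∀ j → Dec (Q j)) (Q⇒<n : ∀ {j} → Q j → j < n) (σ : Completing Q) where
    open Completing σ

    all-units : List ℕ → List ℤ
    all-units = concatMap units

    length-all-units : ∀ {L} → All Q L → length (all-units L) ≡ length L * p
    length-all-units [] = refl
    length-all-units {j ∷ L} (q ∷ qs) = trans (LP.length-++ (units j)) (cong₂ _+_ (|units| j q) (length-all-units qs))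

    ∈-all-units⁻ : ∀ {L t} → t ∈ all-units L → ∃[ j ] j ∈ L × t ∈ units j
    ∈-all-units⁻ {j ∷ L} t∈ with MemP.∈-++⁻ (units j) t∈
    ... | inj₁ q = j , here refl , q
    ... | inj₂ q with ∈-all-units⁻ {L} q
    ...   | i , i∈ , t∈i = i , there i∈ , t∈i

    unique-all-units : ∀ {L} → Unique L → All Q L → Unique (all-units L)
    unique-all-units [] [] = []
    unique-all-units {j ∷ L} (j∉ ∷ u) (q ∷ qs) = UniqueP.++⁺ (units-unique j q) (unique-all-units u qs)
      (λ { (t∈ , t∈′) → let (i , i∈ , t∈i) = ∈-all-units⁻ {L} t∈′ in
           units-disjoint j i q (All.lookup qs i∈) (All.lookup j∉ i∈) t∈ t∈i })

    -- The units of the jobs in `L` are distinct and lie in their windows, all of which are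
    -- contained in the interval from `x` to `y`. This count is the only information about the given
    -- schedule that the insertion of a job uses.
    hall : ∀ {x y L} → 0 < length L → Unique L → All Q L → All (λ j → x ≤ℤ rel j × dl j ≤ℤ y) L →
      x +ℤ + (length L * p) ≤ℤ y
    hall {x} {y} {L} 0<L u qs w = subst (λ q → x +ℤ + q ≤ℤ y) (length-all-units qs)
      (length-window-≤ (subst (0 <_) (sym (length-all-units qs)) (NP.*-mono-≤ 0<L 0<p)) (unique-all-units u qs)
        (All.tabulate λ t∈ → let (j , j∈ , t∈j) = ∈-all-units⁻ {L} t∈
                                 (r≤t , t<d) = All.lookup (window j (All.lookup qs j∈)) t∈j
                                 (x≤r , d≤y) = All.lookup w j∈ in
          ZP.≤-trans x≤r r≤t , ZP.<-≤-trans t<d d≤y))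


    -- All jobs present have smaller deadline rank, so `j` has the latest deadline in its new block.
    -- The block consists of `i` jobs released from `rel a` on with deadlines up to `dl j`, and
    -- `hall` turns this into `val a i ≤ dl j`. The end time may grow, because no later job limits
    -- the block.
    insert-tight : ∀ {x y j L} → Q j → x ≤ℤ rel j → Unique L → All Q L → All (λ l → jrk l < jrk j) L →
      Tight (jrk j) x y L → ∃[ L′ ] ∃[ y′ ] (L′ ↭ j ∷ L × Tight (suc (jrk j)) x y′ L′)
    insert-tight {x} {y} {j} {L} Qj x≤j u qs lows C =
      (P ++ j ∷ J ++ K) ++ U , y′ , perm ,
      tight-++ (ZP.≤-trans x≤a (rel≤val a i)) (ZP.i≤j⊔i y₀ (val a i))
        (snoc a<n 0<i i≤n x≤a ZP.≤-refl (tight-mono (NP.n≤1+n _) prefix) blockj |Bl|)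
        (tight-end (ZP.i≤i⊔j y₀ (val a i)) (tight-mono (NP.n≤1+n _) suffix))
      where
      j<n = Q⇒<n Qj
      -- The insertion needs an end that is not before `rel j`; the maximum with `val a i` below
      -- makes room for a block that overruns this end.
      y₀ = y Int.⊔ rel j
      open Insertion (insert-job j<n x≤j (ZP.i≤j⊔i y (rel j)) (tight-end (ZP.i≤i⊔j y (rel j)) C))
      y′ = y₀ Int.⊔ val a i
      0<i : 0 < i
      0<i = subst (0 <_) (sym i≡) (s≤s z≤n)
      h<i : h < i
      h<i = subst (h <_) (sym i≡) (s≤s (NP.m≤m+n h _))
      on-JK : ∀ {R : ℕ → Set} → All R L → All R (J ++ K)
      on-JK rs with AllP.++⁻ P (subst (All _) L≡ rs)
      ... | _ , rest with AllP.++⁻ J rest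
      ...   | rJ , rest′ = AllP.++⁺ rJ (proj₁ (AllP.++⁻ K rest′))
      unique-JK : Unique (J ++ K)
      unique-JK = unique-takeˡ (J ++ K) (subst Unique (sym (LP.++-assoc J K U)) (unique-dropˡ P (subst Unique L≡ u)))
      Bl = j ∷ J ++ K
      unique-Bl : Unique Bl
      unique-Bl = All.map (λ lt e → NP.<⇒≢ lt (cong jrk (sym e))) (on-JK lows) ∷ unique-JK
      |Bl| : length Bl ≡ i
      |Bl| = trans (cong suc (trans (LP.length-++ J) (cong (_+ length K) |J|≡h))) (sym i≡)
      -- The grid has only the indices up to `n`. They suffice because a full block of length `i`
      -- contains `i` distinct jobs.
      i≤n : i ≤ n
      i≤n = subst (_≤ n) |Bl| (length-bounded unique-Bl (j<n ∷ All.map Q⇒<n (on-JK qs)))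
      h≤n = NP.≤-trans (NP.<⇒≤ h<i) i≤n
      CJ : Chain (jrk j) (rel a) (top a h) J
      CJ = tight⇒chain-top a<n h≤n ZP.≤-refl partJ
      CK : Chain (jrk j) (sucℤ (val a h)) (top a i) K
      CK = tight⇒chain-top a<n i≤n e≤i partK
      i≤d : val a i ≤ℤ dl j
      i≤d = subst (λ q → rel a +ℤ + (q * p) ≤ℤ dl j) |Bl| (hall (s≤s z≤n) unique-Bl (Qj ∷ on-JK qs)
        ((a≤j , ZP.≤-refl) ∷ All.zipWith (λ { ((r , ln) , lt) → r , jrk⇒≤ _ j ln j<n lt })
          (All.zipWith id (AllP.++⁺ (All.map (λ q → proj₁ (proj₂ (proj₂ q))) (chain-jobs CJ))
            (All.map (λ q → ZP.≤-trans (rel≤val a h) (ZP.<⇒≤ (suc≤⇒< (proj₁ (proj₂ (proj₂ q)))))) (chain-jobs CK)) ,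
            All.map Q⇒<n (on-JK qs)) , on-JK lows)))
      blockj : Block (suc (jrk j)) a i Bl
      blockj = block j<n NP.≤-refl h<i a≤j j≤h i≤d CJ CK
      perm : (P ++ Bl) ++ U ↭ j ∷ L
      perm = ↭-trans (↭-reflexive (LP.++-assoc P Bl U)) (↭-trans (PermP.shift j P ((J ++ K) ++ U))
        (prep j (↭-reflexive (trans (cong (P ++_) (LP.++-assoc J K U)) (sym L≡)))))

    record Optimal (x : ℤ) (k : ℕ) : Set where
      field
        {L}   : List ℕ
        {y}   : ℤ
        uniq  : Unique L
        ⊆Q    : All (λ j → Q j × jrk j < k) L
        Q⊆    : ∀ {j} → Q j → jrk j < k → j ∈ L
        tight : Tight k x y L

    -- Induction on the deadline rank. Ranks are injective, so each step either finds no job of `Q`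
    -- with rank `k` or inserts the unique one.
    tight-of-schedule : ∀ {x} → (∀ j → j < n → x ≤ℤ rel j) → ∀ k → Optimal x k
    tight-of-schedule {x} x≤ zero = record { L = [] ; y = x ; uniq = [] ; ⊆Q = [] ; Q⊆ = λ _ () ; tight = [] }
    tight-of-schedule {x} x≤ (suc k) with tight-of-schedule x≤ k | NP.anyUpTo? (λ j → Q? j ×-dec (jrk j NP.≟ k)) n
    ... | o | no ∄ = record { uniq = uniq ; ⊆Q = All.map (λ { (q , lt) → q , NP.m<n⇒m<1+n lt }) ⊆Q
                            ; Q⊆ = new ; tight = tight-mono (NP.n≤1+n k) tight }
      where
      open Optimal o
      new : ∀ {j} → Q j → jrk j < suc k → j ∈ L
      new {j} q lt with NP.m≤n⇒m<n∨m≡n (NP.≤-pred lt)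
      ... | inj₁ l = Q⊆ q l
      ... | inj₂ e = contradiction (j , Q⇒<n q , q , e) ∄
    ... | o | yes (j , j<n , Qj , refl)
      with insert-tight Qj (x≤ j j<n) (Optimal.uniq o) (All.map proj₁ (Optimal.⊆Q o)) (All.map proj₂ (Optimal.⊆Q o)) (Optimal.tight o)
    ...   | L′ , y′ , perm , T′ = record
      { uniq = PermS.Unique-resp-↭ (setoid ℕ) (Perm.↭⇒↭ₛ (↭-sym perm)) (All.map (λ { (_ , lt) e → NP.<⇒≢ lt (cong jrk (sym e)) }) ⊆Q ∷ uniq)
      ; ⊆Q = PermP.All-resp-↭ (↭-sym perm) ((Qj , NP.≤-refl) ∷ All.map (λ { (q , lt) → q , NP.m<n⇒m<1+n lt }) ⊆Q)
      ; Q⊆ = λ q lt → PermP.∈-resp-↭ (↭-sym perm) (new q lt)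
      ; tight = T′ }
      where
      open Optimal o
      new : ∀ {l} → Q l → jrk l < suc (jrk j) → l ∈ j ∷ L
      new {l} q lt with NP.m≤n⇒m<n∨m≡n (NP.≤-pred lt)
      ... | inj₁ l< = there (Q⊆ q l<)
      ... | inj₂ e = here (jrk-inj l j (Q⇒<n q) j<n e)

    chain-of-schedule : ∀ {x} → (∀ j → j < n → x ≤ℤ rel j) →
      ∃[ L ] (Unique L × (∀ {j} → j ∈ L → Q j) × (∀ {j} → Q j → j ∈ L) × Chain n x M L)
    chain-of-schedule x≤ = L , uniq , (λ j∈ → proj₁ (All.lookup ⊆Q j∈)) , (λ q → Q⊆ q (jrk<n _ (Q⇒<n q))) ,
      tight⇒chain tight (λ a i a<n i≤n _ → pos<M a i a<n i≤n)
      where open Optimal (tight-of-schedule x≤ n)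

-- A structured language and its compilation to the random access machine

data Bound : Set where
  #jobs #rows #cells : Bound

bounds : ℕ → ℕ → Bound → ℕ
bounds n M #jobs  = n
bounds n M #rows  = suc n
bounds n M #cells = M

Column : Set
Column = Fin 30

data Loc : Set where
  sc  : ℕ → Loc
  arr : Column → ℕ → Loc
  raw : ℕ → Loc

State : Set
State = Loc → ℤ

_≡ᴸ_ : Loc → Loc → Bool
sc x    ≡ᴸ sc y    = x ≡ᵇ y
arr c i ≡ᴸ arr d j = (toℕ c ≡ᵇ toℕ d) ∧ (i ≡ᵇ j)
raw a   ≡ᴸ raw b   = a ≡ᵇ b
_       ≡ᴸ _       = false

infixl 6 _[_↦_]
_[_↦_] : State → Loc → ℤ → State
(s [ l ↦ v ]) l′ = if l′ ≡ᴸ l then v else s l′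

data Exp : Set where
  num        : ℤ → Exp
  var        : ℕ → Exp
  plus minus : Exp → ℕ → Exp
  get        : Column → Exp → Exp
  input      : Exp → Exp

infixr 4 _⨾_
infix 5 _≔_ _[_]≔_

data Com : Set where
  skip   : Com
  _≔_    : ℕ → Exp → Com
  _[_]≔_ : Column → ℕ → Exp → Com
  output : ℕ → Exp → Com
  if≤    : ℕ → Exp → Com → Com → Com
  for    : Bound → ℕ → Com → Com
  _⨾_    : Com → Com → Com

iterate : {A : Set} → ℕ → (ℕ → A → A) → A → A
iterate zero    f a = a
iterate (suc N) f a = f N (iterate N f a)

-- Registers 0 … 4 are scratch space, and register 0 holds B = 5 + b.  The input and the output occupy
-- registers below B, the variables those from B on.
module Semantics (b : ℕ) (β : Bound → ℕ) where

  B : ℕ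
  B = 5 + b

  -- Accesses to input and output take effect only at addresses from 5 up to `B`, so no command can
  -- reach the scratch registers or the variables through them. A rejected read yields the address
  -- itself, because skipping the load leaves the address in register 1.
  guarded : ℤ → ℤ → ℤ → ℤ
  guarded v x y = if + 5 ≤ᵇℤ v then (if + B ≤ᵇℤ v then x else y) else x

  eval : State → Exp → ℤ
  eval s (num z)     = z
  eval s (var x)     = s (sc x)
  eval s (plus E x)  = eval s E +ℤ s (sc x)
  eval s (minus E x) = eval s E -ℤ s (sc x)
  eval s (get c E)   = s (arr c ∣ eval s E ∣)
  eval s (input E)   = guarded (eval s E) (eval s E) (s (raw ∣ eval s E ∣))

  ⟦_⟧ : Com → State → State
  ⟦ skip ⟧ s         = s
  ⟦ x ≔ E ⟧ s        = s [ sc x ↦ eval s E ]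
  ⟦ c [ x ]≔ E ⟧ s   = s [ arr c ∣ s (sc x) ∣ ↦ eval s E ]
  ⟦ output x E ⟧ s   =
    if + 5 ≤ᵇℤ s (sc x) then (if + B ≤ᵇℤ s (sc x) then s else s [ raw ∣ s (sc x) ∣ ↦ eval s E ]) else s
  ⟦ if≤ x E C D ⟧ s  = if s (sc x) ≤ᵇℤ eval s E then ⟦ C ⟧ s else ⟦ D ⟧ s
  ⟦ for d x C ⟧ s    = iterate (β d) (λ i s → ⟦ C ⟧ (s [ sc x ↦ + i ])) s
  ⟦ C ⨾ D ⟧ s        = ⟦ D ⟧ (⟦ C ⟧ s)

-- Memory layout and code generation

Mem : Set
Mem = ℕ → ℤ

-- Recursion on the list, rather than `o + length is`, makes the end of a concrete instruction list
-- reduce to successors of `o`, in agreement with the jump targets in the code.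
end : ℕ → List Instr → ℕ
end o []       = o
end o (_ ∷ is) = end (suc o) is

At : Program → ℕ → List Instr → Set
At P o []       = ⊤
At P o (i ∷ is) = fetch P o ≡ i × At P (suc o) is

end-++ : ∀ o xs ys → end o (xs ++ ys) ≡ end (end o xs) ys
end-++ o []       ys = refl
end-++ o (x ∷ xs) ys = end-++ (suc o) xs ys

at-++ : ∀ {P} o xs {ys} → At P o (xs ++ ys) → At P o xs × At P (end o xs) ys
at-++ o []       a       = tt , a
at-++ o (x ∷ xs) (e , a) = let (p , q) = at-++ (suc o) xs a in (e , p) , q

row : Bound → ℕ
row #jobs  = 0
row #rows  = 1
row #cells = 2

-- Each row of the area above B has 32 columns: column 0 holds the variables, columns 1 … 30 the arrays,
-- and column 31 the values of the loop bounds (rows 0 … 2) and the loop counters (one row per nesting depth).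
cell : ℕ → ℕ → ℕ
cell i c = i * 32 + c

hidden : ℕ → ℕ
hidden k = cell k 31

loadCell : ℕ → ℕ → List Instr
loadCell q k = const q (+ k) ∷ add q 0 q ∷ load q q ∷ []

-- The first three instructions replace the contents of q by their absolute value.
addressOf : ℕ → ℕ → ℕ → List Instr
addressOf o q c =
  const 3 0ℤ ∷ jle 3 q (3 + o) ∷ sub q 3 q ∷
  add q q q ∷ add q q q ∷ add q q q ∷ add q q q ∷ add q q q ∷ add q 0 q ∷ const 3 (+ c) ∷ add q q 3 ∷ []

-- The value ends up in register 1, with registers 2 and 3 as scratch. Code is generated for its
-- absolute position `o`, since jumps have absolute targets; `jle 0 0` is an unconditional jump.
codeᴱ : ℕ → Exp → List Instr
codeᴱ o (num z)     = const 1 z ∷ []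
codeᴱ o (var x)     = loadCell 1 (cell x 0)
codeᴱ o (plus E x)  = codeᴱ o E ++ loadCell 2 (cell x 0) ++ add 1 1 2 ∷ []
codeᴱ o (minus E x) = codeᴱ o E ++ loadCell 2 (cell x 0) ++ sub 1 1 2 ∷ []
codeᴱ o (get c E)   = codeᴱ o E ++ addressOf (end o (codeᴱ o E)) 1 (suc (toℕ c)) ++ load 1 1 ∷ []
codeᴱ o (input E)   = codeᴱ o E ++
  (let o′ = end o (codeᴱ o E) in const 2 (+ 5) ∷ jle 2 1 (3 + o′) ∷ jle 0 0 (5 + o′) ∷ jle 0 1 (5 + o′) ∷ load 1 1 ∷ [])

-- The nesting depth `δ` selects the cell of the loop counter. This cell is no location of the
-- source language, so a body may assign to the loop variable without disturbing the iteration.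
code : ℕ → ℕ → Com → List Instr
code δ o skip         = []
code δ o (x ≔ E)      = codeᴱ o E ++ const 2 (+ (cell x 0)) ∷ add 2 0 2 ∷ store 2 1 ∷ []
code δ o (c [ x ]≔ E) = codeᴱ o E ++ loadCell 2 (cell x 0) ++
  addressOf (3 + end o (codeᴱ o E)) 2 (suc (toℕ c)) ++ store 2 1 ∷ []
code δ o (output x E) = codeᴱ o E ++ loadCell 2 (cell x 0) ++
  (let o′ = 3 + end o (codeᴱ o E) in const 3 (+ 5) ∷ jle 3 2 (3 + o′) ∷ jle 0 0 (5 + o′) ∷ jle 0 2 (5 + o′) ∷ store 2 1 ∷ [])
code δ o (if≤ x E C D) = codeᴱ o E ++ loadCell 2 (cell x 0) ++ jle 2 1 (suc o₂) ∷ (code δ o₁ D ++ jle 0 0 o₃ ∷ code δ (suc o₂) C)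
  where
  o₁ = 4 + end o (codeᴱ o E)
  o₂ = end o₁ (code δ o₁ D)
  o₃ = end (suc o₂) (code δ (suc o₂) C)
code δ o (for d x C) =
  const 1 0ℤ ∷ const 2 (+ (hidden (3 + δ))) ∷ add 2 0 2 ∷ store 2 1 ∷
  (loadCell 1 (hidden (row d)) ++ loadCell 2 (hidden (3 + δ)) ++
   jle 1 2 (7 + o₂) ∷ const 1 (+ (cell x 0)) ∷ add 1 0 1 ∷ store 1 2 ∷ (code (suc δ) o₁ C ++
   const 2 (+ (hidden (3 + δ))) ∷ add 2 0 2 ∷ load 1 2 ∷ const 3 1ℤ ∷ add 1 1 3 ∷ store 2 1 ∷ jle 0 0 (4 + o) ∷ []))
  where
  o₁ = 14 + o
  o₂ = end o₁ (code (suc δ) o₁ C)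
code δ o (C ⨾ D) = code δ o C ++ code δ (end o (code δ o C)) D

costᴱ : Exp → ℕ
costᴱ (num _)     = 1
costᴱ (var _)     = 3
costᴱ (plus E _)  = costᴱ E + 4
costᴱ (minus E _) = costᴱ E + 4
costᴱ (get _ E)   = costᴱ E + 12
costᴱ (input E)   = costᴱ E + 4

cost : (Bound → ℕ) → Com → ℕ
cost β skip         = 0
cost β (x ≔ E)      = costᴱ E + 3
cost β (c [ x ]≔ E) = costᴱ E + 15
cost β (output x E) = costᴱ E + 7
cost β (if≤ x E C D) = costᴱ E + (5 + (cost β C + cost β D))
-- Outside the iterations: 4 instructions to clear the counter and 7 for the last test. In each
-- iteration: 7 for the test, 3 to set the loop variable, 7 to increment the counter and jump back.
cost β (for d x C)  = 11 + β d * (cost β C + 17)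
cost β (C ⨾ D)      = cost β C + cost β D

update-same : ∀ (m : Mem) a v → update m a v a ≡ v
update-same m a v with a ≡ᵇ a | NP.≡⇒≡ᵇ a a refl
... | true | _ = refl

update-other : ∀ (m : Mem) {a c} v → c ≢ a → update m a v c ≡ m c
update-other m {a} {c} v c≢a with c ≡ᵇ a in eq
... | false = refl
... | true  = contradiction (NP.≡ᵇ⇒≡ c a (subst T (sym eq) tt)) c≢a

bool-≡ : ∀ {x y} → (T x → T y) → (T y → T x) → x ≡ y
bool-≡ {false} {false} f g = refl
bool-≡ {true}  {true}  f g = refl
bool-≡ {false} {true}  f g = ⊥-elim (g tt)
bool-≡ {true}  {false} f g = ⊥-elim (f tt)

cell-injective : ∀ {i c j d} → c < 32 → d < 32 → cell i c ≡ cell j d → i ≡ j × c ≡ d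
cell-injective {i} {c} {j} {d} c< d< e = NP.*-cancelʳ-≡ i j 32 (NP.+-cancelʳ-≡ c (i * 32) (j * 32)
    (trans e (cong (λ z → j * 32 + z) (sym c≡d)))) , c≡d
  where
  open import Data.Nat.DivMod using (_%_; [m+kn]%n≡m%n; m<n⇒m%n≡m)
  rem : ∀ k c → c < 32 → cell k c % 32 ≡ c
  rem k c c< = trans (cong (_% 32) (NP.+-comm (k * 32) c)) (trans ([m+kn]%n≡m%n c k 32) (m<n⇒m%n≡m c<))
  c≡d : c ≡ d
  c≡d = trans (sym (rem i c c<)) (trans (cong (_% 32) e) (rem j d d<))

col<32 : ∀ (c : Column) → suc (toℕ c) < 32
col<32 c = NP.m<n⇒m<1+n (s≤s (FP.toℕ<n c))

col≢31 : ∀ (c : Column) → suc (toℕ c) ≢ 31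
col≢31 c e = NP.<⇒≢ (FP.toℕ<n c) (NP.suc-injective e)

-- Simulation of states by register contents

module Simulation (b : ℕ) (β : Bound → ℕ) where
  open Semantics b β

  InRange : Loc → Set
  InRange (raw a) = 5 ≤ a × a < B
  InRange _       = ⊤

  addr : Loc → ℕ
  addr (sc x)    = B + cell x 0
  addr (arr c i) = B + cell i (suc (toℕ c))
  addr (raw a)   = a

  -- Injectivity of `addr` in Boolean form: after rewriting, the update of a state and the update of
  -- the memory branch on the same test.
  addr-≡ᴸ : ∀ l l′ → InRange l → InRange l′ → (l ≡ᴸ l′) ≡ (addr l ≡ᵇ addr l′)
  addr-≡ᴸ (sc x) (sc y) _ _ = bool-≡
    (λ q → NP.≡⇒≡ᵇ _ _ (cong (λ z → b + cell z 0) (NP.≡ᵇ⇒≡ x y q)))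
    (λ q → NP.≡⇒≡ᵇ _ _ (proj₁ (cell-injective {x} {0} {y} {0} (s≤s z≤n) (s≤s z≤n) (NP.+-cancelˡ-≡ b _ _ (NP.≡ᵇ⇒≡ _ _ q)))))
  addr-≡ᴸ (sc x) (arr c i) _ _ = bool-≡ (λ ())
    (λ q → NP.0≢1+n (proj₂ (cell-injective {x} {0} {i} (s≤s z≤n) (col<32 c) (NP.+-cancelˡ-≡ b _ _ (NP.≡ᵇ⇒≡ _ _ q)))))
  addr-≡ᴸ (arr c i) (sc x) _ _ = bool-≡ (λ ())
    (λ q → NP.1+n≢0 (proj₂ (cell-injective {i} {_} {x} {0} (col<32 c) (s≤s z≤n) (NP.+-cancelˡ-≡ b _ _ (NP.≡ᵇ⇒≡ _ _ q)))))
  addr-≡ᴸ (arr c i) (arr d j) _ _ = bool-≡ to from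
    where
    to : T ((toℕ c ≡ᵇ toℕ d) ∧ (i ≡ᵇ j)) → T (b + cell i (suc (toℕ c)) ≡ᵇ b + cell j (suc (toℕ d)))
    to q with toℕ c ≡ᵇ toℕ d in e | i ≡ᵇ j in e′
    ... | true | true = NP.≡⇒≡ᵇ (b + cell i (suc (toℕ c))) _ (cong₂ (λ i z → b + cell i (suc z))
      (NP.≡ᵇ⇒≡ i j (subst T (sym e′) tt)) (NP.≡ᵇ⇒≡ (toℕ c) (toℕ d) (subst T (sym e) tt)))
    from : T (b + cell i (suc (toℕ c)) ≡ᵇ b + cell j (suc (toℕ d))) → T ((toℕ c ≡ᵇ toℕ d) ∧ (i ≡ᵇ j))
    from q with cell-injective {i} {suc (toℕ c)} {j} {suc (toℕ d)} (col<32 c) (col<32 d)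
                  (NP.+-cancelˡ-≡ b _ _ (NP.≡ᵇ⇒≡ (b + cell i (suc (toℕ c))) _ q))
    ... | refl , e with toℕ c ≡ᵇ toℕ d | NP.≡⇒≡ᵇ _ _ (NP.suc-injective e) | i ≡ᵇ i | NP.≡⇒≡ᵇ i i refl
    ...   | true | _ | true | _ = tt
  addr-≡ᴸ (raw a) (raw a′) _ _ = refl
  addr-≡ᴸ (raw a) (sc x) (_ , a<B) _ = bool-≡ (λ ()) (λ q → NP.<⇒≢ (NP.<-≤-trans a<B (NP.m≤m+n B _)) (NP.≡ᵇ⇒≡ a _ q))
  addr-≡ᴸ (raw a) (arr c i) (_ , a<B) _ = bool-≡ (λ ()) (λ q → NP.<⇒≢ (NP.<-≤-trans a<B (NP.m≤m+n B _)) (NP.≡ᵇ⇒≡ a _ q))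
  addr-≡ᴸ (sc x) (raw a) _ (_ , a<B) = bool-≡ (λ ()) (λ q → NP.<⇒≢ (NP.<-≤-trans a<B (NP.m≤m+n B _)) (sym (NP.≡ᵇ⇒≡ _ a q)))
  addr-≡ᴸ (arr c i) (raw a) _ (_ , a<B) = bool-≡ (λ ()) (λ q → NP.<⇒≢ (NP.<-≤-trans a<B (NP.m≤m+n B _)) (sym (NP.≡ᵇ⇒≡ _ a q)))

  hidden≢addr : ∀ k l → InRange l → B + hidden k ≢ addr l
  hidden≢addr k (sc x) _ e = NP.1+n≢0 (proj₂ (cell-injective {k} {31} {x} {0} NP.≤-refl (s≤s z≤n) (NP.+-cancelˡ-≡ B _ _ e)))
  hidden≢addr k (arr c i) _ e = col≢31 c (sym (proj₂ (cell-injective {k} {31} {i} NP.≤-refl (col<32 c) (NP.+-cancelˡ-≡ B _ _ e))))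
  hidden≢addr k (raw a) (_ , a<B) e = NP.<⇒≢ (NP.<-≤-trans a<B (NP.m≤m+n B _)) (sym e)

  hidden-injective : ∀ {k k′} → B + hidden k ≡ B + hidden k′ → k ≡ k′
  hidden-injective {k} {k′} e = proj₁ (cell-injective {k} {31} {k′} NP.≤-refl NP.≤-refl (NP.+-cancelˡ-≡ B _ _ e))

  record _∼_ (s : State) (m : Mem) : Set where
    field
      base  : m 0 ≡ + B
      cells : ∀ l → InRange l → m (addr l) ≡ s l
  open _∼_

  addr-high : ∀ l → InRange l → ∃[ a ] addr l ≡ 5 + a
  addr-high (sc x)    _ = _ , refl
  addr-high (arr c i) _ = _ , refl
  addr-high (raw a) (5≤a , _) = a ∸ 5 , sym (NP.m+[n∸m]≡n 5≤a)

  -- Agreement outside the scratch registers 1 … 4.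
  record _≈_ (m m′ : Mem) : Set where
    constructor agree
    field
      base≈ : m 0 ≡ m′ 0
      high≈ : ∀ a → m (5 + a) ≡ m′ (5 + a)

  ≈-trans : ∀ {m m′ m″} → m ≈ m′ → m′ ≈ m″ → m ≈ m″
  ≈-trans (agree p q) (agree p′ q′) = agree (trans p p′) λ a → trans (q a) (q′ a)

  ∼-≈ : ∀ {s m m′} → s ∼ m → m′ ≈ m → s ∼ m′
  ∼-≈ {s} {m} {m′} r (agree e es) = record
    { base = trans e (base r)
    ; cells = λ l i → let (a , q) = addr-high l i in trans (subst (λ z → m′ z ≡ m z) (sym q) (es a)) (cells r l i) }

  ∼-update : ∀ {s m} l v → InRange l → s ∼ m → (s [ l ↦ v ]) ∼ update m (addr l) v
  ∼-update {s} {m} l v i r = record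
    { base = trans (update-other m v (low l i)) (base r)
    ; cells = go }
    where
    low : ∀ l → InRange l → 0 ≢ addr l
    low l i e with addr-high l i
    ... | a , q = NP.0≢1+n (trans e q)
    go : ∀ l′ → InRange l′ → update m (addr l) v (addr l′) ≡ (s [ l ↦ v ]) l′
    go l′ i′ rewrite addr-≡ᴸ l′ l i′ i with addr l′ ≡ᵇ addr l
    ... | true  = refl
    ... | false = cells r l′ i′

-- Timed execution of code segments

run-+ : ∀ P t t′ c → run P (t + t′) c ≡ run P t′ (run P t c)
run-+ P zero    t′ c = refl
run-+ P (suc t) t′ c = run-+ P t t′ (step P c)

-- A Hoare triple for one starting memory, with a time bound. The time is bounded and not fixed, so
-- that branches of different length fit under one `τ`.
record Exec (P : Program) (o : ℕ) (m : Mem) (o′ : ℕ) (τ : ℕ) (Post : Mem → Set) : Set where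
  constructor exec′
  field
    time   : ℕ
    time≤  : time ≤ τ
    memory : Mem
    runs   : run P time (cfg o m) ≡ cfg o′ memory
    post   : Post memory

infixr 2 _▹_
_▹_ : ∀ {P o m o₁ o₂ τ₁ τ₂ Q R} → Exec P o m o₁ τ₁ Q → (∀ m′ → Q m′ → Exec P o₁ m′ o₂ τ₂ R) → Exec P o m o₂ (τ₁ + τ₂) R
_▹_ {P} {o} {m} (exec′ t t≤ m′ e q) f with f m′ q
... | exec′ t₂ t₂≤ m″ e₂ r = exec′ (t + t₂) (NP.+-mono-≤ t≤ t₂≤) m″ (trans (run-+ P t t₂ (cfg o m)) (trans (cong (run P t₂) e) e₂)) r

weaken : ∀ {P o m o′ τ τ′ Q R} → τ ≤ τ′ → (∀ {m′} → Q m′ → R m′) → Exec P o m o′ τ Q → Exec P o m o′ τ′ R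
weaken le f (exec′ t t≤ m′ e q) = exec′ t (NP.≤-trans t≤ le) m′ e (f q)

at-pc : ∀ {P o m o₁ o₂ τ Q} → o₁ ≡ o₂ → Exec P o m o₁ τ Q → Exec P o m o₂ τ Q
at-pc refl x = x

done : ∀ {P o m τ} {Q : Mem → Set} → Q m → Exec P o m o τ Q
done q = exec′ 0 z≤n _ refl q

Straight : List Instr → Set
Straight []              = ⊤
Straight (jle _ _ _ ∷ _) = ⊥
Straight (halt ∷ _)      = ⊥
Straight (_ ∷ is)        = Straight is

effects : List Instr → Mem → Mem
effects []       m = m
effects (i ∷ is) m = effects is (mem (exec i (cfg 0 m)))

module Correctness (b : ℕ) (β : Bound → ℕ) (P : Program) where
  open Semantics b β
  open Simulation b β
  open _∼_

  -- For a concrete list `effects` evaluates, so that most postconditions of straight-line code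
  -- follow by matching on `refl`.
  straight : ∀ is {o m} → {st : Straight is} → At P o is → Exec P o m (end o is) (length is) (_≡ effects is m)
  straight [] _ = done refl
  straight (const a v ∷ is) {o} {m} {st} (e , at) = one ▹ λ { _ refl → straight is {st = st} at }
    where
    one : Exec P o m (suc o) 1 (_≡ mem (exec (const a v) (cfg 0 m)))
    one = exec′ 1 NP.≤-refl _ (cong (λ i → exec i (cfg o m)) e) refl
  straight (add a v w ∷ is) {o} {m} {st} (e , at) = one ▹ λ { _ refl → straight is {st = st} at }
    where
    one : Exec P o m (suc o) 1 (_≡ mem (exec (add a v w) (cfg 0 m)))
    one = exec′ 1 NP.≤-refl _ (cong (λ i → exec i (cfg o m)) e) refl
  straight (sub a v w ∷ is) {o} {m} {st} (e , at) = one ▹ λ { _ refl → straight is {st = st} at }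
    where
    one : Exec P o m (suc o) 1 (_≡ mem (exec (sub a v w) (cfg 0 m)))
    one = exec′ 1 NP.≤-refl _ (cong (λ i → exec i (cfg o m)) e) refl
  straight (load a v ∷ is) {o} {m} {st} (e , at) = one ▹ λ { _ refl → straight is {st = st} at }
    where
    one : Exec P o m (suc o) 1 (_≡ mem (exec (load a v) (cfg 0 m)))
    one = exec′ 1 NP.≤-refl _ (cong (λ i → exec i (cfg o m)) e) refl
  straight (store a v ∷ is) {o} {m} {st} (e , at) = one ▹ λ { _ refl → straight is {st = st} at }
    where
    one : Exec P o m (suc o) 1 (_≡ mem (exec (store a v) (cfg 0 m)))
    one = exec′ 1 NP.≤-refl _ (cong (λ i → exec i (cfg o m)) e) refl

  jump-≤ : ∀ {o m x y l} → fetch P o ≡ jle x y l → T (m x ≤ᵇℤ m y) → Exec P o m l 1 (λ m′ → m′ ≡ m)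
  jump-≤ {o} {m} {x} {y} {l} e q = exec′ 1 NP.≤-refl m go refl
    where
    go : exec (fetch P o) (cfg o m) ≡ cfg l m
    go rewrite e with m x ≤ᵇℤ m y
    ... | true = refl

  jump-≰ : ∀ {o m x y l} → fetch P o ≡ jle x y l → ¬ T (m x ≤ᵇℤ m y) → Exec P o m (suc o) 1 (λ m′ → m′ ≡ m)
  jump-≰ {o} {m} {x} {y} {l} e q = exec′ 1 NP.≤-refl m go refl
    where
    go : exec (fetch P o) (cfg o m) ≡ cfg (suc o) m
    go rewrite e with m x ≤ᵇℤ m y
    ... | true  = ⊥-elim (q tt)
    ... | false = refl

  jump : ∀ {o m x l} → fetch P o ≡ jle x x l → Exec P o m l 1 (λ m′ → m′ ≡ m)
  jump {m = m} {x} e = jump-≤ e (ZP.≤⇒≤ᵇ (ZP.≤-refl {m x}))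

  branch : ∀ {o m x y l o′ τ Q} → fetch P o ≡ jle x y l →
    (T (m x ≤ᵇℤ m y) → Exec P l m o′ τ Q) → (¬ T (m x ≤ᵇℤ m y) → Exec P (suc o) m o′ τ Q) → Exec P o m o′ (1 + τ) Q
  branch {o} {m} {x} {y} e f g with m x ≤ᵇℤ m y in eq
  ... | true  = jump-≤ e (subst T (sym eq) tt) ▹ λ { _ refl → f tt }
  ... | false = jump-≰ e (λ q → subst T eq q) ▹ λ { _ refl → g (λ ()) }

  guarded-high : ∀ v {x y} → T (+ 5 ≤ᵇℤ v) → T (+ B ≤ᵇℤ v) → guarded v x y ≡ x
  guarded-high v p q with + 5 ≤ᵇℤ v | + B ≤ᵇℤ v
  ... | true | true = refl

  guarded-mid : ∀ v {x y} → T (+ 5 ≤ᵇℤ v) → ¬ T (+ B ≤ᵇℤ v) → guarded v x y ≡ y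
  guarded-mid v p q with + 5 ≤ᵇℤ v | + B ≤ᵇℤ v
  ... | true | true  = ⊥-elim (q tt)
  ... | true | false = refl

  guarded-low : ∀ v {x y} → ¬ T (+ 5 ≤ᵇℤ v) → guarded v x y ≡ x
  guarded-low v p with + 5 ≤ᵇℤ v
  ... | true  = ⊥-elim (p tt)
  ... | false = refl

  in-range : ∀ v → T (+ 5 ≤ᵇℤ v) → ¬ T (+ B ≤ᵇℤ v) → InRange (raw ∣ v ∣)
  in-range v p q = ZP.drop‿+≤+ (subst (+ 5 ≤ℤ_) (sym v≡) 5≤v) ,
    NP.≰⇒> (λ B≤ → q (ZP.≤⇒≤ᵇ (subst (+ B ≤ℤ_) v≡ (+≤+ B≤))))
    where
    5≤v : + 5 ≤ℤ v
    5≤v = ZP.≤ᵇ⇒≤ p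
    v≡ : + ∣ v ∣ ≡ v
    v≡ = ZP.0≤i⇒+∣i∣≡i (ZP.≤-trans (+≤+ z≤n) 5≤v)

  load₁ : ∀ {o m} k → m 0 ≡ + B → At P o (loadCell 1 k) → Exec P o m (3 + o) 3 (λ m′ → m′ 1 ≡ m (B + k) × m′ ≈ m)
  load₁ {o} {m} k base at = weaken NP.≤-refl
    (λ { refl → cong (λ z → update (update m 1 (+ k)) 1 (m 0 +ℤ + k) ∣ z +ℤ + k ∣) base , agree refl (λ _ → refl) }) (straight (loadCell 1 k) at)

  load₂ : ∀ {o m} k → m 0 ≡ + B → At P o (loadCell 2 k) →
    Exec P o m (3 + o) 3 (λ m′ → m′ 2 ≡ m (B + k) × m′ 1 ≡ m 1 × m′ ≈ m)
  load₂ {o} {m} k base at = weaken NP.≤-refl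
    (λ { refl → cong (λ z → update (update m 2 (+ k)) 2 (m 0 +ℤ + k) ∣ z +ℤ + k ∣) base , refl , agree refl (λ _ → refl) }) (straight (loadCell 2 k) at)

  scratch₁ : ∀ {m v} → update m 1 v ≈ m
  scratch₁ = agree refl (λ _ → refl)

  -- This is `32 v`, where 32 is the number of columns in a row; the five doublings in `addressOf`
  -- replace a multiplication, which the machine does not have.
  double⁵ : ℤ → ℤ
  double⁵ v = let v₁ = v +ℤ v; v₂ = v₁ +ℤ v₁; v₃ = v₂ +ℤ v₂; v₄ = v₃ +ℤ v₃ in v₄ +ℤ v₄

  cell-address : ∀ {v k c w} → v ≡ + k → w ≡ + B → (w +ℤ double⁵ v) +ℤ + c ≡ + (B + cell k c)
  cell-address {k = k} {c} refl refl = cong (λ z → + (5 + z)) (lemma b k c)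
    where
    lemma : ∀ b k c → b + (((k + k + (k + k)) + (k + k + (k + k)) + ((k + k + (k + k)) + (k + k + (k + k)))) + ((k + k + (k + k)) + (k + k + (k + k)) + ((k + k + (k + k)) + (k + k + (k + k))))) + c ≡ b + (k * 32 + c)
    lemma = NatSolver.solve-∀

  ∣∣-≥0 : ∀ {v} → T (0ℤ ≤ᵇℤ v) → v ≡ + ∣ v ∣
  ∣∣-≥0 {v} q = sym (ZP.0≤i⇒+∣i∣≡i (ZP.≤ᵇ⇒≤ q))

  ∣∣-<0 : ∀ {v} → ¬ T (0ℤ ≤ᵇℤ v) → 0ℤ -ℤ v ≡ + ∣ v ∣
  ∣∣-<0 { + n}         q = ⊥-elim (q tt)
  ∣∣-<0 { Int.-[1+ n ]} q = refl

  address₁ : ∀ {o m} c → m 0 ≡ + B → At P o (addressOf o 1 c) →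
    Exec P o m (11 + o) 11 (λ m′ → m′ 1 ≡ + (B + cell ∣ m 1 ∣ c) × m′ ≈ m)
  address₁ {o} {m} c base (e₀ , e₁ , e₂ , e₃ , e₄ , e₅ , e₆ , e₇ , e₈ , e₉ , e₁₀ , _) =
    absolute
    ▹ λ { m′ (q₁ , q) → weaken NP.≤-refl (λ { refl → cell-address q₁ (trans (_≈_.base≈ q) base) , agree (_≈_.base≈ q) (_≈_.high≈ q) })
        (straight _ (e₃ , e₄ , e₅ , e₆ , e₇ , e₈ , e₉ , e₁₀ , tt)) }
    where
    absolute : Exec P o m (3 + o) 3 (λ m′ → m′ 1 ≡ + ∣ m 1 ∣ × m′ ≈ m)
    absolute = straight (const 3 0ℤ ∷ []) (e₀ , tt) ▹ λ { _ refl → branch e₁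
      (λ t → done (∣∣-≥0 t , agree refl (λ _ → refl)))
      (λ f → weaken NP.≤-refl (λ { refl → ∣∣-<0 {m 1} f , agree refl (λ _ → refl) }) (straight (sub 1 3 1 ∷ []) (e₂ , tt))) }

  address₂ : ∀ {o m} c → m 0 ≡ + B → At P o (addressOf o 2 c) →
    Exec P o m (11 + o) 11 (λ m′ → m′ 2 ≡ + (B + cell ∣ m 2 ∣ c) × m′ 1 ≡ m 1 × m′ ≈ m)
  address₂ {o} {m} c base (e₀ , e₁ , e₂ , e₃ , e₄ , e₅ , e₆ , e₇ , e₈ , e₉ , e₁₀ , _) =
    absolute
    ▹ λ { m′ (q₁ , q) → weaken NP.≤-refl (λ { refl → cell-address q₁ (trans (_≈_.base≈ (proj₂ q)) base) , proj₁ q , agree (_≈_.base≈ (proj₂ q)) (_≈_.high≈ (proj₂ q)) })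
        (straight _ (e₃ , e₄ , e₅ , e₆ , e₇ , e₈ , e₉ , e₁₀ , tt)) }
    where
    absolute : Exec P o m (3 + o) 3 (λ m′ → m′ 2 ≡ + ∣ m 2 ∣ × m′ 1 ≡ m 1 × m′ ≈ m)
    absolute = straight (const 3 0ℤ ∷ []) (e₀ , tt) ▹ λ { _ refl → branch e₁
      (λ t → done (∣∣-≥0 t , refl , agree refl (λ _ → refl)))
      (λ f → weaken NP.≤-refl (λ { refl → ∣∣-<0 {m 2} f , refl , agree refl (λ _ → refl) }) (straight (sub 2 3 2 ∷ []) (e₂ , tt))) }

  Evaluates : State → Exp → Mem → Mem → Set
  Evaluates s E m m′ = m′ 1 ≡ eval s E × m′ ≈ m

  evaluates : ∀ E {o s m} → s ∼ m → At P o (codeᴱ o E) → Exec P o m (end o (codeᴱ o E)) (costᴱ E) (Evaluates s E m)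
  evaluates (num z) r (e , _) = weaken NP.≤-refl (λ { refl → refl , agree refl (λ _ → refl) }) (straight _ (e , tt))
  evaluates (var x) r at = weaken NP.≤-refl (λ { (q , a) → trans q (cells r (sc x) tt) , a }) (load₁ (cell x 0) (base r) at)
  evaluates (plus E x) {o} {s} {m} r at with at-++ {P} o (codeᴱ o E) at
  ... | atE , e₀ , e₁ , e₂ , e₃ , _ = at-pc (sym (end-++ o (codeᴱ o E) _)) (evaluates E r atE
    ▹ λ { m₁ (v , a) → load₂ (cell x 0) (base (∼-≈ r a)) (e₀ , e₁ , e₂ , tt)
    ▹ λ { m₂ (q , q₁ , a₂) → weaken NP.≤-refl
      (λ { refl → cong₂ _+ℤ_ (trans q₁ v) (trans q (cells (∼-≈ r a) (sc x) tt)) , ≈-trans (agree refl λ _ → refl) (≈-trans a₂ a) }) (straight _ (e₃ , tt)) }})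
  evaluates (minus E x) {o} {s} {m} r at with at-++ {P} o (codeᴱ o E) at
  ... | atE , e₀ , e₁ , e₂ , e₃ , _ = at-pc (sym (end-++ o (codeᴱ o E) _)) (evaluates E r atE
    ▹ λ { m₁ (v , a) → load₂ (cell x 0) (base (∼-≈ r a)) (e₀ , e₁ , e₂ , tt)
    ▹ λ { m₂ (q , q₁ , a₂) → weaken NP.≤-refl
      (λ { refl → cong₂ _-ℤ_ (trans q₁ v) (trans q (cells (∼-≈ r a) (sc x) tt)) , ≈-trans (agree refl λ _ → refl) (≈-trans a₂ a) }) (straight _ (e₃ , tt)) }})
  evaluates (get c E) {o} {s} {m} r at with at-++ {P} o (codeᴱ o E) at
  ... | atE , at′ with at-++ {P} (end o (codeᴱ o E)) (addressOf (end o (codeᴱ o E)) 1 (suc (toℕ c))) at′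
  ...   | atA , e₃ , _ = at-pc (sym (end-++ o (codeᴱ o E) _)) (evaluates E r atE
    ▹ λ { m₁ (v , a) → address₁ (suc (toℕ c)) (base (∼-≈ r a)) atA
    ▹ λ { m₂ (q , a₂) → weaken NP.≤-refl
      (λ { refl → trans (cong (λ z → m₂ ∣ z ∣) q) (trans (cells (∼-≈ r (≈-trans a₂ a)) (arr c ∣ m₁ 1 ∣) tt) (cong (λ z → s (arr c ∣ z ∣)) v)) , ≈-trans scratch₁ (≈-trans a₂ a) })
      (straight _ (e₃ , tt)) }})
  evaluates (input E) {o} {s} {m} r at with at-++ {P} o (codeᴱ o E) at
  ... | atE , e₀ , e₁ , e₂ , e₃ , e₄ , _ = at-pc (sym (end-++ o (codeᴱ o E) _)) (evaluates E r atE ▹ access)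
    where
    access : ∀ m₁ → Evaluates s E m m₁ → Exec P (end o (codeᴱ o E)) m₁ (5 + end o (codeᴱ o E)) 4 (Evaluates s (input E) m)
    access m₁ (v , a) = straight (const 2 (+ 5) ∷ []) (e₀ , tt)
      ▹ λ { _ refl → branch e₁
        (λ 5≤ → branch e₃
          (λ B≤ → done (trans v (sym (guarded-high (eval s E) (5≤′ 5≤) (B≤′ B≤))) , a₂))
          (λ B≰ → weaken NP.≤-refl (λ { refl → trans
              (trans (cong (λ z → update m₁ 2 (+ 5) ∣ z ∣) v) (trans (read (in-range (eval s E) (5≤′ 5≤) (λ q → B≰ (B≤″ q)))) (cells (∼-≈ {m′ = m₁} r a) (raw ∣ eval s E ∣) (in-range (eval s E) (5≤′ 5≤) (λ q → B≰ (B≤″ q))))))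
              (sym (guarded-mid (eval s E) (5≤′ 5≤) (λ q → B≰ (B≤″ q)))) , ≈-trans scratch₁ a₂ })
            (straight (load 1 1 ∷ []) (e₄ , tt))))
        (λ 5≰ → weaken (s≤s z≤n) (λ { refl → trans v (sym (guarded-low (eval s E) (λ q → 5≰ (subst (λ z → T (+ 5 ≤ᵇℤ z)) (sym v) q)))) , a₂ }) (jump e₂)) }
      where
      a₂ : update m₁ 2 (+ 5) ≈ m
      a₂ = ≈-trans (agree refl λ _ → refl) a
      base₁ : m₁ 0 ≡ + B
      base₁ = base (∼-≈ r a)
      5≤′ : T (+ 5 ≤ᵇℤ m₁ 1) → T (+ 5 ≤ᵇℤ eval s E)
      5≤′ = subst (λ z → T (+ 5 ≤ᵇℤ z)) v
      B≤′ : T (m₁ 0 ≤ᵇℤ m₁ 1) → T (+ B ≤ᵇℤ eval s E)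
      B≤′ = subst₂ (λ y z → T (y ≤ᵇℤ z)) base₁ v
      B≤″ : T (+ B ≤ᵇℤ eval s E) → T (m₁ 0 ≤ᵇℤ m₁ 1)
      B≤″ = subst₂ (λ y z → T (y ≤ᵇℤ z)) (sym base₁) (sym v)
      read : ∀ {c} → InRange (raw c) → update m₁ 2 (+ 5) c ≡ m₁ c
      read (s≤s (s≤s (s≤s _)) , _) = refl

-- Correctness of the compiled commands

module Commands (b : ℕ) (β : Bound → ℕ) (P : Program) where
  open Semantics b β
  open Simulation b β
  open Correctness b β P
  open _∼_

  hid : Mem → ℕ → ℤ
  hid m k = m (B + hidden k)

  Rows : Mem → Set
  Rows m = ∀ d → hid m (row d) ≡ + β d

  -- The hidden cells below `3 + δ` are the three loop bounds and the counters of the loops around a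
  -- command of depth `δ`.
  record Keeps (δ : ℕ) (m m′ : Mem) : Set where
    constructor kept
    field
      keep : ∀ k → k < 3 + δ → hid m′ k ≡ hid m k
  open Keeps

  keeps-trans : ∀ {δ m m′ m″} → Keeps δ m m′ → Keeps δ m′ m″ → Keeps δ m m″
  keeps-trans (kept f) (kept g) = kept λ k k< → trans (g k k<) (f k k<)

  keeps-suc : ∀ {δ m m′} → Keeps (suc δ) m m′ → Keeps δ m m′
  keeps-suc (kept f) = kept λ k k< → f k (NP.m<n⇒m<1+n k<)

  rows-keep : ∀ {δ m m′} → Keeps δ m m′ → Rows m → Rows m′
  rows-keep {δ} f rows d = trans (keep f (row d) (NP.≤-trans (row<3 d) (NP.m≤m+n 3 δ))) (rows d)
    where
    row<3 : ∀ d → row d < 3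
    row<3 #jobs  = s≤s z≤n
    row<3 #rows  = s≤s (s≤s z≤n)
    row<3 #cells = s≤s (s≤s (s≤s z≤n))

  hid-≈ : ∀ {m m′} → m′ ≈ m → ∀ k → hid m′ k ≡ hid m k
  hid-≈ q k = _≈_.high≈ q (b + hidden k)

  keeps-update : ∀ {δ m} l v → InRange l → Keeps δ m (update m (addr l) v)
  keeps-update {m = m} l v i = kept λ k _ → update-other m v (hidden≢addr k l i)

  keeps-≈ : ∀ {δ m m′} → m′ ≈ m → Keeps δ m m′
  keeps-≈ q = kept λ k _ → hid-≈ q k

  ∼-hidden : ∀ {s m} k v → s ∼ m → s ∼ update m (B + hidden k) v
  ∼-hidden {m = m} k v r = record
    { base = base r
    ; cells = λ l i → trans (update-other m v (λ e → hidden≢addr k l i (sym e))) (cells r l i) }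

  Result : ℕ → State → Mem → Mem → Set
  Result δ s m m′ = s ∼ m′ × Keeps δ m m′

  store-loc : ∀ {δ s m m₁ m′ v} l → InRange l → s ∼ m → m₁ ≈ m → v ≡ m₁ 1 → m₁ 2 ≡ + addr l →
    m′ ≡ update m₁ ∣ m₁ 2 ∣ (m₁ 1) → Result δ (s [ l ↦ v ]) m m′
  store-loc {δ} {s} {m} {m₁} l i r a refl e refl rewrite e =
    ∼-update l (m₁ 1) i (∼-≈ r a) , keeps-trans {δ} {m} (keeps-≈ {δ} a) (keeps-update {δ} {m₁} l (m₁ 1) i)

  -- Induction on the command. The conjunct `Keeps` of the result is what lets a surrounding loop
  -- find its counter and its bound intact after the body.
  executes : ∀ C δ {o s m} → s ∼ m → Rows m → At P o (code δ o C) →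
    Exec P o m (end o (code δ o C)) (cost β C) (Result δ (⟦ C ⟧ s) m)
  executes skip δ r rows at = done (r , kept (λ _ _ → refl))
  executes (x ≔ E) δ {o} {s} {m} r rows at with at-++ {P} o (codeᴱ o E) at
  ... | atE , at′ = at-pc (sym (end-++ o (codeᴱ o E) _)) (evaluates E r atE
    ▹ λ { m₁ (v , a) → weaken NP.≤-refl
      (λ { refl → store-loc {δ} {m₁ = update (update m₁ 2 (+ cell x 0)) 2 (m₁ 0 +ℤ + cell x 0)} (sc x) tt r
          (≈-trans (agree refl λ _ → refl) a) (sym v) (cong (_+ℤ + cell x 0) (base (∼-≈ r a))) refl })
      (straight (const 2 (+ (cell x 0)) ∷ add 2 0 2 ∷ store 2 1 ∷ []) at′) })
  executes (c [ x ]≔ E) δ {o} {s} {m} r rows at with at-++ {P} o (codeᴱ o E) at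
  ... | atE , e₀ , e₁ , e₂ , at′ with at-++ {P} (3 + end o (codeᴱ o E)) (addressOf (3 + end o (codeᴱ o E)) 2 (suc (toℕ c))) at′
  ...   | atA , atS = at-pc (sym (end-++ o (codeᴱ o E) _)) (evaluates E r atE
    ▹ λ { m₁ (v , a) → load₂ (cell x 0) (base (∼-≈ r a)) (e₀ , e₁ , e₂ , tt)
    ▹ λ { m₂ (q , q₁ , a₂) → address₂ (suc (toℕ c)) (base (∼-≈ r (≈-trans a₂ a))) atA
    ▹ λ { m₃ (w , w₁ , a₃) → weaken NP.≤-refl
      (λ { refl → store-loc {δ} (arr c ∣ s (sc x) ∣) tt r (≈-trans a₃ (≈-trans a₂ a)) (sym (trans w₁ (trans q₁ v)))
          (trans w (cong (λ z → + (B + cell ∣ z ∣ (suc (toℕ c)))) (trans q (cells (∼-≈ r a) (sc x) tt)))) refl })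
      (straight (store 2 1 ∷ []) atS) }}})
  executes (output x E) δ {o} {s} {m} r rows at with at-++ {P} o (codeᴱ o E) at
  ... | atE , e₀ , e₁ , e₂ , f₀ , f₁ , f₂ , f₃ , f₄ , _ = at-pc (sym (end-++ o (codeᴱ o E) _)) (evaluates E r atE
    ▹ λ { m₁ (v , a) → load₂ (cell x 0) (base (∼-≈ r a)) (e₀ , e₁ , e₂ , tt)
    ▹ λ { m₂ (q , q₁ , a₂) → write m₂ (trans q₁ v) (trans q (cells (∼-≈ r a) (sc x) tt)) (≈-trans a₂ a) }})
    where
    o₁ = 3 + end o (codeᴱ o E)
    write : ∀ m₂ → m₂ 1 ≡ eval s E → m₂ 2 ≡ s (sc x) → m₂ ≈ m → Exec P o₁ m₂ (5 + o₁) 4 (Result δ (⟦ output x E ⟧ s) m)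
    write m₂ v w a = straight (const 3 (+ 5) ∷ []) (f₀ , tt)
      ▹ λ { _ refl → branch f₁
        (λ 5≤ → branch f₃
          (λ B≤ → done (unchanged (guarded-state (inj₁ (B≤′ B≤)))))
          (λ B≰ → weaken NP.≤-refl (λ { refl → subst (λ z → Result δ z m _) (sym (written (5≤′ 5≤) (λ z → B≰ (B≤″ z))))
              (store-loc {δ} {m₁ = update m₂ 3 (+ 5)} (raw ∣ s (sc x) ∣) (in-range (s (sc x)) (5≤′ 5≤) (λ z → B≰ (B≤″ z))) r a₃ (sym v)
                (trans w (sym (ZP.0≤i⇒+∣i∣≡i (ZP.≤-trans (+≤+ z≤n) (ZP.≤ᵇ⇒≤ (5≤′ 5≤)))))) refl) })
            (straight (store 2 1 ∷ []) (f₄ , tt))))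
        (λ 5≰ → weaken (s≤s z≤n) (λ { refl → unchanged (guarded-state (inj₂ (λ z → 5≰ (subst (λ z → T (+ 5 ≤ᵇℤ z)) (sym w) z)))) }) (jump f₂)) }
      where
      a₃ : update m₂ 3 (+ 5) ≈ m
      a₃ = ≈-trans (agree refl λ _ → refl) a
      base₁ : m₂ 0 ≡ + B
      base₁ = base (∼-≈ r a)
      5≤′ : T (+ 5 ≤ᵇℤ m₂ 2) → T (+ 5 ≤ᵇℤ s (sc x))
      5≤′ = subst (λ z → T (+ 5 ≤ᵇℤ z)) w
      B≤′ : T (m₂ 0 ≤ᵇℤ m₂ 2) → T (+ B ≤ᵇℤ s (sc x))
      B≤′ = subst₂ (λ y z → T (y ≤ᵇℤ z)) base₁ w
      B≤″ : T (+ B ≤ᵇℤ s (sc x)) → T (m₂ 0 ≤ᵇℤ m₂ 2)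
      B≤″ = subst₂ (λ y z → T (y ≤ᵇℤ z)) (sym base₁) (sym w)
      guarded-state : T (+ B ≤ᵇℤ s (sc x)) ⊎ ¬ T (+ 5 ≤ᵇℤ s (sc x)) → ⟦ output x E ⟧ s ≡ s
      guarded-state q with + 5 ≤ᵇℤ s (sc x) | + B ≤ᵇℤ s (sc x)
      guarded-state q | false | _ = refl
      guarded-state q | true | true = refl
      guarded-state (inj₂ q) | true | false = ⊥-elim (q tt)
      written : T (+ 5 ≤ᵇℤ s (sc x)) → ¬ T (+ B ≤ᵇℤ s (sc x)) → ⟦ output x E ⟧ s ≡ s [ raw ∣ s (sc x) ∣ ↦ eval s E ]
      written p q with + 5 ≤ᵇℤ s (sc x) | + B ≤ᵇℤ s (sc x)
      ... | true | false = refl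
      ... | true | true  = ⊥-elim (q tt)
      unchanged : ⟦ output x E ⟧ s ≡ s → Result δ (⟦ output x E ⟧ s) m (update m₂ 3 (+ 5))
      unchanged q = subst (λ z → Result δ z m _) (sym q) (∼-≈ r a₃ , keeps-≈ {δ} a₃)
  executes (if≤ x E C D) δ {o} {s} {m} r rows at with at-++ {P} o (codeᴱ o E) at
  ... | atE , e₀ , e₁ , e₂ , f , at′ with at-++ {P} (4 + end o (codeᴱ o E)) (code δ (4 + end o (codeᴱ o E)) D) at′
  ...   | atD , g , atC = at-pc (sym (trans (end-++ o (codeᴱ o E) _) (end-++ (4 + end o (codeᴱ o E)) (code δ (4 + end o (codeᴱ o E)) D) _)))
    (weaken (NP.+-monoʳ-≤ (costᴱ E) (NP.+-monoʳ-≤ 4 (NP.≤-reflexive (NP.+-suc (cost β C) (cost β D))))) id (evaluates E r atE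
    ▹ λ { m₁ (v , a) → load₂ (cell x 0) (base (∼-≈ r a)) (e₀ , e₁ , e₂ , tt)
    ▹ λ { m₂ (q , q₁ , a₂) → let a₂′ = ≈-trans a₂ a
                                 x≡  = trans q (cells (∼-≈ r a) (sc x) tt)
                                 E≡  = trans q₁ v
                                 k   = keeps-≈ {δ} a₂′ in
      branch f
        (λ t → weaken (NP.m≤m+n (cost β C) (1 + cost β D))
          (λ { (r′ , k′) → subst (_∼ _) (sym (then≡ (subst₂ (λ y z → T (y ≤ᵇℤ z)) x≡ E≡ t))) r′ , keeps-trans {δ} {m} k k′ })
          (executes C δ (∼-≈ r a₂′) (rows-keep {δ} k rows) atC))
        (λ ¬t → weaken (NP.≤-trans (NP.≤-reflexive (NP.+-comm (cost β D) 1)) (NP.m≤n+m (1 + cost β D) (cost β C)))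
          (λ { (r′ , k′) → subst (_∼ _) (sym (else≡ (λ t → ¬t (subst₂ (λ y z → T (y ≤ᵇℤ z)) (sym x≡) (sym E≡) t)))) r′ , keeps-trans {δ} {m} k k′ })
          (executes D δ (∼-≈ r a₂′) (rows-keep {δ} k rows) atD ▹ λ { m₃ p → weaken NP.≤-refl (λ { refl → p }) (jump g) })) }}))
    where
    then≡ : T (s (sc x) ≤ᵇℤ eval s E) → ⟦ if≤ x E C D ⟧ s ≡ ⟦ C ⟧ s
    then≡ t with s (sc x) ≤ᵇℤ eval s E
    ... | true = refl
    else≡ : ¬ T (s (sc x) ≤ᵇℤ eval s E) → ⟦ if≤ x E C D ⟧ s ≡ ⟦ D ⟧ s
    else≡ t with s (sc x) ≤ᵇℤ eval s E
    ... | true  = ⊥-elim (t tt)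
    ... | false = refl
  executes (C ⨾ D) δ {o} {s} {m} r rows at with at-++ {P} o (code δ o C) at
  ... | atC , atD = at-pc (sym (end-++ o (code δ o C) _)) (executes C δ r rows atC
    ▹ λ { m₁ (r₁ , k₁) → weaken NP.≤-refl (λ { (r₂ , k₂) → r₂ , keeps-trans {δ} {m} k₁ k₂ })
      (executes D δ r₁ (rows-keep {δ} k₁ rows) atD) })
  executes (for d x C) δ {o} {s} {m} r rows (i₀ , i₁ , i₂ , i₃ , l₀ , l₁ , l₂ , c₀ , c₁ , c₂ , t , x₀ , x₁ , x₂ , at)
    with at-++ {P} (14 + o) (code (suc δ) (14 + o) C) at
  ... | atC , n₀ , n₁ , n₂ , n₃ , n₄ , n₅ , j , _ = at-pc (sym (end-++ (14 + o) (code (suc δ) (14 + o) C) _))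
    (weaken (NP.≤-reflexive cost≡) id (straight (const 1 0ℤ ∷ const 2 (+ (hidden (3 + δ))) ∷ add 2 0 2 ∷ store 2 1 ∷ []) (i₀ , i₁ , i₂ , i₃ , tt)
    ▹ λ { _ refl → start }))
    where
    o₂ = end (14 + o) (code (suc δ) (14 + o) C)
    h = hidden (3 + δ)
    f : ℕ → State → State
    f i s = ⟦ C ⟧ (s [ sc x ↦ + i ])
    body = cost β C + 17
    cost≡ : 4 + (β d * body + 7) ≡ 11 + β d * body
    cost≡ = cong (λ z → 4 + z) (NP.+-comm (β d * body) 7)
    counter : Mem → ℤ
    counter m = hid m (3 + δ)
    Inv : ℕ → Mem → Set
    Inv i m′ = iterate i f s ∼ m′ × Keeps δ m m′ × counter m′ ≡ + i
    store-counter : ∀ {s m v} → s ∼ m → m 2 ≡ + (B + h) → m 1 ≡ v →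
      s ∼ update m ∣ m 2 ∣ (m 1) × Keeps δ m (update m ∣ m 2 ∣ (m 1)) × counter (update m ∣ m 2 ∣ (m 1)) ≡ v
    store-counter {m = m} {v} r e refl rewrite e =
      ∼-hidden (3 + δ) v r , kept (λ k k< → update-other m v (λ e → NP.<⇒≢ k< (hidden-injective {k} {3 + δ} e))) , update-same m (B + h) v
    -- Induction on the number `rem` of iterations left; the summand 7 pays for the test that leaves
    -- the loop.
    loop : ∀ rem i {m′} → i + rem ≡ β d → Inv i m′ →
      Exec P (4 + o) m′ (7 + o₂) (rem * body + 7) (Result δ (iterate (β d) f s) m)
    loop rem i {m′} e (r′ , k′ , ctr) = load₁ (hidden (row d)) (base r′) (l₀ , l₁ , l₂ , tt)
      ▹′ λ { m₁ (q , a) → load₂ h (base (∼-≈ r′ a)) (c₀ , c₁ , c₂ , tt)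
      ▹ λ { m₂ (p , p₁ , a₂) → test rem e m₂ (trans p₁ (trans q (rows-keep {δ} k′ rows d))) (trans p (trans (hid-≈ a (3 + δ)) ctr)) (≈-trans a₂ a) }}
      where
      infixr 2 _▹′_
      _▹′_ : ∀ {o m o₁ o₂ Q R} → Exec P o m o₁ 3 Q → (∀ m′ → Q m′ → Exec P o₁ m′ o₂ (3 + (1 + (rem * body))) R) → Exec P o m o₂ (rem * body + 7) R
      x ▹′ f = weaken (NP.≤-reflexive (NP.+-comm 7 (rem * body))) id (x ▹ f)
      test : ∀ rem → i + rem ≡ β d → ∀ m₂ → m₂ 1 ≡ + β d → m₂ 2 ≡ + i → m₂ ≈ m′ →
        Exec P (10 + o) m₂ (7 + o₂) (1 + rem * body) (Result δ (iterate (β d) f s) m)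
      test zero e m₂ v₁ v₂ a = weaken NP.≤-refl
        (λ { refl → subst (λ z → iterate z f s ∼ m₂) i≡ (∼-≈ r′ a) , keeps-trans {δ} {m} k′ (keeps-≈ {δ} a) })
        (jump-≤ t (subst₂ (λ y z → T (y ≤ᵇℤ z)) (sym v₁) (sym v₂) (ZP.≤⇒≤ᵇ (+≤+ (NP.≤-reflexive (sym i≡))))))
        where
        i≡ : i ≡ β d
        i≡ = trans (sym (NP.+-identityʳ i)) e
      test (suc rem) e m₂ v₁ v₂ a = jump-≰ t (λ q → NP.<⇒≱ (i<β) (ZP.drop‿+≤+ (ZP.≤ᵇ⇒≤ {+ β d} {+ i} (subst₂ (λ y z → T (y ≤ᵇℤ z)) v₁ v₂ q))))
        ▹ λ { _ refl → straight (const 1 (+ cell x 0) ∷ add 1 0 1 ∷ store 1 2 ∷ []) (x₀ , x₁ , x₂ , tt)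
        ▹″ λ { m₃ refl → next (set m₂ v₂ a) } }
        where
        i<β : i < β d
        i<β = subst (i <_) e (NP.m<m+n i (s≤s z≤n))
        infixr 2 _▹″_
        _▹″_ : ∀ {o m o₁ o₂ Q R} → Exec P o m o₁ 3 Q → (∀ m′ → Q m′ → Exec P o₁ m′ o₂ (cost β C + (7 + (rem * body + 7))) R) → Exec P o m o₂ (suc rem * body) R
        x ▹″ f = weaken (NP.≤-reflexive (arith (cost β C) (rem * (cost β C + 17)))) id (x ▹ f)
          where
          arith : ∀ c z → 3 + (c + (7 + (z + 7))) ≡ c + 17 + z
          arith = NatSolver.solve-∀
        stored : Mem → Mem
        stored m = effects (const 1 (+ cell x 0) ∷ add 1 0 1 ∷ store 1 2 ∷ []) m
        set : ∀ m₂ → m₂ 2 ≡ + i → m₂ ≈ m′ → (iterate i f s [ sc x ↦ + i ]) ∼ stored m₂ × Keeps (suc δ) m′ (stored m₂)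
        set m₂ v₂ a rewrite base (∼-≈ r′ a) | v₂ =
          let a′ = ≈-trans (agree {_} {m₂} refl λ _ → refl) a in
          ∼-update (sc x) (+ i) tt (∼-≈ r′ a′) , keeps-trans {suc δ} {m′} (keeps-≈ {suc δ} a′) (keeps-update {suc δ} (sc x) (+ i) tt)
        increment : ∀ m₄ → iterate (suc i) f s ∼ m₄ → counter m₄ ≡ + i → Keeps δ m m₄ →
          Inv (suc i) (effects (const 2 (+ h) ∷ add 2 0 2 ∷ load 1 2 ∷ const 3 1ℤ ∷ add 1 1 3 ∷ store 2 1 ∷ []) m₄)
        increment m₄ r₄ ctr₄ k₄ =
          let m₅ = effects (const 2 (+ h) ∷ add 2 0 2 ∷ load 1 2 ∷ const 3 1ℤ ∷ add 1 1 3 ∷ []) m₄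
              a′ = agree {m₅} {m₄} refl (λ _ → refl)
              at = cong (_+ℤ + h) (base r₄)
              (r₅ , k₅ , c₅) = store-counter (∼-≈ r₄ a′) at
                (cong (_+ℤ 1ℤ) (trans (cong (λ z → update (update m₄ 2 (+ h)) 2 (m₄ 0 +ℤ + h) ∣ z ∣) at) ctr₄)) in
          r₅ , keeps-trans k₄ (keeps-trans (keeps-≈ a′) k₅) , trans c₅ (cong +_ (NP.+-comm i 1))
        next : ∀ {m₃} → (iterate i f s [ sc x ↦ + i ]) ∼ m₃ × Keeps (suc δ) m′ m₃ →
          Exec P (14 + o) m₃ (7 + o₂) (cost β C + (7 + (rem * body + 7))) (Result δ (iterate (β d) f s) m)
        next {m₃} (r₃ , k₃) = executes C (suc δ) r₃ (rows-keep {δ} (keeps-suc k₃) (rows-keep {δ} k′ rows)) atC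
          ▹ λ { m₄ (r₄ , k₄) → straight (const 2 (+ h) ∷ add 2 0 2 ∷ load 1 2 ∷ const 3 1ℤ ∷ add 1 1 3 ∷ store 2 1 ∷ []) (n₀ , n₁ , n₂ , n₃ , n₄ , n₅ , tt)
          ▹ λ { _ refl → jump j
          ▹ λ { _ refl → loop rem (suc i) (trans (sym (NP.+-suc i rem)) e) (increment m₄ r₄
                (trans (keep k₄ (3 + δ) (NP.n<1+n _)) (trans (keep k₃ (3 + δ) (NP.n<1+n _)) ctr))
                (keeps-trans {δ} {m} k′ (keeps-trans {δ} {m′} (keeps-suc k₃) (keeps-suc k₄)))) } } }
    start : Exec P (4 + o) (effects (const 1 0ℤ ∷ const 2 (+ h) ∷ add 2 0 2 ∷ store 2 1 ∷ []) m) (7 + o₂) (β d * body + 7)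
      (Result δ (iterate (β d) f s) m)
    start = loop (β d) 0 refl init
      where
      init : Inv 0 (effects (const 1 0ℤ ∷ const 2 (+ h) ∷ add 2 0 2 ∷ store 2 1 ∷ []) m)
      init =
        let m₅ = effects (const 1 0ℤ ∷ const 2 (+ h) ∷ add 2 0 2 ∷ []) m
            a′ = agree {m₅} {m} refl (λ _ → refl)
            (r₅ , k₅ , c₅) = store-counter (∼-≈ r a′) (cong (_+ℤ + h) (base r)) refl in
        r₅ , keeps-trans (keeps-≈ a′) k₅ , c₅

-- The exponent and the constant of the running time

degree : Com → ℕ
degree (if≤ _ _ C D)   = degree C ⊔ degree D
degree (for #cells _ C) = 2 + degree C
degree (for _ _ C)     = 1 + degree C
degree (C ⨾ D)         = degree C ⊔ degree D
degree _               = 0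

-- This is `cost` with every loop bound set to 1. It does not depend on the instance and therefore
-- serves as the constant in front of the power.
factor : Com → ℕ
factor skip          = 0
factor (x ≔ E)       = costᴱ E + 3
factor (c [ x ]≔ E)  = costᴱ E + 15
factor (output x E)  = costᴱ E + 7
factor (if≤ x E C D) = costᴱ E + (5 + (factor C + factor D))
factor (for d x C)   = 11 + (factor C + 17)
factor (C ⨾ D)       = factor C + factor D

module CostBound (N : ℕ) (0<N : 0 < N) (β : Bound → ℕ)
  (β-jobs : β #jobs ≤ N) (β-rows : β #rows ≤ N) (β-cells : β #cells ≤ N * N) where

  instance
    N≢0 : Nat.NonZero N
    N≢0 = Nat.>-nonZero 0<N

  ≤-pow : ∀ a k → a ≤ a * N ^ k
  ≤-pow a k = NP.m≤m*n a (N ^ k) {{NP.m^n≢0 N k}}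

  raise : ∀ {x} a {k l} → k ≤ l → x ≤ a * N ^ k → x ≤ a * N ^ l
  raise a k≤l x≤ = NP.≤-trans x≤ (NP.*-monoʳ-≤ a (NP.^-monoʳ-≤ N k≤l))

  sum-≤ : ∀ {x y} a b k → x ≤ a * N ^ k → y ≤ b * N ^ k → x + y ≤ (a + b) * N ^ k
  sum-≤ a b k p q = NP.≤-trans (NP.+-mono-≤ p q) (NP.≤-reflexive (sym (NP.*-distribʳ-+ (N ^ k) a b)))

  loop-≤ : ∀ {x a B w} k → B ≤ N ^ w → x ≤ a * N ^ k → 11 + B * (x + 17) ≤ (11 + (a + 17)) * N ^ (w + k)
  loop-≤ {x} {a} {B} {w} k B≤ x≤ = sum-≤ 11 (a + 17) (w + k) (≤-pow 11 (w + k)) (begin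
    B * (x + 17)                ≤⟨ NP.*-mono-≤ B≤ (sum-≤ a 17 k x≤ (≤-pow 17 k)) ⟩
    N ^ w * ((a + 17) * N ^ k)  ≡⟨ arith (N ^ w) (a + 17) (N ^ k) ⟩
    (a + 17) * (N ^ w * N ^ k)  ≡⟨ cong ((a + 17) *_) (sym (NP.^-distribˡ-+-* N w k)) ⟩
    (a + 17) * N ^ (w + k)      ∎)
    where
    open NP.≤-Reasoning
    arith : ∀ x y z → x * (y * z) ≡ y * (x * z)
    arith = NatSolver.solve-∀

  cost-≤ : ∀ C → cost β C ≤ factor C * N ^ degree C
  cost-≤ skip          = z≤n
  cost-≤ (x ≔ E)       = ≤-pow _ 0
  cost-≤ (c [ x ]≔ E)  = ≤-pow _ 0
  cost-≤ (output x E)  = ≤-pow _ 0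
  cost-≤ (if≤ x E C D) = sum-≤ (costᴱ E) (5 + (factor C + factor D)) k (≤-pow _ k) (sum-≤ 5 (factor C + factor D) k (≤-pow 5 k)
    (sum-≤ (factor C) (factor D) k (raise (factor C) (NP.m≤m⊔n (degree C) (degree D)) (cost-≤ C))
      (raise (factor D) (NP.m≤n⊔m (degree C) (degree D)) (cost-≤ D))))
    where k = degree C ⊔ degree D
  cost-≤ (for #jobs x C)  = loop-≤ {a = factor C} {w = 1} (degree C) (NP.≤-trans β-jobs (NP.≤-reflexive (sym (NP.*-identityʳ N)))) (cost-≤ C)
  cost-≤ (for #rows x C)  = loop-≤ {a = factor C} {w = 1} (degree C) (NP.≤-trans β-rows (NP.≤-reflexive (sym (NP.*-identityʳ N)))) (cost-≤ C)
  cost-≤ (for #cells x C) = loop-≤ {a = factor C} {w = 2} (degree C) (NP.≤-trans β-cells (NP.≤-reflexive (cong (N *_) (sym (NP.*-identityʳ N))))) (cost-≤ C)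
  cost-≤ (C ⨾ D)       = sum-≤ (factor C) (factor D) k (raise (factor C) (NP.m≤m⊔n (degree C) (degree D)) (cost-≤ C))
    (raise (factor D) (NP.m≤n⊔m (degree C) (degree D)) (cost-≤ D))
    where k = degree C ⊔ degree D

-- Prologue and assembly of the program

put : ℕ → ℕ → List Instr
put k y = const 2 (+ k) ∷ add 2 1 2 ∷ store 2 y ∷ []

-- Register 1 becomes B = p + 5 n, above the input and the output.  Then the registers 2, 3, 4 (the data
-- of the first job), n and p are saved as the variables 0 … 4.
prologue : List Instr
prologue =
  jle 0 0 2 ∷ halt ∷
  add 1 1 0 ∷ add 1 1 0 ∷ add 1 1 0 ∷ add 1 1 0 ∷ add 1 1 0 ∷ store 1 2 ∷
  const 2 0ℤ ∷ jle 0 2 1 ∷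
  put (cell 1 0) 3 ++ put (cell 2 0) 4 ++ put (cell 3 0) 0 ++
  sub 3 1 0 ∷ sub 3 3 0 ∷ sub 3 3 0 ∷ sub 3 3 0 ∷ sub 3 3 0 ∷ put (cell 4 0) 3 ++
  put (hidden 0) 0 ++ const 4 1ℤ ∷ add 4 0 4 ∷ put (hidden 1) 4 ++
  const 2 0ℤ ∷ add 0 1 2 ∷ []

-- The bound #cells is not available at the start; it is computed in variable 5.
setCells : List Instr
setCells = loadCell 1 (cell 5 0) ++ const 2 (+ (hidden 2)) ∷ add 2 0 2 ∷ store 2 1 ∷ []

-- A loop over `#cells` can run only after its bound is in place. So `C₁` computes the bound with
-- `#cells` still counting as 0, `setCells` installs it, and `C₂` runs with the true value.
program : Com → Com → Program
program C₁ C₂ = let o₁ = end 0 prologue; o₂ = end o₁ (code 0 o₁ C₁) in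
  prologue ++ code 0 o₁ C₁ ++ setCells ++ code 0 (end o₂ setCells) C₂

at-self : ∀ {P} k xs ys → (∀ j → fetch P (k + j) ≡ fetch (xs ++ ys) j) → At P k xs
at-self k [] ys f = tt
at-self {P} k (x ∷ xs) ys f = trans (cong (fetch P) (sym (NP.+-identityʳ k))) (f 0) ,
  at-self (suc k) xs ys (λ j → trans (cong (fetch P) (sym (NP.+-suc k j))) (f (suc j)))

end-length : ∀ o xs → end o xs ≡ o + length xs
end-length o [] = sym (NP.+-identityʳ o)
end-length o (x ∷ xs) = trans (end-length (suc o) xs) (sym (NP.+-suc o (length xs)))

fetch-end : ∀ P → fetch P (length P) ≡ halt
fetch-end [] = refl
fetch-end (x ∷ P) = fetch-end P

nth-beyond : ∀ xs a → length xs ≤ a → nth xs a ≡ 0ℤ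
nth-beyond [] a _ = refl
nth-beyond (x ∷ xs) (suc a) (s≤s le) = nth-beyond xs a le

module Start (b n : ℕ) (β : Bound → ℕ) (P : Program) where
  open Semantics b β
  open Simulation b β
  open Correctness b β P
  open Commands b β P

  -- During the prologue register 0 still holds `n`, so the relation `∼` does not apply yet. The
  -- five low registers are tracked one by one instead, together with the state and the hidden cells
  -- above the base.
  record Setup (s : State) (h : ℕ → ℤ) (x₂ x₃ x₄ : ℤ) (m : Mem) : Set where
    field
      reg₀  : m 0 ≡ + n
      reg₁  : m 1 ≡ + B
      reg₂  : m 2 ≡ x₂
      reg₃  : m 3 ≡ x₃
      reg₄  : m 4 ≡ x₄
      locs  : ∀ l → InRange l → m (addr l) ≡ s l
      hids  : ∀ k → hid m k ≡ h k
  open Setup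

  high : ∀ {m m′ : Mem} {s : State} → (∀ a → m′ (5 + a) ≡ m (5 + a)) → (∀ l → InRange l → m (addr l) ≡ s l) → ∀ l → InRange l → m′ (addr l) ≡ s l
  high {m} {m′} e f l i = let (a , q) = addr-high l i in trans (subst (λ z → m′ z ≡ m z) (sym q) (e a)) (f l i)

  set₂ : ∀ {s h x₂ x₃ x₄ m y v} → v ≡ y → Setup s h x₂ x₃ x₄ m → Setup s h y x₃ x₄ (update m 2 v)
  set₂ {s} {m = m} {v = v} e σ = record { reg₀ = reg₀ σ ; reg₁ = reg₁ σ ; reg₂ = e ; reg₃ = reg₃ σ ; reg₄ = reg₄ σ
    ; locs = high {m} {update m 2 v} {s} (λ _ → refl) (locs σ) ; hids = hids σ }

  set₃ : ∀ {s h x₂ x₃ x₄ m y v} → v ≡ y → Setup s h x₂ x₃ x₄ m → Setup s h x₂ y x₄ (update m 3 v)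
  set₃ {s} {m = m} {v = v} e σ = record { reg₀ = reg₀ σ ; reg₁ = reg₁ σ ; reg₂ = reg₂ σ ; reg₃ = e ; reg₄ = reg₄ σ
    ; locs = high {m} {update m 3 v} {s} (λ _ → refl) (locs σ) ; hids = hids σ }

  set₄ : ∀ {s h x₂ x₃ x₄ m y v} → v ≡ y → Setup s h x₂ x₃ x₄ m → Setup s h x₂ x₃ y (update m 4 v)
  set₄ {s} {m = m} {v = v} e σ = record { reg₀ = reg₀ σ ; reg₁ = reg₁ σ ; reg₂ = reg₂ σ ; reg₃ = reg₃ σ ; reg₄ = e
    ; locs = high {m} {update m 4 v} {s} (λ _ → refl) (locs σ) ; hids = hids σ }

  storeVar : ∀ {s h x₂ x₃ x₄ m A v w} x → A ≡ + (B + cell x 0) → v ≡ w → Setup s h x₂ x₃ x₄ m →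
    Setup (s [ sc x ↦ w ]) h x₂ x₃ x₄ (update m ∣ A ∣ v)
  storeVar {s} {m = m} {v = v} x refl refl σ = record
    { reg₀ = reg₀ σ ; reg₁ = reg₁ σ ; reg₂ = reg₂ σ ; reg₃ = reg₃ σ ; reg₄ = reg₄ σ
    ; locs = locs′
    ; hids = λ k → trans (update-other m v (hidden≢addr k (sc x) tt)) (hids σ k) }
    where
    locs′ : ∀ l → InRange l → update m (addr (sc x)) v (addr l) ≡ (s [ sc x ↦ v ]) l
    locs′ l i rewrite addr-≡ᴸ l (sc x) i tt with addr l ≡ᵇ addr (sc x)
    ... | true  = refl
    ... | false = locs σ l i

  storeHid : ∀ {s h x₂ x₃ x₄ m A v w} k → A ≡ + (B + hidden k) → v ≡ w → Setup s h x₂ x₃ x₄ m →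
    Setup s (update h k w) x₂ x₃ x₄ (update m ∣ A ∣ v)
  storeHid {h = h} {m = m} {v = v} k refl refl σ = record
    { reg₀ = reg₀ σ ; reg₁ = reg₁ σ ; reg₂ = reg₂ σ ; reg₃ = reg₃ σ ; reg₄ = reg₄ σ
    ; locs = λ l i → trans (update-other m v (λ e → hidden≢addr k l i (sym e))) (locs σ l i)
    ; hids = hids′ }
    where
    hids′ : ∀ k′ → hid (update m (B + hidden k) v) k′ ≡ update h k v k′
    hids′ k′ with k′ ≡ᵇ k in eq
    ... | true rewrite NP.≡ᵇ⇒≡ k′ k (subst T (sym eq) tt) = update-same m (B + hidden k) v
    ... | false = trans (update-other m v (λ e → subst T eq (NP.≡⇒≡ᵇ k′ k (hidden-injective {k′} {k} e)))) (hids σ k′)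

module Run (C₁ C₂ : Com) (b n p M : ℕ) (B≡ : p + n + n + n + n + n ≡ 5 + b) (0<n : 0 < n) (μ : Mem)
  (μ₀ : μ 0 ≡ + n) (μ₁ : μ 1 ≡ + p) (μ-clear : ∀ a → μ (5 + b + a) ≡ 0ℤ) where

  P : Program
  P = program C₁ C₂

  β₁ β₂ : Bound → ℕ
  β₁ = bounds n 0
  β₂ = bounds n M

  module Phase₁ where
    open Semantics b β₁ public
    open Simulation b β₁ public
    open Correctness b β₁ P public
    open Commands b β₁ P public
    open Start b n β₁ P public
    open Setup public
    open _∼_ public

  module Phase₂ where
    open Semantics b β₂ public
    open Simulation b β₂ public
    open Correctness b β₂ P public
    open Commands b β₂ P public

  module PrologueRun where
    open Phase₁

    blank : State
    blank (raw a) = μ a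
    blank _       = 0ℤ

    put-ok : ∀ {s h x₂ x₃ x₄ m w} y x → update (update m 2 (+ cell x 0)) 2 (m 1 +ℤ + cell x 0) y ≡ w → Setup s h x₂ x₃ x₄ m →
      Setup (s [ sc x ↦ w ]) h (+ (B + cell x 0)) x₃ x₄ (effects (put (cell x 0) y) m)
    put-ok y x e σ = storeVar x (cong (_+ℤ + cell x 0) (reg₁ σ)) e (set₂ (cong (_+ℤ + cell x 0) (reg₁ σ)) (set₂ refl σ))

    put-hidden : ∀ {s h x₂ x₃ x₄ m w} y k → update (update m 2 (+ hidden k)) 2 (m 1 +ℤ + hidden k) y ≡ w → Setup s h x₂ x₃ x₄ m →
      Setup s (update h k w) (+ (B + hidden k)) x₃ x₄ (effects (put (hidden k) y) m)
    put-hidden y k e σ = storeHid k (cong (_+ℤ + hidden k) (reg₁ σ)) e (set₂ (cong (_+ℤ + hidden k) (reg₁ σ)) (set₂ refl σ))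

    put₀ : ∀ {s h x₂ x₃ x₄ m o} x → At P o (put (cell x 0) 0) → Setup s h x₂ x₃ x₄ m →
      Exec P o m (3 + o) 3 (Setup (s [ sc x ↦ + n ]) h (+ (B + cell x 0)) x₃ x₄)
    put₀ x at σ = weaken NP.≤-refl (λ { refl → put-ok 0 x (reg₀ σ) σ }) (straight (put (cell x 0) 0) at)

    put₃ : ∀ {s h x₂ x₃ x₄ m o} x → At P o (put (cell x 0) 3) → Setup s h x₂ x₃ x₄ m →
      Exec P o m (3 + o) 3 (Setup (s [ sc x ↦ x₃ ]) h (+ (B + cell x 0)) x₃ x₄)
    put₃ x at σ = weaken NP.≤-refl (λ { refl → put-ok 3 x (reg₃ σ) σ }) (straight (put (cell x 0) 3) at)

    put₄ : ∀ {s h x₂ x₃ x₄ m o} x → At P o (put (cell x 0) 4) → Setup s h x₂ x₃ x₄ m →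
      Exec P o m (3 + o) 3 (Setup (s [ sc x ↦ x₄ ]) h (+ (B + cell x 0)) x₃ x₄)
    put₄ x at σ = weaken NP.≤-refl (λ { refl → put-ok 4 x (reg₄ σ) σ }) (straight (put (cell x 0) 4) at)

    adds : List Instr
    adds = add 1 1 0 ∷ add 1 1 0 ∷ add 1 1 0 ∷ add 1 1 0 ∷ add 1 1 0 ∷ []

    saves : List Instr
    saves = put (cell 1 0) 3 ++ put (cell 2 0) 4 ++ put (cell 3 0) 0 ++
      sub 3 1 0 ∷ sub 3 3 0 ∷ sub 3 3 0 ∷ sub 3 3 0 ∷ sub 3 3 0 ∷ put (cell 4 0) 3 ++
      put (hidden 0) 0 ++ const 4 1ℤ ∷ add 4 0 4 ∷ put (hidden 1) 4 ++
      const 2 0ℤ ∷ add 0 1 2 ∷ []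

    σ₀ : Setup blank (λ _ → 0ℤ) (μ 2) (μ 3) (μ 4) (effects adds μ)
    σ₀ = record
      { reg₀ = μ₀ ; reg₁ = trans (cong₂ (λ x y → x +ℤ y +ℤ y +ℤ y +ℤ y +ℤ y) μ₁ μ₀) (cong +_ B≡)
      ; reg₂ = refl ; reg₃ = refl ; reg₄ = refl
      ; locs = high {μ} {effects adds μ} {blank} (λ _ → refl) λ
          { (sc x) _ → μ-clear (cell x 0) ; (arr c i) _ → μ-clear (cell i (suc (toℕ c))) ; (raw a) _ → refl }
      ; hids = λ k → μ-clear (hidden k) }

    σ₁ : Setup (blank [ sc 0 ↦ μ 2 ]) (λ _ → 0ℤ) 0ℤ (μ 3) (μ 4) (effects (store 1 2 ∷ const 2 0ℤ ∷ []) (effects adds μ))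
    σ₁ = set₂ refl (storeVar 0 (trans (reg₁ σ₀) (cong +_ (sym (NP.+-identityʳ B)))) refl σ₀)

    p≡ : + B -ℤ + n -ℤ + n -ℤ + n -ℤ + n -ℤ + n ≡ + p
    p≡ = trans (cong (λ z → + z -ℤ + n -ℤ + n -ℤ + n -ℤ + n -ℤ + n) (sym B≡)) (lemma (+ p) (+ n))
      where
      lemma : ∀ x y → x +ℤ y +ℤ y +ℤ y +ℤ y +ℤ y -ℤ y -ℤ y -ℤ y -ℤ y -ℤ y ≡ x
      lemma = IntSolver.solve-∀

    saved : State
    saved = blank [ sc 0 ↦ μ 2 ] [ sc 1 ↦ μ 3 ] [ sc 2 ↦ μ 4 ] [ sc 3 ↦ + n ] [ sc 4 ↦ + p ]

    Ready : Mem → Set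
    Ready m = saved ∼ m × Rows m

    restore-p : ∀ {s h x₂ x₃ x₄ m o} → At P o (sub 3 1 0 ∷ sub 3 3 0 ∷ sub 3 3 0 ∷ sub 3 3 0 ∷ sub 3 3 0 ∷ []) →
      Setup s h x₂ x₃ x₄ m → Exec P o m (5 + o) 5 (Setup s h x₂ (+ p) x₄)
    restore-p {s} {h} {x₂} {x₃} {x₄} {m} at σ = weaken NP.≤-refl (λ { refl → set₃ (trans (cong₂ (λ x y → x -ℤ y -ℤ y -ℤ y -ℤ y -ℤ y) (reg₁ σ) (reg₀ σ)) p≡)
      (set₃ refl (set₃ refl (set₃ refl (set₃ refl σ)))) })
      (straight (sub 3 1 0 ∷ sub 3 3 0 ∷ sub 3 3 0 ∷ sub 3 3 0 ∷ sub 3 3 0 ∷ []) at)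

    hidden₀ : ∀ {s h x₂ x₃ x₄ m o} k → At P o (put (hidden k) 0) → Setup s h x₂ x₃ x₄ m →
      Exec P o m (3 + o) 3 (Setup s (update h k (+ n)) (+ (B + hidden k)) x₃ x₄)
    hidden₀ k at σ = weaken NP.≤-refl (λ { refl → put-hidden 0 k (reg₀ σ) σ }) (straight (put (hidden k) 0) at)

    hidden₄ : ∀ {s h x₂ x₃ x₄ m o} k → At P o (put (hidden k) 4) → Setup s h x₂ x₃ x₄ m →
      Exec P o m (3 + o) 3 (Setup s (update h k x₄) (+ (B + hidden k)) x₃ x₄)
    hidden₄ k at σ = weaken NP.≤-refl (λ { refl → put-hidden 4 k (reg₄ σ) σ }) (straight (put (hidden k) 4) at)

    suc-n : ∀ {s h x₂ x₃ x₄ m o} → At P o (const 4 1ℤ ∷ add 4 0 4 ∷ []) → Setup s h x₂ x₃ x₄ m →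
      Exec P o m (2 + o) 2 (Setup s h x₂ x₃ (+ suc n))
    suc-n at σ = weaken NP.≤-refl
      (λ { refl → set₄ (trans (cong (_+ℤ 1ℤ) (reg₀ σ)) (cong +_ (NP.+-comm n 1))) (set₄ refl σ) })
      (straight (const 4 1ℤ ∷ add 4 0 4 ∷ []) at)

    finish : ∀ {x₂ x₃ x₄ m o} → At P o (const 2 0ℤ ∷ add 0 1 2 ∷ []) →
      Setup saved (update (update (λ _ → 0ℤ) 0 (+ n)) 1 (+ suc n)) x₂ x₃ x₄ m → Exec P o m (2 + o) 2 Ready
    finish {m = m} at σ = weaken NP.≤-refl
      (λ { refl → record
        { base  = trans (cong (_+ℤ 0ℤ) (reg₁ σ)) (cong +_ (NP.+-identityʳ B))
        ; cells = high {m} {effects (const 2 0ℤ ∷ add 0 1 2 ∷ []) m} {saved} (λ _ → refl) (locs σ) } ,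
        λ { #jobs → hids σ 0 ; #rows → hids σ 1 ; #cells → hids σ 2 } })
      (straight (const 2 0ℤ ∷ add 0 1 2 ∷ []) at)

    save : ∀ {m o} → At P o saves → Setup (blank [ sc 0 ↦ μ 2 ]) (λ _ → 0ℤ) 0ℤ (μ 3) (μ 4) m →
      Exec P o m (end o saves) 30 Ready
    save (a₁ , a₂ , a₃ , b₁ , b₂ , b₃ , c₁ , c₂ , c₃ , d₁ , d₂ , d₃ , d₄ , d₅ , e₁ , e₂ , e₃ , f₁ , f₂ , f₃ , g₁ , g₂ , h₁ , h₂ , h₃ , i₁ , i₂ , _) σ =
      weaken (NP.m≤m+n _ _) id (put₃ 1 (a₁ , a₂ , a₃ , tt) σ
      ▹ λ m₁ σ₁ → put₄ 2 (b₁ , b₂ , b₃ , tt) σ₁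
      ▹ λ m₂ σ₂ → put₀ 3 (c₁ , c₂ , c₃ , tt) σ₂
      ▹ λ m₃ σ₃ → restore-p (d₁ , d₂ , d₃ , d₄ , d₅ , tt) σ₃
      ▹ λ m₄ σ₄ → put₃ 4 (e₁ , e₂ , e₃ , tt) σ₄
      ▹ λ m₅ σ₅ → hidden₀ 0 (f₁ , f₂ , f₃ , tt) σ₅
      ▹ λ m₆ σ₆ → suc-n (g₁ , g₂ , tt) σ₆
      ▹ λ m₇ σ₇ → hidden₄ 1 (h₁ , h₂ , h₃ , tt) σ₇
      ▹ λ m₈ σ₈ → finish (i₁ , i₂ , tt) σ₈)

    -- The first jump passes over the `halt` in position 1, which is the target of the later test
    -- for `n ≤ 0`; for positive `n` this test falls through.
    prologue-runs : At P 0 prologue → Exec P 0 μ (end 0 prologue) 45 Ready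
    prologue-runs (e₀ , _ , a₁ , a₂ , a₃ , a₄ , a₅ , a₆ , a₇ , e₁ , at) = weaken (NP.m≤m+n _ _) id (jump e₀
      ▹ λ { _ refl → straight adds (a₁ , a₂ , a₃ , a₄ , a₅ , tt)
      ▹ λ { _ refl → straight (store 1 2 ∷ const 2 0ℤ ∷ []) (a₆ , a₇ , tt)
      ▹ λ { m e → jump-≰ e₁ (positive m e)
      ▹ λ { _ refl → save at (subst (Setup _ _ _ _ _) (sym e) σ₁) }}}})
      where
      positive : ∀ m → m ≡ effects (store 1 2 ∷ const 2 0ℤ ∷ []) (effects adds μ) → ¬ T (m 0 ≤ᵇℤ m 2)
      positive m refl t = NP.<⇒≱ 0<n (ZP.drop‿+≤+ (ZP.≤ᵇ⇒≤ (subst₂ (λ y z → T (y ≤ᵇℤ z)) (reg₀ σ₁) (reg₂ σ₁) t)))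

  open PrologueRun using (saved) public
  module S₁ = Semantics b β₁
  module S₂ = Semantics b β₂

  -- The state is the same before and after; only the number of iterations attributed to `#cells`
  -- changes, from 0 to the value of variable 5.
  set-cells : ∀ {s m o} → Phase₁._∼_ s m → Phase₁.Rows m → s (sc 5) ≡ + M → At P o setCells →
    Exec P o m (end o setCells) 6 (λ m′ → Phase₂._∼_ s m′ × Phase₂.Rows m′)
  set-cells {s} {m} r rows e (a₁ , a₂ , a₃ , b₁ , b₂ , b₃ , _) =
    load₁ (cell 5 0) (base r) (a₁ , a₂ , a₃ , tt)
    ▹ λ { m₁ (q , a) → weaken NP.≤-refl (λ { refl → new m₁ (trans q (trans (cells r (sc 5) tt) e)) a })
      (straight (const 2 (+ (hidden 2)) ∷ add 2 0 2 ∷ store 2 1 ∷ []) (b₁ , b₂ , b₃ , tt)) }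
    where
    open Phase₁
    stored : ∀ m₂ → m₂ 2 ≡ + (B + hidden 2) → m₂ 1 ≡ + M → s ∼ m₂ → (∀ k → hid m₂ k ≡ hid m k) →
      Phase₂._∼_ s (update m₂ ∣ m₂ 2 ∣ (m₂ 1)) × Phase₂.Rows (update m₂ ∣ m₂ 2 ∣ (m₂ 1))
    stored m₂ e₂ e₁ r₂ hs rewrite e₂ | e₁ = record
      { base = base r₃ ; cells = λ { (sc x) i → cells r₃ (sc x) i ; (arr c j) i → cells r₃ (arr c j) i ; (raw x) i → cells r₃ (raw x) i } } ,
      λ { #jobs → trans (keep 0 (λ ())) (trans (hs 0) (rows #jobs))
        ; #rows → trans (keep 1 (λ ())) (trans (hs 1) (rows #rows))
        ; #cells → update-same m₂ (B + hidden 2) (+ M) }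
      where
      r₃ = ∼-hidden 2 (+ M) r₂
      keep : ∀ k → k ≢ 2 → hid (update m₂ (B + hidden 2) (+ M)) k ≡ hid m₂ k
      keep k k≢ = update-other m₂ (+ M) (λ q → k≢ (hidden-injective {k} {2} q))
    new : ∀ m₁ → m₁ 1 ≡ + M → m₁ ≈ m → _
    new m₁ q a = stored (effects (const 2 (+ (hidden 2)) ∷ add 2 0 2 ∷ []) m₁)
      (cong (_+ℤ + hidden 2) (base (∼-≈ r a))) q (∼-≈ r (≈-trans (agree refl λ _ → refl) a))
      (hid-≈ {m} {effects (const 2 (+ (hidden 2)) ∷ add 2 0 2 ∷ []) m₁} (≈-trans (agree refl λ _ → refl) a))

  run-program : S₁.⟦ C₁ ⟧ saved (sc 5) ≡ + M →
    Exec P 0 μ (length P) (45 + (cost β₁ C₁ + (6 + cost β₂ C₂))) (λ m → Phase₂._∼_ (S₂.⟦ C₂ ⟧ (S₁.⟦ C₁ ⟧ saved)) m)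
  run-program e with at-self {P} 0 P [] (λ j → cong (λ z → fetch z j) (sym (LP.++-identityʳ P)))
  ... | at with at-++ {P} 0 prologue at
  ...   | atP , at₁ with at-++ {P} o₁ (code 0 o₁ C₁) at₁
    where o₁ = end 0 prologue
  ...     | atC₁ , at₂ with at-++ {P} o₂ setCells at₂
    where o₂ = end (end 0 prologue) (code 0 (end 0 prologue) C₁)
  ...       | atG , atC₂ = at-pc end≡ (PrologueRun.prologue-runs atP
    ▹ λ { m₁ (r₁ , rows₁) → Phase₁.executes C₁ 0 r₁ rows₁ atC₁
    ▹ λ { m₂ (r₂ , k₂) → set-cells r₂ (Phase₁.rows-keep k₂ rows₁) e atG
    ▹ λ { m₃ (r₃ , rows₃) → weaken NP.≤-refl proj₁ (Phase₂.executes C₂ 0 r₃ rows₃ atC₂) }}})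
    where
    o₁ = end 0 prologue
    A = code 0 o₁ C₁
    o₂ = end o₁ A
    D = code 0 (end o₂ setCells) C₂
    end≡ : end (end o₂ setCells) D ≡ length P
    end≡ = trans (sym (trans (end-++ 0 prologue (A ++ setCells ++ D)) (trans (end-++ o₁ A (setCells ++ D)) (end-++ o₂ setCells D))))
      (end-length 0 P)

  halts : ∀ m → Halted P (cfg (length P) m)
  halts m = subst isHalt (sym (fetch-end P)) tt

-- Loop invariants and framing

iterate-inv : {A : Set} (I : ℕ → A → Set) (N : ℕ) (f : ℕ → A → A) {a : A} → I 0 a →
  (∀ i a → i < N → I i a → I (suc i) (f i a)) → I N (iterate N f a)
iterate-inv I zero    f i₀ step = i₀
iterate-inv I (suc N) f i₀ step = step N _ NP.≤-refl (iterate-inv I N f i₀ (λ i a i<N → step i a (NP.m<n⇒m<1+n i<N)))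

if-case : {A : Set} (Q : A → Set) (c : Bool) {x y : A} → (T c → Q x) → (¬ T c → Q y) → Q (if c then x else y)
if-case Q true  f g = f tt
if-case Q false f g = g (λ ())

≤ᵇ-false : ∀ {x y} → ¬ T (x ≤ᵇℤ y) → y <ℤ x
≤ᵇ-false q = ZP.≰⇒> (λ le → q (ZP.≤⇒≤ᵇ le))

table-same : ∀ (g : ℕ → ℤ) i v → (if i ≡ᵇ i then v else g i) ≡ v
table-same g i v = update-same g i v

table-step : ∀ (f g : ℕ → ℤ) i {v} → (∀ k → k < i → g k ≡ f k) → v ≡ f i →
  ∀ k → k < suc i → (if k ≡ᵇ i then v else g k) ≡ f k
table-step f g i h e k k< with NP.m≤n⇒m<n∨m≡n (NP.≤-pred k<)
... | inj₁ k<i  = trans (update-other g _ (NP.<⇒≢ k<i)) (h k k<i)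
... | inj₂ refl = trans (update-same g k _) e

≡ᵇ-false : ∀ {i j} → i ≢ j → (i ≡ᵇ j) ≡ false
≡ᵇ-false {i} {j} ne with i ≡ᵇ j in eq
... | false = refl
... | true  = contradiction (NP.≡ᵇ⇒≡ i j (subst T (sym eq) tt)) ne

-- An over-approximation that can be computed: array writes are recorded by column only, as the
-- index is known only at run time, and an output counts as a write to every raw register. For a
-- concrete command the hypothesis of `frame` is then `refl`.
writes : Com → Loc → Bool
writes skip l                  = false
writes (x ≔ E) l               = l ≡ᴸ sc x
writes (c [ x ]≔ E) (arr d i)  = toℕ d ≡ᵇ toℕ c
writes (c [ x ]≔ E) _          = false
writes (output x E) (raw _)    = true
writes (output x E) _          = false
writes (if≤ x E C D) l         = writes C l ∨ writes D l
writes (for d x C) l           = (l ≡ᴸ sc x) ∨ writes C l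
writes (C ⨾ D) l               = writes C l ∨ writes D l

∨-false : ∀ {x y} → x ∨ y ≡ false → x ≡ false × y ≡ false
∨-false {false} {false} _ = refl , refl

module Frame (b : ℕ) (β : Bound → ℕ) where
  open Semantics b β

  loop-inv : (I : ℕ → State → Set) → ∀ d x C s → I 0 s →
    (∀ i t → i < β d → I i t → I (suc i) (⟦ C ⟧ (t [ sc x ↦ + i ]))) → I (β d) (⟦ for d x C ⟧ s)
  loop-inv I d x C s = iterate-inv I (β d) (λ i t → ⟦ C ⟧ (t [ sc x ↦ + i ]))

  frame : ∀ C l s → writes C l ≡ false → ⟦ C ⟧ s l ≡ s l
  frame skip l s e = refl
  frame (x ≔ E) l s e rewrite e = refl
  frame (c [ x ]≔ E) (arr d i) s e rewrite e = refl
  frame (c [ x ]≔ E) (sc y) s e = refl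
  frame (c [ x ]≔ E) (raw y) s e = refl
  frame (output x E) (sc y) s e = if-case (λ (t : State) → t (sc y) ≡ s (sc y)) (+ 5 ≤ᵇℤ s (sc x))
    (λ _ → if-case (λ (t : State) → t (sc y) ≡ s (sc y)) (+ B ≤ᵇℤ s (sc x)) (λ _ → refl) (λ _ → refl)) (λ _ → refl)
  frame (output x E) (arr c i) s e = if-case (λ (t : State) → t (arr c i) ≡ s (arr c i)) (+ 5 ≤ᵇℤ s (sc x))
    (λ _ → if-case (λ (t : State) → t (arr c i) ≡ s (arr c i)) (+ B ≤ᵇℤ s (sc x)) (λ _ → refl) (λ _ → refl)) (λ _ → refl)
  frame (if≤ x E C D) l s e = let (e₁ , e₂) = ∨-false e in
    if-case (λ (t : State) → t l ≡ s l) (s (sc x) ≤ᵇℤ eval s E) (λ _ → frame C l s e₁) (λ _ → frame D l s e₂)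
  frame (for d x C) l s e = iterate-inv (λ _ t → t l ≡ s l) (β d) _ refl each
    where
    each : ∀ i t → i < β d → t l ≡ s l → ⟦ C ⟧ (t [ sc x ↦ + i ]) l ≡ s l
    each i t _ q with ∨-false {l ≡ᴸ sc x} e
    ... | e₁ , e₂ = trans (frame C l (t [ sc x ↦ + i ]) e₂) (trans (cong (λ c → if c then + i else t l) e₁) q)
  frame (C ⨾ D) l s e = let (e₁ , e₂) = ∨-false {writes C l} e in trans (frame D l (⟦ C ⟧ s) e₂) (frame C l s e₁)

-- Grid points are numbered e = a (n + 1) + i.
module Grid (n p : ℕ) (0<p : 0 < p) (rel dl : ℕ → ℤ) where
  open import Data.Nat.DivMod using (_/_; _%_; [m+kn]%n≡m%n; m<n⇒m%n≡m; +-distrib-/-∣ʳ; m*n/n≡m; m<n⇒m/n≡0; m≡m%n+[m/n]*n; m%n<n; m<n*o⇒m/o<n)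
  open import Data.Nat.Divisibility using (divides)

  m M : ℕ
  m = suc n
  M = n * m

  point : ℕ → ℕ → ℕ
  point a i = a * m + i

  job-of index-of : ℕ → ℕ
  job-of e   = e / m
  index-of e = e % m

  index-of-point : ∀ a i → i ≤ n → index-of (point a i) ≡ i
  index-of-point a i i≤n = trans (cong (_% m) (NP.+-comm (a * m) i)) (trans ([m+kn]%n≡m%n i a m) (m<n⇒m%n≡m (s≤s i≤n)))

  job-of-point : ∀ a i → i ≤ n → job-of (point a i) ≡ a
  job-of-point a i i≤n = begin
    (a * m + i) / m      ≡⟨ cong (_/ m) (NP.+-comm (a * m) i) ⟩
    (i + a * m) / m      ≡⟨ +-distrib-/-∣ʳ i (divides a refl) ⟩
    i / m + (a * m) / m  ≡⟨ cong₂ _+_ (m<n⇒m/n≡0 (s≤s i≤n)) (m*n/n≡m a m) ⟩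
    a                    ∎
    where open ≡-Reasoning

  point-split : ∀ e → e ≡ point (job-of e) (index-of e)
  point-split e = trans (m≡m%n+[m/n]*n e m) (NP.+-comm (index-of e) _)

  index-of≤ : ∀ e → index-of e ≤ n
  index-of≤ e = NP.≤-pred (m%n<n e m)

  job-of< : ∀ {e} → e < M → job-of e < n
  job-of< e<M = m<n*o⇒m/o<n e<M

  point<M : ∀ {a i} → a < n → i ≤ n → point a i < M
  point<M {a} {i} a<n i≤n = NP.<-≤-trans (NP.+-monoʳ-< (a * m) (s≤s i≤n))
    (NP.≤-trans (NP.≤-reflexive (NP.+-comm (a * m) m)) (NP.*-monoˡ-≤ m a<n))

  inst : Instance
  inst = record { n = n ; p = p ; 0<p = 0<p ; rel = rel ; dl = dl }
  open Instance inst using (val) public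

  key : ℕ → ℤ
  key e = val (job-of e) (index-of e)

  key-point : ∀ a i → i ≤ n → key (point a i) ≡ val a i
  key-point a i i≤n = cong₂ val (job-of-point a i i≤n) (index-of-point a i i≤n)

  private
    module K = Rank key M
    module J = Rank dl n

  order : Order inst
  order = record
    { pos = λ a i → rank key M (point a i) ; top = λ a i → countUpTo key M (point a i)
    ; jrk = rank dl n ; M = M
    ; pos<top⇒≤ = λ a i b k a<n i≤n b<n k≤n lt → subst₂ _≤ℤ_ (key-point a i i≤n) (key-point b k k≤n)
        (K.rank<countUpTo⇒≤ (point a i) (point b k) lt)
    ; ≤⇒pos<top = λ a i b k a<n i≤n b<n k≤n le → K.≤⇒rank<countUpTo (point a i) (point b k) (point<M a<n i≤n)
        (subst₂ _≤ℤ_ (sym (key-point a i i≤n)) (sym (key-point b k k≤n)) le)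
    ; pos<M = λ a i a<n i≤n → K.rank<N (point a i) (point<M a<n i≤n)
    ; jrk<n = J.rank<N
    ; jrk⇒≤ = λ i j i<n j<n lt → J.rank<⇒≤ j i j<n lt
    ; jrk-inj = J.rank-injective }

  pos-injective : ∀ {e f} → e < M → f < M → rank key M e ≡ rank key M f → e ≡ f
  pos-injective {e} {f} = K.rank-injective e f

  top≤M : ∀ e → countUpTo key M e ≤ M
  top≤M = K.countUpTo≤N

-- The dynamic program

-- RW and RM hold the weights and bit masks of the chain table, whose row z starts at RB z; its row n
-- stays 0 and serves NXT as a sentinel.  AW and AM hold those of the block table.
REL DL WT POW RB JORD VAL EA EI TOP ORD NXT AW AM RW RM : Column
REL  = # 0
DL   = # 1
WT   = # 2
POW  = # 3
RB   = # 4
JORD = # 5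
VAL  = # 6
EA   = # 7
EI   = # 8
TOP  = # 9
ORD  = # 10
NXT  = # 11
AW   = # 12
AM   = # 13
RW   = # 14
RM   = # 15

-- Variables 0 … 5 hold the release time, deadline and weight of the first job, n, p and n (n + 1).
countCells : Com
countCells = 5 ≔ num 0ℤ ⨾ for #jobs 6 (5 ≔ plus (plus (num 1ℤ) 5) 3)

readJobs : Com
readJobs =
  7 ≔ num (+ 2) ⨾
  for #jobs 6 (
    REL [ 6 ]≔ input (var 7) ⨾ 7 ≔ plus (num 1ℤ) 7 ⨾
    DL  [ 6 ]≔ input (var 7) ⨾ 7 ≔ plus (num 1ℤ) 7 ⨾
    WT  [ 6 ]≔ input (var 7) ⨾ 7 ≔ plus (num 1ℤ) 7) ⨾
  -- The data of job 0 came in the scratch registers 2, 3 and 4, where the guarded reads return mere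
  -- addresses. Its entries are overwritten with the values saved by the prologue.
  6 ≔ num 0ℤ ⨾ REL [ 6 ]≔ var 0 ⨾ DL [ 6 ]≔ var 1 ⨾ WT [ 6 ]≔ var 2

powers : Com
powers = 8 ≔ num 1ℤ ⨾ for #jobs 6 (POW [ 6 ]≔ var 8 ⨾ 8 ≔ plus (var 8) 8)

rowBases : Com
rowBases = 10 ≔ plus (num 1ℤ) 5 ⨾ 9 ≔ num 0ℤ ⨾ for #rows 6 (RB [ 6 ]≔ var 9 ⨾ 9 ≔ plus (var 9) 10)

-- The branches follow those of `precedes`: variable 7 accumulates `rank` and variable 8 accumulates
-- `countUpTo`.
compareKeys : Com
compareKeys =
  11 ≔ get VAL (var 10) ⨾
  if≤ 11 (var 9)
    (8 ≔ plus (num 1ℤ) 8 ⨾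
     if≤ 9 (var 11) (if≤ 6 (var 10) skip (7 ≔ plus (num 1ℤ) 7)) (7 ≔ plus (num 1ℤ) 7))
    skip

rankKey : Bound → Com
rankKey d =
  7 ≔ num 0ℤ ⨾ 8 ≔ num 0ℤ ⨾ 9 ≔ get VAL (var 6) ⨾ for d 10 compareKeys ⨾ TOP [ 6 ]≔ var 8 ⨾ ORD [ 7 ]≔ var 6

-- Each key is stored at the position given by its rank. The default in variable 12 is chosen so
-- that a position still holding it is passed over later: `n` is no job, and grid point 0 has index
-- 0 and so ends no nonempty block.
sortKeys : Bound → Com
sortKeys d = for d 6 (ORD [ 6 ]≔ var 12) ⨾ for d 6 (rankKey d)

module Setups (b : ℕ) (β : Bound → ℕ) where
  open Semantics b β
  open Frame b β

  powers-ok : ∀ s j → j < β #jobs → ⟦ powers ⟧ s (arr POW j) ≡ + (2 ^ j)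
  powers-ok s = proj₂ (iterate-inv (λ i (t : State) → t (sc 8) ≡ + (2 ^ i) × (∀ j → j < i → t (arr POW j) ≡ + (2 ^ j)))
    (β #jobs) _ (refl , λ _ ())
    (λ { i t _ (e , h) → trans (cong₂ _+ℤ_ e e) (cong (λ z → + (2 ^ i + z)) (sym (NP.+-identityʳ (2 ^ i)))) ,
         table-step (λ j → + (2 ^ j)) (λ j → t (arr POW j)) i h e }))

  rowBases-ok : ∀ s M → s (sc 5) ≡ + M → ∀ j → j < β #rows → ⟦ rowBases ⟧ s (arr RB j) ≡ + (j * suc M)
  rowBases-ok s M e₅ = proj₂ (proj₂ (iterate-inv
    (λ i (t : State) → t (sc 10) ≡ + suc M × t (sc 9) ≡ + (i * suc M) × (∀ j → j < i → t (arr RB j) ≡ + (j * suc M)))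
    (β #rows) _ (cong (1ℤ +ℤ_) e₅ , refl , λ _ ())
    (λ { i t _ (e , e′ , h) → e , trans (cong₂ _+ℤ_ e′ e) (cong +_ (NP.+-comm (i * suc M) (suc M))) ,
         table-step (λ j → + (j * suc M)) (λ j → t (arr RB j)) i h e′ })))

  countCells-ok : ∀ s N → s (sc 3) ≡ + N → ⟦ countCells ⟧ s (sc 5) ≡ + (β #jobs * suc N)
  countCells-ok s N e₃ = proj₂ (iterate-inv (λ i (t : State) → t (sc 3) ≡ + N × t (sc 5) ≡ + (i * suc N))
    (β #jobs) _ (e₃ , refl)
    (λ { i t _ (e , e′) → e , trans (cong₂ (λ x y → 1ℤ +ℤ x +ℤ y) e′ e) (cong (λ z → + suc z) (NP.+-comm (i * suc N) N)) }))

  module ReadJobs (s : State) (range : suc (suc (β #jobs * 3)) ≤ B)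
    (e₀ : s (sc 0) ≡ s (raw 2)) (e₁ : s (sc 1) ≡ s (raw 3)) (e₂ : s (sc 2) ≡ s (raw 4)) where

    n = β #jobs

    cell-of : ℕ → ℕ → ℤ
    cell-of k j = guarded (+ (k + j * 3)) (+ (k + j * 3)) (s (raw (k + j * 3)))

    Inv : ℕ → State → Set
    Inv i t = t (sc 7) ≡ + (2 + i * 3) × (∀ a → t (raw a) ≡ s (raw a)) ×
      (t (sc 0) ≡ s (sc 0) × t (sc 1) ≡ s (sc 1) × t (sc 2) ≡ s (sc 2)) ×
      (∀ j → j < i → t (arr REL j) ≡ cell-of 2 j) ×
      (∀ j → j < i → t (arr DL j) ≡ cell-of 3 j) × (∀ j → j < i → t (arr WT j) ≡ cell-of 4 j)

    read : ∀ {t k} (a : ℕ) → t (sc 7) ≡ + a → (∀ a → t (raw a) ≡ s (raw a)) → k ≡ a →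
      eval t (input (var 7)) ≡ guarded (+ k) (+ k) (s (raw k))
    read a e f refl rewrite e | f a = refl

    body : Com
    body = REL [ 6 ]≔ input (var 7) ⨾ 7 ≔ plus (num 1ℤ) 7 ⨾
      DL  [ 6 ]≔ input (var 7) ⨾ 7 ≔ plus (num 1ℤ) 7 ⨾
      WT  [ 6 ]≔ input (var 7) ⨾ 7 ≔ plus (num 1ℤ) 7

    loop : State
    loop = iterate n (λ i t → ⟦ body ⟧ (t [ sc 6 ↦ + i ])) (s [ sc 7 ↦ + 2 ])

    loop-ok : Inv n loop
    loop-ok = iterate-inv Inv n _ (refl , (λ _ → refl) , (refl , refl , refl) , (λ _ ()) , (λ _ ()) , λ _ ()) each
      where
      each : ∀ i t → i < n → Inv i t → Inv (suc i) (⟦ body ⟧ (t [ sc 6 ↦ + i ]))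
      each i t _ (e₇ , rw , ss , h₁ , h₂ , h₃) =
        cong (λ z → 1ℤ +ℤ (1ℤ +ℤ (1ℤ +ℤ z))) e₇ , rw , ss ,
        table-step (cell-of 2) (λ j → t (arr REL j)) i h₁ (read {t [ sc 6 ↦ + i ]} (2 + i * 3) e₇ rw refl) ,
        table-step (cell-of 3) (λ j → t (arr DL j)) i h₂
          (read {⟦ REL [ 6 ]≔ input (var 7) ⨾ 7 ≔ plus (num 1ℤ) 7 ⟧ (t [ sc 6 ↦ + i ])} (3 + i * 3) (cong (1ℤ +ℤ_) e₇) rw refl) ,
        table-step (cell-of 4) (λ j → t (arr WT j)) i h₃
          (read {⟦ REL [ 6 ]≔ input (var 7) ⨾ 7 ≔ plus (num 1ℤ) 7 ⨾ DL  [ 6 ]≔ input (var 7) ⨾ 7 ≔ plus (num 1ℤ) 7 ⟧ (t [ sc 6 ↦ + i ])}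
            (4 + i * 3) (cong (λ z → 1ℤ +ℤ (1ℤ +ℤ z)) e₇) rw refl)

    inside : ∀ k j → k ≤ 4 → 2 ≤ k → j < n → 0 < j → cell-of k j ≡ s (raw (k + j * 3))
    inside k j k≤4 2≤k j<n 0<j with + 5 ≤ᵇℤ + (k + j * 3) in eq | + B ≤ᵇℤ + (k + j * 3) in eq′
    ... | true  | false = refl
    ... | false | _     = contradiction (NP.+-mono-≤ 2≤k (NP.*-monoˡ-≤ 3 0<j)) (λ le → subst T eq (NP.≤⇒≤ᵇ le))
    ... | true  | true  = contradiction (NP.≤ᵇ⇒≤ B (k + j * 3) (subst T (sym eq′) tt)) (NP.<⇒≱ (begin-strict
        k + j * 3        ≤⟨ NP.+-monoˡ-≤ (j * 3) k≤4 ⟩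
        4 + j * 3        <⟨ NP.≤-refl ⟩
        2 + (suc j) * 3  ≤⟨ NP.+-monoʳ-≤ 2 (NP.*-monoˡ-≤ 3 j<n) ⟩
        2 + n * 3        ≤⟨ range ⟩
        B                ∎))
      where open NP.≤-Reasoning

    rel-ok : ∀ j → j < n → ⟦ readJobs ⟧ s (arr REL j) ≡ s (raw (2 + j * 3))
    rel-ok zero    _   = trans (proj₁ (proj₁ (proj₂ (proj₂ loop-ok)))) e₀
    rel-ok (suc j) j<n = trans (proj₁ (proj₂ (proj₂ (proj₂ loop-ok))) (suc j) j<n) (inside 2 (suc j) (s≤s (s≤s z≤n)) NP.≤-refl j<n (s≤s z≤n))

    dl-ok : ∀ j → j < n → ⟦ readJobs ⟧ s (arr DL j) ≡ s (raw (3 + j * 3))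
    dl-ok zero    _   = trans (proj₁ (proj₂ (proj₁ (proj₂ (proj₂ loop-ok))))) e₁
    dl-ok (suc j) j<n = trans (proj₁ (proj₂ (proj₂ (proj₂ (proj₂ loop-ok)))) (suc j) j<n) (inside 3 (suc j) (NP.n≤1+n 3) (s≤s (s≤s z≤n)) j<n (s≤s z≤n))

    wt-ok : ∀ j → j < n → ⟦ readJobs ⟧ s (arr WT j) ≡ s (raw (4 + j * 3))
    wt-ok zero    _   = trans (proj₂ (proj₂ (proj₁ (proj₂ (proj₂ loop-ok))))) e₂
    wt-ok (suc j) j<n = trans (proj₂ (proj₂ (proj₂ (proj₂ (proj₂ loop-ok)))) (suc j) j<n) (inside 4 (suc j) NP.≤-refl (s≤s (s≤s z≤n)) j<n (s≤s z≤n))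

  module Sort (d : Bound) (s : State) (κ : ℕ → ℤ) (keys : ∀ g → g < β d → s (arr VAL g) ≡ κ g) where

    N = β d

    Compared : ℕ → ℕ → State → Set
    Compared e g t = t (sc 6) ≡ + e × t (sc 9) ≡ κ e × (∀ g → g < N → t (arr VAL g) ≡ κ g) ×
      t (sc 7) ≡ + count g (precedes κ e) × t (sc 8) ≡ + count g (λ g → κ g ≤ᵇℤ κ e)

    compare-ok : ∀ e g t → g < N → Compared e g t → Compared e (suc g) (⟦ compareKeys ⟧ (t [ sc 10 ↦ + g ]))
    compare-ok e g t g<N (e₆ , e₉ , ks , e₇ , e₈) =
      trans (frame compareKeys (sc 6) (t [ sc 10 ↦ + g ]) refl) e₆ ,
      trans (frame compareKeys (sc 9) (t [ sc 10 ↦ + g ]) refl) e₉ ,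
      (λ h h< → trans (frame compareKeys (arr VAL h) (t [ sc 10 ↦ + g ]) refl) (ks h h<)) ,
      counts₇ , counts₈
      where
      counts₇ : ⟦ compareKeys ⟧ (t [ sc 10 ↦ + g ]) (sc 7) ≡ + count (suc g) (precedes κ e)
      counts₇ rewrite ks g g<N | e₉ with κ g ≤ᵇℤ κ e
      ... | false = e₇
      ... | true with κ e ≤ᵇℤ κ g
      ...   | false = cong (1ℤ +ℤ_) e₇
      ...   | true rewrite e₆ with e Nat.≤ᵇ g
      ...     | true  = e₇
      ...     | false = cong (1ℤ +ℤ_) e₇
      counts₈ : ⟦ compareKeys ⟧ (t [ sc 10 ↦ + g ]) (sc 8) ≡ + count (suc g) (λ g → κ g ≤ᵇℤ κ e)
      counts₈ rewrite ks g g<N | e₉ with κ g ≤ᵇℤ κ e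
      ... | false = e₈
      ... | true with κ e ≤ᵇℤ κ g
      ...   | false = cong (1ℤ +ℤ_) e₈
      ...   | true rewrite e₆ with e Nat.≤ᵇ g
      ...     | true  = cong (1ℤ +ℤ_) e₈
      ...     | false = cong (1ℤ +ℤ_) e₈

    Slot : ℕ → State → ℕ → Set
    Slot i t q = (∃[ e ] e < i × rank κ N e ≡ q × t (arr ORD q) ≡ + e) ⊎
      ((∀ e → e < i → rank κ N e ≢ q) × t (arr ORD q) ≡ s (sc 12))

    Sorted : ℕ → State → Set
    Sorted i t = (∀ g → g < N → t (arr VAL g) ≡ κ g) × (∀ e → e < i → t (arr TOP e) ≡ + countUpTo κ N e) ×
      (∀ q → q < N → Slot i t q)

    rank-step : ∀ i t → i < N → Sorted i t → Sorted (suc i) (⟦ rankKey d ⟧ (t [ sc 6 ↦ + i ]))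
    rank-step i t i<N (ks , tops , slots) =
      (λ g g<N → trans (frame (rankKey d) (arr VAL g) (t [ sc 6 ↦ + i ]) refl) (ks g g<N)) ,
      tops′ , slots′
      where
      t₁ = ⟦ 7 ≔ num 0ℤ ⨾ 8 ≔ num 0ℤ ⨾ 9 ≔ get VAL (var 6) ⟧ (t [ sc 6 ↦ + i ])
      t₂ = ⟦ for d 10 compareKeys ⟧ t₁
      compared : Compared i N t₂
      compared = iterate-inv (Compared i) N _ (refl , ks i i<N , ks , refl , refl) (λ g t → compare-ok i g t)
      tops′ : ∀ e → e < suc i → ⟦ rankKey d ⟧ (t [ sc 6 ↦ + i ]) (arr TOP e) ≡ + countUpTo κ N e
      tops′ rewrite proj₁ compared = table-step (λ e → + countUpTo κ N e) (λ e → t₂ (arr TOP e)) i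
        (λ e e< → trans (frame (for d 10 compareKeys) (arr TOP e) t₁ refl) (tops e e<)) (proj₂ (proj₂ (proj₂ (proj₂ compared))))
      slots′ : ∀ q → q < N → Slot (suc i) (⟦ rankKey d ⟧ (t [ sc 6 ↦ + i ])) q
      slots′ q q<N rewrite proj₁ (proj₂ (proj₂ (proj₂ compared))) with q ≡ᵇ rank κ N i in eq
      ... | true = inj₁ (i , NP.≤-refl , sym (NP.≡ᵇ⇒≡ q _ (subst T (sym eq) tt)) , proj₁ compared)
      ... | false with slots q q<N
      ...   | inj₁ (e , e<i , r , v) = inj₁ (e , NP.m<n⇒m<1+n e<i , r , trans (frame (for d 10 compareKeys) (arr ORD q) t₁ refl) v)
      ...   | inj₂ (none , v) = inj₂ (none′ , trans (frame (for d 10 compareKeys) (arr ORD q) t₁ refl) v)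
        where
        none′ : ∀ e → e < suc i → rank κ N e ≢ q
        none′ e e< r with NP.m≤n⇒m<n∨m≡n (NP.≤-pred e<)
        ... | inj₁ e<i  = none e e<i r
        ... | inj₂ refl = subst T eq (NP.≡⇒≡ᵇ q _ (sym r))

    sorted : Sorted N (⟦ sortKeys d ⟧ s)
    sorted = iterate-inv Sorted N _
      ((λ g g<N → trans (frame (for d 6 (ORD [ 6 ]≔ var 12)) (arr VAL g) s refl) (keys g g<N)) , (λ _ ()) ,
       λ q q<N → inj₂ ((λ _ ()) , proj₂ (iterate-inv (λ i (t : State) → t (sc 12) ≡ s (sc 12) × (∀ q → q < i → t (arr ORD q) ≡ s (sc 12))) N _
         (refl , λ _ ()) (λ { i t _ (e , h) → e , table-step (λ _ → s (sc 12)) (λ q → t (arr ORD q)) i h e })) q q<N))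
      rank-step

sortJobs : Com
sortJobs =
  for #jobs 6 (VAL [ 6 ]≔ get DL (var 6)) ⨾ 12 ≔ var 3 ⨾ sortKeys #jobs ⨾
  for #jobs 6 (JORD [ 6 ]≔ get ORD (var 6))

fillRow : Com
fillRow = VAL [ 7 ]≔ var 8 ⨾ EA [ 7 ]≔ var 6 ⨾ EI [ 7 ]≔ var 9 ⨾ 8 ≔ plus (var 8) 4 ⨾ 7 ≔ plus (num 1ℤ) 7

fillGrid : Com
fillGrid = 7 ≔ num 0ℤ ⨾ for #jobs 6 (8 ≔ get REL (var 6) ⨾ for #rows 9 fillRow)

-- Comparing all pairs of the `n (n + 1)` grid points takes time of order `n ^ 4`, just within the
-- allowed bound.
sortGrid : Com
sortGrid = 12 ≔ num 0ℤ ⨾ sortKeys #cells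

adopt : Com
adopt = 8 ≔ var 10 ⨾ 9 ≔ var 11

-- Variable 8 is `n` until a candidate has been found, and variable 9 is meaningful only afterwards;
-- hence the test of 8 comes before the comparison with 9.
tryNext : Com
tryNext = 11 ≔ get REL (var 10) ⨾ if≤ 11 (var 7) skip (if≤ 3 (var 8) adopt (if≤ 11 (var 9) adopt skip))

findNext : Com
findNext = 7 ≔ get VAL (var 6) ⨾ 8 ≔ var 3 ⨾ for #jobs 10 tryNext ⨾ NXT [ 6 ]≔ var 8

setup : Com
setup = readJobs ⨾ powers ⨾ rowBases ⨾ sortJobs ⨾ fillGrid ⨾ sortGrid ⨾ for #cells 6 findNext

module Tables (n p : ℕ) (0<p : 0 < p) (rel dl wt : ℕ → ℤ) where
  open Grid n p 0<p rel dl

  -- The second chain of a block may start at any time after `val a h`. Its row in the chain table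
  -- is that of the first release time after this grid point, or the sentinel row `n` if there is
  -- none.
  record Next (e : ℕ) (x : ℤ) : Set where
    constructor next
    field
      z     : ℕ
      x≡    : x ≡ + z
      least : (z ≡ n × (∀ j → j < n → rel j ≤ℤ key e)) ⊎
              (z < n × key e <ℤ rel z × (∀ j → j < n → key e <ℤ rel j → rel z ≤ℤ rel j))

  record Tabulated (σ : State) : Set where
    field
      n-ok    : σ (sc 3) ≡ + n
      cells-ok : σ (sc 5) ≡ + M
      rel-ok  : ∀ j → j < n → σ (arr REL j) ≡ rel j
      dl-ok   : ∀ j → j < n → σ (arr DL j) ≡ dl j
      wt-ok   : ∀ j → j < n → σ (arr WT j) ≡ wt j
      pow-ok  : ∀ j → j < n → σ (arr POW j) ≡ + (2 ^ j)
      base-ok : ∀ z → z ≤ n → σ (arr RB z) ≡ + (z * suc M)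
      jord-ok : ∀ k → k < n → (∃[ j ] j < n × rank dl n j ≡ k × σ (arr JORD k) ≡ + j) ⊎
                              ((∀ j → j < n → rank dl n j ≢ k) × σ (arr JORD k) ≡ + n)
      val-ok  : ∀ e → e < M → σ (arr VAL e) ≡ key e
      ea-ok   : ∀ e → e < M → σ (arr EA e) ≡ + job-of e
      ei-ok   : ∀ e → e < M → σ (arr EI e) ≡ + index-of e
      top-ok  : ∀ e → e < M → σ (arr TOP e) ≡ + countUpTo key M e
      ord-ok  : ∀ q → q < M → (∃[ e ] e < M × rank key M e ≡ q × σ (arr ORD q) ≡ + e) ⊎
                              ((∀ e → e < M → rank key M e ≢ q) × σ (arr ORD q) ≡ 0ℤ)
      next-ok : ∀ e → e < M → Next e (σ (arr NXT e))

module SetupRun (b n p : ℕ) (0<p : 0 < p) (s : State)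
  (range : suc (suc (n * 3)) ≤ 5 + b)
  (e₀ : s (sc 0) ≡ s (raw 2)) (e₁ : s (sc 1) ≡ s (raw 3)) (e₂ : s (sc 2) ≡ s (raw 4))
  (e₃ : s (sc 3) ≡ + n) (e₄ : s (sc 4) ≡ + p) (e₅ : s (sc 5) ≡ + (n * suc n)) where

  rel dl wt : ℕ → ℤ
  rel j = s (raw (2 + j * 3))
  dl j  = s (raw (3 + j * 3))
  wt j  = s (raw (4 + j * 3))

  open Grid n p 0<p rel dl
  open Tables n p 0<p rel dl wt

  β : Bound → ℕ
  β = bounds n M

  open Semantics b β
  open Frame b β
  open Setups b β

  s₁ s₂ s₃ s₄ s₅ s₆ : State
  s₁ = ⟦ readJobs ⟧ s
  s₂ = ⟦ powers ⟧ s₁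
  s₃ = ⟦ rowBases ⟧ s₂
  s₄ = ⟦ sortJobs ⟧ s₃
  s₅ = ⟦ fillGrid ⟧ s₄
  s₆ = ⟦ sortGrid ⟧ s₅

  module RJ = ReadJobs s range e₀ e₁ e₂

  rel₃ : ∀ j → j < n → s₃ (arr REL j) ≡ rel j
  rel₃ j j<n = trans (frame (powers ⨾ rowBases) (arr REL j) s₁ refl) (RJ.rel-ok j j<n)

  dl₃ : ∀ j → j < n → s₃ (arr DL j) ≡ dl j
  dl₃ j j<n = trans (frame (powers ⨾ rowBases) (arr DL j) s₁ refl) (RJ.dl-ok j j<n)

  n₃ : s₃ (sc 3) ≡ + n
  n₃ = trans (frame (readJobs ⨾ powers ⨾ rowBases) (sc 3) s refl) e₃

  copied : State
  copied = ⟦ for #jobs 6 (VAL [ 6 ]≔ get DL (var 6)) ⟧ s₃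

  copied-ok : ∀ j → j < n → copied (arr VAL j) ≡ dl j
  copied-ok = proj₂ (iterate-inv (λ i (t : State) → (∀ j → j < n → t (arr DL j) ≡ dl j) × (∀ j → j < i → t (arr VAL j) ≡ dl j)) n _
    (dl₃ , λ _ ()) (λ { i t i<n (h , h′) → h , table-step dl (λ j → t (arr VAL j)) i h′ (h i i<n) }))

  module JS = Sort #jobs (⟦ 12 ≔ var 3 ⟧ copied) dl copied-ok

  jord-copy : ∀ k → k < n → s₄ (arr JORD k) ≡ ⟦ 12 ≔ var 3 ⨾ sortKeys #jobs ⟧ copied (arr ORD k)
  jord-copy = proj₂ (iterate-inv (λ i (t : State) → (∀ k → t (arr ORD k) ≡ u k) × (∀ k → k < i → t (arr JORD k) ≡ u k)) n _
    ((λ _ → refl) , λ _ ()) (λ { i t i<n (h , h′) → h , table-step u (λ j → t (arr JORD j)) i h′ (h i) }))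
    where
    u : ℕ → ℤ
    u k = ⟦ 12 ≔ var 3 ⨾ sortKeys #jobs ⟧ copied (arr ORD k)

  jord₄ : ∀ k → k < n → (∃[ j ] j < n × rank dl n j ≡ k × s₄ (arr JORD k) ≡ + j) ⊎
                        ((∀ j → j < n → rank dl n j ≢ k) × s₄ (arr JORD k) ≡ + n)
  jord₄ k k<n with proj₂ (proj₂ JS.sorted) k k<n
  ... | inj₁ (j , j<n , r , v) = inj₁ (j , j<n , r , trans (jord-copy k k<n) v)
  ... | inj₂ (none , v) = inj₂ (none , trans (jord-copy k k<n)
    (trans v (trans (frame (for #jobs 6 (VAL [ 6 ]≔ get DL (var 6))) (sc 3) s₃ refl) n₃)))

  Filled : ℕ → State → Set
  Filled e t = t (sc 7) ≡ + e × t (sc 4) ≡ + p × (∀ j → j < n → t (arr REL j) ≡ rel j) ×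
    (∀ f → f < e → t (arr VAL f) ≡ key f) × (∀ f → f < e → t (arr EA f) ≡ + job-of f) × (∀ f → f < e → t (arr EI f) ≡ + index-of f)

  val-suc : ∀ a i → val a i +ℤ + p ≡ val a (suc i)
  val-suc a i = trans (ZP.+-assoc (rel a) (+ (i * p)) (+ p)) (cong (λ z → rel a +ℤ + z) (NP.+-comm (i * p) p))

  filled : Filled M s₅
  filled = iterate-inv (λ a → Filled (a * m)) n _
    (refl , trans (frame (readJobs ⨾ powers ⨾ rowBases ⨾ sortJobs) (sc 4) s refl) e₄ ,
      (λ j j<n → trans (frame sortJobs (arr REL j) s₃ refl) (rel₃ j j<n)) , (λ _ ()) , (λ _ ()) , λ _ ())
    fill
    where
    fill : ∀ a t → a < n → Filled (a * m) t → Filled (suc a * m) (⟦ 8 ≔ get REL (var 6) ⨾ for #rows 9 fillRow ⟧ (t [ sc 6 ↦ + a ]))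
    fill a t a<n (e₇ , e₄ , rs , vs , as , is) = subst (λ e → Filled e (⟦ 8 ≔ get REL (var 6) ⨾ for #rows 9 fillRow ⟧ (t [ sc 6 ↦ + a ]))) (NP.+-comm (a * m) m) (proj₂ (proj₂
      (loop-inv (λ i (t : State) → t (sc 6) ≡ + a × t (sc 8) ≡ val a i × Filled (a * m + i) t) #rows 9 fillRow (⟦ 8 ≔ get REL (var 6) ⟧ (t [ sc 6 ↦ + a ]))
        (refl , trans (rs a a<n) (sym (ZP.+-identityʳ (rel a))) , start) cells)))
      where
      start : Filled (a * m + 0) (⟦ 8 ≔ get REL (var 6) ⟧ (t [ sc 6 ↦ + a ]))
      start = subst (λ e → Filled e (⟦ 8 ≔ get REL (var 6) ⟧ (t [ sc 6 ↦ + a ]))) (sym (NP.+-identityʳ (a * m))) (e₇ , e₄ , rs , vs , as , is)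
      cells : ∀ i t → i < m → t (sc 6) ≡ + a × t (sc 8) ≡ val a i × Filled (a * m + i) t →
        let t′ = ⟦ fillRow ⟧ (t [ sc 9 ↦ + i ]) in t′ (sc 6) ≡ + a × t′ (sc 8) ≡ val a (suc i) × Filled (a * m + suc i) t′
      cells i t (s≤s i≤n) (e₆ , e₈ , e₇ , e₄ , rs , vs , as , is) =
        e₆ , trans (cong₂ _+ℤ_ e₈ e₄) (val-suc a i) ,
        subst (λ e → Filled e (⟦ fillRow ⟧ (t [ sc 9 ↦ + i ]))) (sym (NP.+-suc (a * m) i))
          (cong (1ℤ +ℤ_) e₇ , e₄ , rs ,
           subst (λ x → ∀ f → f < suc (a * m + i) → (if f ≡ᵇ ∣ x ∣ then t (sc 8) else t (arr VAL f)) ≡ key f) (sym e₇)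
             (table-step key (λ f → t (arr VAL f)) (a * m + i) vs (trans e₈ (sym (key-point a i i≤n)))) ,
           subst (λ x → ∀ f → f < suc (a * m + i) → (if f ≡ᵇ ∣ x ∣ then t (sc 6) else t (arr EA f)) ≡ + job-of f) (sym e₇)
             (table-step (λ f → + job-of f) (λ f → t (arr EA f)) (a * m + i) as (trans e₆ (cong +_ (sym (job-of-point a i i≤n))))) ,
           subst (λ x → ∀ f → f < suc (a * m + i) → (if f ≡ᵇ ∣ x ∣ then + i else t (arr EI f)) ≡ + index-of f) (sym e₇)
             (table-step (λ f → + index-of f) (λ f → t (arr EI f)) (a * m + i) is (cong +_ (sym (index-of-point a i i≤n)))))

  module GS = Sort #cells (⟦ 12 ≔ num 0ℤ ⟧ s₅) key (proj₁ (proj₂ (proj₂ (proj₂ filled))))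

  Candidate : ℤ → ℕ → State → Set
  Candidate v i t = (t (sc 8) ≡ + n × (∀ j → j < i → rel j ≤ℤ v)) ⊎
    (∃[ z ] z < n × t (sc 8) ≡ + z × t (sc 9) ≡ rel z × v <ℤ rel z × (∀ j → j < i → v <ℤ rel j → rel z ≤ℤ rel j))

  Searching : ℤ → ℕ → State → Set
  Searching v i t = t (sc 3) ≡ + n × t (sc 7) ≡ v × (∀ j → j < n → t (arr REL j) ≡ rel j) × Candidate v i t

  below-suc : ∀ {R : ℕ → Set} {i} → (∀ j → j < i → R j) → R i → ∀ j → j < suc i → R j
  below-suc h r j j< with NP.m≤n⇒m<n∨m≡n (NP.≤-pred j<)
  ... | inj₁ j<i  = h j j<i
  ... | inj₂ refl = r

  search : ∀ v i t → i < n → Searching v i t → Searching v (suc i) (⟦ tryNext ⟧ (t [ sc 10 ↦ + i ]))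
  search v i t i<n (e₃ , e₇ , rs , c) =
    trans (frame tryNext (sc 3) t₀ refl) e₃ , trans (frame tryNext (sc 7) t₀ refl) e₇ ,
    (λ j j<n → trans (frame tryNext (arr REL j) t₀ refl) (rs j j<n)) ,
    if-case (Candidate v (suc i)) (t (arr REL i) ≤ᵇℤ t (sc 7))
      (λ le → skipped c (subst₂ _≤ℤ_ (rs i i<n) e₇ (ZP.≤ᵇ⇒≤ le)))
      (λ gt → let v<i = subst₂ _<ℤ_ e₇ (rs i i<n) (≤ᵇ-false gt) in
        if-case (Candidate v (suc i)) (t (sc 3) ≤ᵇℤ t (sc 8))
          (λ n≤ → inj₂ (i , i<n , refl , rs i i<n , v<i , first n≤ c))
          (λ n> → if-case (Candidate v (suc i)) (t (arr REL i) ≤ᵇℤ t (sc 9))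
            (λ le → inj₂ (i , i<n , refl , rs i i<n , v<i , better n> c (ZP.≤ᵇ⇒≤ le)))
            (λ gt → kept′ n> c (≤ᵇ-false gt))))
    where
    t₀ = t [ sc 10 ↦ + i ]
    t₁ = ⟦ 11 ≔ get REL (var 10) ⟧ t₀
    skipped : Candidate v i t → rel i ≤ℤ v → Candidate v (suc i) t₁
    skipped (inj₁ (e , h)) le = inj₁ (e , below-suc h le)
    skipped (inj₂ (z , z<n , e , e′ , v<z , h)) le =
      inj₂ (z , z<n , e , e′ , v<z , below-suc h (λ v<i → contradiction le (ZP.<⇒≱ v<i)))
    not-n : ∀ {z} → z < n → t (sc 8) ≡ + z → ¬ T (t (sc 3) ≤ᵇℤ t (sc 8))
    not-n z<n e q = NP.<⇒≱ z<n (ZP.drop‿+≤+ (ZP.≤ᵇ⇒≤ (subst₂ (λ x y → T (x ≤ᵇℤ y)) e₃ e q)))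
    is-n : t (sc 8) ≡ + n → T (t (sc 3) ≤ᵇℤ t (sc 8))
    is-n e = subst₂ (λ x y → T (x ≤ᵇℤ y)) (sym e₃) (sym e) (ZP.≤⇒≤ᵇ (ZP.≤-refl {+ n}))
    first : T (t (sc 3) ≤ᵇℤ t (sc 8)) → Candidate v i t → ∀ j → j < suc i → v <ℤ rel j → rel i ≤ℤ rel j
    first n≤ (inj₁ (_ , h)) = below-suc (λ j j<i v<j → contradiction (h j j<i) (ZP.<⇒≱ v<j)) (λ _ → ZP.≤-refl)
    first n≤ (inj₂ (z , z<n , e , _)) = contradiction n≤ (not-n z<n e)
    better : ¬ T (t (sc 3) ≤ᵇℤ t (sc 8)) → Candidate v i t → t (arr REL i) ≤ℤ t (sc 9) → ∀ j → j < suc i → v <ℤ rel j → rel i ≤ℤ rel j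
    better n> (inj₁ (e , _)) le = contradiction (is-n e) n>
    better n> (inj₂ (z , z<n , e , e′ , v<z , h)) le =
      below-suc (λ j j<i v<j → ZP.≤-trans (subst₂ _≤ℤ_ (rs i i<n) e′ le) (h j j<i v<j)) (λ _ → ZP.≤-refl)
    kept′ : ¬ T (t (sc 3) ≤ᵇℤ t (sc 8)) → Candidate v i t → t (sc 9) <ℤ t (arr REL i) → Candidate v (suc i) t₁
    kept′ n> (inj₁ (e , _)) gt = contradiction (is-n e) n>
    kept′ n> (inj₂ (z , z<n , e , e′ , v<z , h)) gt =
      inj₂ (z , z<n , e , e′ , v<z , below-suc h (λ _ → ZP.<⇒≤ (subst₂ _<ℤ_ e′ (rs i i<n) gt)))

  to-next : ∀ {e t x} → Candidate (key e) n t → x ≡ t (sc 8) → Next e x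
  to-next (inj₁ (q , h)) e = next n (trans e q) (inj₁ (refl , h))
  to-next (inj₂ (z , z<n , q , _ , v<z , h)) e = next z (trans e q) (inj₂ (z<n , v<z , h))

  Nexts : ℕ → State → Set
  Nexts i t = t (sc 3) ≡ + n × (∀ j → j < n → t (arr REL j) ≡ rel j) × (∀ e → e < M → t (arr VAL e) ≡ key e) ×
    (∀ e → e < i → Next e (t (arr NXT e)))

  nexts : Nexts M (⟦ for #cells 6 findNext ⟧ s₆)
  nexts = iterate-inv Nexts M _
    (trans (frame (readJobs ⨾ powers ⨾ rowBases ⨾ sortJobs ⨾ fillGrid ⨾ sortGrid) (sc 3) s refl) e₃ ,
     (λ j j<n → trans (frame (sortJobs ⨾ fillGrid ⨾ sortGrid) (arr REL j) s₃ refl) (rel₃ j j<n)) ,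
     proj₁ GS.sorted , λ _ ())
    each
    where
    each : ∀ e t → e < M → Nexts e t → Nexts (suc e) (⟦ findNext ⟧ (t [ sc 6 ↦ + e ]))
    each e t e<M (e₃ , rs , vs , ns) =
      trans (frame findNext (sc 3) t₀ refl) e₃ ,
      (λ j j<n → trans (frame findNext (arr REL j) t₀ refl) (rs j j<n)) ,
      (λ f f<M → trans (frame findNext (arr VAL f) t₀ refl) (vs f f<M)) , entries
      where
      t₀ = t [ sc 6 ↦ + e ]
      t₁ = ⟦ 7 ≔ get VAL (var 6) ⨾ 8 ≔ var 3 ⟧ t₀
      t₂ = ⟦ for #jobs 10 tryNext ⟧ t₁
      found : Searching (key e) n t₂
      found = iterate-inv (Searching (key e)) n _ (e₃ , vs e e<M , rs , inj₁ (e₃ , λ _ ())) (search (key e))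
      e₆ : t₂ (sc 6) ≡ + e
      e₆ = frame (for #jobs 10 tryNext) (sc 6) t₁ refl
      entries : ∀ f → f < suc e → Next f (⟦ findNext ⟧ t₀ (arr NXT f))
      entries f f< rewrite e₆ with NP.m≤n⇒m<n∨m≡n (NP.≤-pred f<)
      ... | inj₂ refl = to-next {t = t₂} (proj₂ (proj₂ (proj₂ found))) (table-same (λ f → t₂ (arr NXT f)) f (t₂ (sc 8)))
      ... | inj₁ f<e rewrite ≡ᵇ-false (NP.<⇒≢ f<e) =
        subst (Next f) (sym (frame (for #jobs 10 tryNext) (arr NXT f) t₁ refl)) (ns f f<e)

  tabulated : Tabulated (⟦ setup ⟧ s)
  tabulated = record
    { n-ok    = trans (frame setup (sc 3) s refl) e₃
    ; cells-ok = trans (frame setup (sc 5) s refl) e₅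
    ; rel-ok  = proj₁ (proj₂ nexts)
    ; dl-ok   = λ j j<n → trans (frame (sortJobs ⨾ fillGrid ⨾ sortGrid ⨾ for #cells 6 findNext) (arr DL j) s₃ refl) (dl₃ j j<n)
    ; wt-ok   = λ j j<n → trans (frame (powers ⨾ rowBases ⨾ sortJobs ⨾ fillGrid ⨾ sortGrid ⨾ for #cells 6 findNext) (arr WT j) s₁ refl) (RJ.wt-ok j j<n)
    ; pow-ok  = λ j j<n → trans (frame (rowBases ⨾ sortJobs ⨾ fillGrid ⨾ sortGrid ⨾ for #cells 6 findNext) (arr POW j) s₂ refl) (powers-ok s₁ j j<n)
    ; base-ok = λ z z≤ → trans (frame (sortJobs ⨾ fillGrid ⨾ sortGrid ⨾ for #cells 6 findNext) (arr RB z) s₃ refl)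
        (rowBases-ok s₂ M (trans (frame (readJobs ⨾ powers) (sc 5) s refl) e₅) z (s≤s z≤))
    ; jord-ok = λ k k<n → subst (λ x → (∃[ j ] j < n × rank dl n j ≡ k × x ≡ + j) ⊎ ((∀ j → j < n → rank dl n j ≢ k) × x ≡ + n))
        (sym (frame (fillGrid ⨾ sortGrid ⨾ for #cells 6 findNext) (arr JORD k) s₄ refl)) (jord₄ k k<n)
    ; val-ok  = proj₁ (proj₂ (proj₂ nexts))
    ; ea-ok   = λ e e<M → trans (frame (sortGrid ⨾ for #cells 6 findNext) (arr EA e) s₅ refl) (proj₁ (proj₂ (proj₂ (proj₂ (proj₂ filled)))) e e<M)
    ; ei-ok   = λ e e<M → trans (frame (sortGrid ⨾ for #cells 6 findNext) (arr EI e) s₅ refl) (proj₂ (proj₂ (proj₂ (proj₂ (proj₂ filled)))) e e<M)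
    ; top-ok  = λ e e<M → trans (frame (for #cells 6 findNext) (arr TOP e) s₆ refl) (proj₁ (proj₂ GS.sorted) e e<M)
    ; ord-ok  = λ q q<M → subst (λ x → (∃[ e ] e < M × rank key M e ≡ q × x ≡ + e) ⊎ ((∀ e → e < M → rank key M e ≢ q) × x ≡ 0ℤ))
        (sym (frame (for #cells 6 findNext) (arr ORD q) s₆ refl)) (proj₂ (proj₂ GS.sorted) q q<M)
    ; next-ok = proj₂ (proj₂ (proj₂ nexts)) }

-- Optimality of table entries and the recurrences for chains and blocks

wsum : (ℕ → ℤ) → List ℕ → ℤ
wsum ω []      = 0ℤ
wsum ω (j ∷ L) = ω j +ℤ wsum ω L

wsum-++ : ∀ ω L L′ → wsum ω (L ++ L′) ≡ wsum ω L +ℤ wsum ω L′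
wsum-++ ω []      L′ = sym (ZP.+-identityˡ _)
wsum-++ ω (j ∷ L) L′ = trans (cong (ω j +ℤ_) (wsum-++ ω L L′)) (sym (ZP.+-assoc (ω j) (wsum ω L) (wsum ω L′)))

power : ℕ → ℤ
power j = + (2 ^ j)

-- The table entry (x , y) holds the largest weight of a set satisfying P and a bit mask of such a set.
module Best (wt : ℕ → ℤ) where

  record Best (P : List ℕ → Set) (x y : ℤ) : Set where
    constructor best
    field
      attained : ∃[ L ] P L × x ≡ wsum wt L × y ≡ wsum power L
      maximal  : ∀ L → P L → wsum wt L ≤ℤ x

  best-iso : ∀ {P Q x y} → (∀ {L} → P L → Q L) → (∀ {L} → Q L → P L) → Best P x y → Best Q x y
  best-iso f g (best (L , p , e , e′) max) = best (L , f p , e , e′) (λ L q → max L (g q))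

  best-empty : ∀ {P} → P [] → (∀ {L} → P L → L ≡ []) → Best P 0ℤ 0ℤ
  best-empty p only = best ([] , p , refl , refl) (λ L q → ZP.≤-reflexive (cong (wsum wt) (only q)))

  -- Adding a family Q of sets: the larger of two table entries is the entry of the union.
  best-keep : ∀ {P Q x y x′} → (∀ {L} → P L → Q L) → (∀ {L} → Q L → P L ⊎ wsum wt L ≤ℤ x′) → x′ ≤ℤ x →
    Best P x y → Best Q x y
  best-keep {P} {Q} {x} {y} {x′} f g le (best (L , p , e , e′) max) = best (L , f p , e , e′) bound
    where
    bound : ∀ L → Q L → wsum wt L ≤ℤ x
    bound L q with g q
    ... | inj₁ p = max L p
    ... | inj₂ w = ZP.≤-trans w le

  best-replace : ∀ {P Q x y x′ y′} → ∃[ L ] Q L × x′ ≡ wsum wt L × y′ ≡ wsum power L →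
    (∀ {L} → Q L → P L ⊎ wsum wt L ≤ℤ x′) → x <ℤ x′ → Best P x y → Best Q x′ y′
  best-replace {P} {Q} {x} {y} {x′} new g lt (best _ max) = best new bound
    where
    bound : ∀ L → Q L → wsum wt L ≤ℤ x′
    bound L q with g q
    ... | inj₁ p = ZP.≤-trans (max L p) (ZP.<⇒≤ lt)
    ... | inj₂ w = w

module Recursion (n p : ℕ) (0<p : 0 < p) (rel dl wt : ℕ → ℤ) where
  open Grid n p 0<p rel dl public
  open Order order using (pos; top; jrk; pos<top⇒≤; ≤⇒pos<top; jrk-inj) public
  open Blocks order public
  open Best wt public

  chain-mono : ∀ {k x q q′ L} → q ≤ q′ → Chain k x q L → Chain k x q′ L
  chain-mono q≤ [] = []
  chain-mono q≤ (snoc a<n 0<i i≤n x≤a lt C B) = snoc a<n 0<i i≤n x≤a (NP.<-≤-trans lt q≤) C B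

  -- A chain depends on its start `x` only through the set of jobs released at or after `x`.
  chain-restart : ∀ {k x x′ q L} → (∀ a → a < n → x ≤ℤ rel a → x′ ≤ℤ rel a) → Chain k x q L → Chain k x′ q L
  chain-restart f [] = []
  chain-restart f (snoc a<n 0<i i≤n x≤a lt C B) = snoc a<n 0<i i≤n (f _ a<n x≤a) lt (chain-restart f C) B

  Last : ℕ → ℤ → ℕ → ℕ → List ℕ → Set
  Last k x a i L = ∃[ L₁ ] ∃[ L₂ ] Chain k x (top a 0) L₁ × Block k a i L₂ × L ≡ L₁ ++ L₂

  chain-last : ∀ {k x q L} → Chain k x (suc q) L →
    Chain k x q L ⊎ (∃[ a ] ∃[ i ] a < n × 0 < i × i ≤ n × x ≤ℤ rel a × pos a i ≡ q × Last k x a i L)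
  chain-last [] = inj₁ []
  chain-last (snoc {a} {i} {L} {L′} a<n 0<i i≤n x≤a lt C B) with NP.m≤n⇒m<n∨m≡n (NP.≤-pred lt)
  ... | inj₁ l = inj₁ (snoc a<n 0<i i≤n x≤a l C B)
  ... | inj₂ e = inj₂ (a , i , a<n , 0<i , i≤n , x≤a , e , L , L′ , C , B , refl)

  best-skip : ∀ {k x q u v} → (∀ a i → a < n → 0 < i → i ≤ n → x ≤ℤ rel a → pos a i ≢ q) →
    Best (Chain k x q) u v → Best (Chain k x (suc q)) u v
  best-skip {k} {x} {q} none = best-iso (chain-mono (NP.n≤1+n q)) back
    where
    back : ∀ {L} → Chain k x (suc q) L → Chain k x q L
    back C with chain-last C
    ... | inj₁ D = D
    ... | inj₂ (a , i , a<n , 0<i , i≤n , x≤a , e , _) = contradiction e (none a i a<n 0<i i≤n x≤a)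

  point-injective : ∀ a i b k → i ≤ n → k ≤ n → point a i ≡ point b k → a ≡ b × i ≡ k
  point-injective a i b k i≤n k≤n e =
    trans (sym (job-of-point a i i≤n)) (trans (cong job-of e) (job-of-point b k k≤n)) ,
    trans (sym (index-of-point a i i≤n)) (trans (cong index-of e) (index-of-point b k k≤n))

  module _ {k : ℕ} {x : ℤ} {q a i : ℕ} (a<n : a < n) (0<i : 0 < i) (i≤n : i ≤ n) (x≤a : x ≤ℤ rel a) (pos≡ : pos a i ≡ q) where

    with-last : ∀ {u u′ v v′} → Best (Chain k x (top a 0)) u u′ → Best (Block k a i) v v′ →
      ∃[ L ] Chain k x (suc q) L × u +ℤ v ≡ wsum wt L × u′ +ℤ v′ ≡ wsum power L
    with-last (best (L₁ , C , e₁ , e₁′) _) (best (L₂ , B , e₂ , e₂′) _) = L₁ ++ L₂ ,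
      snoc a<n 0<i i≤n x≤a (subst (_< suc q) (sym pos≡) NP.≤-refl) C B ,
      trans (cong₂ _+ℤ_ e₁ e₂) (sym (wsum-++ wt L₁ L₂)) , trans (cong₂ _+ℤ_ e₁′ e₂′) (sym (wsum-++ power L₁ L₂))

    -- Positions are injective, so `(a , i)` is the only grid point with position `q`. A chain that
    -- is new for the limit `q + 1` must end with a block at this point, and its two parts are
    -- bounded separately.
    last-≤ : ∀ {u u′ v v′ L} → Best (Chain k x (top a 0)) u u′ → Best (Block k a i) v v′ →
      Chain k x (suc q) L → Chain k x q L ⊎ wsum wt L ≤ℤ u +ℤ v
    last-≤ β₁ β₂ C with chain-last C
    ... | inj₁ D = inj₁ D
    ... | inj₂ (b , h , b<n , 0<h , h≤n , x≤b , e , L₁ , L₂ , C₁ , B , refl)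
      with point-injective b h a i h≤n i≤n (pos-injective (point<M b<n h≤n) (point<M a<n i≤n) (trans e (sym pos≡)))
    ...   | refl , refl = inj₂ (ZP.≤-trans (ZP.≤-reflexive (wsum-++ wt L₁ L₂))
      (ZP.+-mono-≤ (Best.maximal β₁ L₁ C₁) (Best.maximal β₂ L₂ B)))

    best-last-keep : ∀ {u u′ v v′ w w′} → Best (Chain k x (top a 0)) u u′ → Best (Block k a i) v v′ → u +ℤ v ≤ℤ w →
      Best (Chain k x q) w w′ → Best (Chain k x (suc q)) w w′
    best-last-keep β₁ β₂ le = best-keep (chain-mono (NP.n≤1+n q)) (last-≤ β₁ β₂) le

    best-last-new : ∀ {u u′ v v′ w w′} → Best (Chain k x (top a 0)) u u′ → Best (Block k a i) v v′ → w <ℤ u +ℤ v →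
      Best (Chain k x q) w w′ → Best (Chain k x (suc q)) (u +ℤ v) (u′ +ℤ v′)
    best-last-new β₁ β₂ lt = best-replace (with-last β₁ β₂) (last-≤ β₁ β₂) lt

  block-mono : ∀ {k k′ a i L} → k ≤ k′ → Block k a i L → Block k′ a i L
  block-mono = Completeness.block-mono order

  block-zero : ∀ {a i L} → Block 0 a i L → L ≡ []
  block-zero empty = refl
  block-zero (block _ () _ _ _ _ _ _)

  -- The blocks in which the job j of deadline rank k runs last, with given h.
  module NewBlock {k j : ℕ} (j<n : j < n) (jrk≡ : jrk j ≡ k) (a i : ℕ) where

    record New (h : ℕ) (L : List ℕ) : Set where
      constructor new
      field
        {J K} : List ℕ
        h<i : h < i
        a≤j : rel a ≤ℤ rel j
        j≤h : rel j ≤ℤ val a h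
        i≤d : val a i ≤ℤ dl j
        CJ  : Chain k (rel a) (top a h) J
        CK  : Chain k (sucℤ (val a h)) (top a i) K
        L≡  : L ≡ j ∷ J ++ K

    -- The family covered when the loop over the split points has tried all values below `h`: the
    -- old blocks and the new ones with a smaller split point.
    UpTo : ℕ → List ℕ → Set
    UpTo h L = Block k a i L ⊎ ∃[ h′ ] h′ < h × New h′ L

    new⇒block : ∀ {h L} → New h L → Block (suc k) a i L
    new⇒block (new h<i a≤j j≤h i≤d CJ CK refl) = block j<n (NP.≤-reflexive (cong suc jrk≡)) h<i a≤j j≤h i≤d
      (subst (λ z → Chain z _ _ _) (sym jrk≡) CJ) (subst (λ z → Chain z _ _ _) (sym jrk≡) CK)

    upTo⇒block : ∀ {h L} → UpTo h L → Block (suc k) a i L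
    upTo⇒block (inj₁ B) = block-mono (NP.n≤1+n k) B
    upTo⇒block (inj₂ (_ , _ , N)) = new⇒block N

    block⇒ : ∀ {L} → Block (suc k) a i L → Block k a i L ⊎ ∃[ h ] New h L
    block⇒ empty = inj₁ empty
    block⇒ (block {j′} {h} j′<n lt h<i a≤j j≤h i≤d CJ CK) with NP.m≤n⇒m<n∨m≡n (NP.≤-pred lt)
    ... | inj₁ l = inj₁ (block j′<n l h<i a≤j j≤h i≤d CJ CK)
    ... | inj₂ refl with jrk-inj j′ j j′<n j<n (sym jrk≡)
    ...   | refl = inj₂ (h , new h<i a≤j j≤h i≤d CJ CK refl)

    best-none : ∀ {x y} → (∀ h L → ¬ New h L) → Best (Block k a i) x y → Best (Block (suc k) a i) x y
    best-none none = best-iso (block-mono (NP.n≤1+n k)) back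
      where
      back : ∀ {L} → Block (suc k) a i L → Block k a i L
      back B with block⇒ B
      ... | inj₁ B′ = B′
      ... | inj₂ (h , N) = contradiction N (none h _)

    best-start : ∀ {x y} → Best (Block k a i) x y → Best (UpTo 0) x y
    best-start = best-iso inj₁ λ { (inj₁ B) → B }

    -- Trying all values below `n` misses nothing, because `h < i ≤ n` in every block.
    best-end : ∀ {x y} → i ≤ n → Best (UpTo n) x y → Best (Block (suc k) a i) x y
    best-end i≤n = best-iso upTo⇒block back
      where
      back : ∀ {L} → Block (suc k) a i L → UpTo n L
      back B with block⇒ B
      ... | inj₁ B′ = inj₁ B′
      ... | inj₂ (h , N) = inj₂ (h , NP.<-≤-trans (New.h<i N) i≤n , N)

    upTo-suc : ∀ {h L} → UpTo h L → UpTo (suc h) L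
    upTo-suc (inj₁ B) = inj₁ B
    upTo-suc (inj₂ (h′ , lt , N)) = inj₂ (h′ , NP.m<n⇒m<1+n lt , N)

    upTo-last : ∀ {h L} → UpTo (suc h) L → UpTo h L ⊎ New h L
    upTo-last (inj₁ B) = inj₁ (inj₁ B)
    upTo-last (inj₂ (h′ , lt , N)) with NP.m≤n⇒m<n∨m≡n (NP.≤-pred lt)
    ... | inj₁ l = inj₁ (inj₂ (h′ , l , N))
    ... | inj₂ refl = inj₂ N

    best-pass : ∀ {h x y} → (∀ L → ¬ New h L) → Best (UpTo h) x y → Best (UpTo (suc h)) x y
    best-pass none = best-iso upTo-suc back
      where
      back : ∀ {L} → UpTo (suc _) L → UpTo _ L
      back U with upTo-last U
      ... | inj₁ U′ = U′
      ... | inj₂ N = contradiction N (none _)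

    module _ {h : ℕ} {u u′ v v′ : ℤ} (h<i : h < i) (a≤j : rel a ≤ℤ rel j) (j≤h : rel j ≤ℤ val a h) (i≤d : val a i ≤ℤ dl j)
      (βJ : Best (Chain k (rel a) (top a h)) u u′) (βK : Best (Chain k (sucℤ (val a h)) (top a i)) v v′) where

      attained-new : ∃[ L ] UpTo (suc h) L × wt j +ℤ (u +ℤ v) ≡ wsum wt L × power j +ℤ (u′ +ℤ v′) ≡ wsum power L
      attained-new =
        let (J , CJ , e₁ , e₁′) = Best.attained βJ
            (K , CK , e₂ , e₂′) = Best.attained βK in
        j ∷ J ++ K , inj₂ (h , NP.≤-refl , new h<i a≤j j≤h i≤d CJ CK refl) ,
        cong (wt j +ℤ_) (trans (cong₂ _+ℤ_ e₁ e₂) (sym (wsum-++ wt J K))) ,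
        cong (power j +ℤ_) (trans (cong₂ _+ℤ_ e₁′ e₂′) (sym (wsum-++ power J K)))

      new-≤ : ∀ {L} → UpTo (suc h) L → UpTo h L ⊎ wsum wt L ≤ℤ wt j +ℤ (u +ℤ v)
      new-≤ U with upTo-last U
      ... | inj₁ U′ = inj₁ U′
      ... | inj₂ (new {J} {K} _ _ _ _ CJ CK refl) = inj₂ (ZP.+-monoʳ-≤ (wt j)
        (ZP.≤-trans (ZP.≤-reflexive (wsum-++ wt J K)) (ZP.+-mono-≤ (Best.maximal βJ J CJ) (Best.maximal βK K CK))))

      best-new-keep : ∀ {x y} → wt j +ℤ (u +ℤ v) ≤ℤ x → Best (UpTo h) x y → Best (UpTo (suc h)) x y
      best-new-keep le = best-keep upTo-suc new-≤ le

      best-new : ∀ {x y} → x <ℤ wt j +ℤ (u +ℤ v) → Best (UpTo h) x y →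
        Best (UpTo (suc h)) (wt j +ℤ (u +ℤ v)) (power j +ℤ (u′ +ℤ v′))
      best-new lt = best-replace attained-new new-≤ lt

-- Computing the chain tables

rTry : Com
rTry =
  -- Subtracting the index from the number of a grid point gives the point `(a , 0)`, the start of
  -- the block; the rest of the chain has to end by this time.
  30 ≔ plus (get TOP (minus (var 27) 28)) 21 ⨾ 31 ≔ get AW (var 27) ⨾ 31 ≔ plus (get RW (var 30)) 31 ⨾
  if≤ 31 (var 23) skip (23 ≔ var 31 ⨾ 32 ≔ get AM (var 27) ⨾ 24 ≔ plus (get RM (var 30)) 32)

rSelect : Com
rSelect = 27 ≔ get ORD (var 26) ⨾ 28 ≔ get EI (var 27) ⨾
  if≤ 28 (num 0ℤ) skip (29 ≔ get REL (get EA (var 27)) ⨾ if≤ 22 (var 29) rTry skip)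

rStore : Com
rStore = 25 ≔ plus (num 1ℤ) 25 ⨾ RW [ 25 ]≔ var 23 ⨾ RM [ 25 ]≔ var 24

rInit : Com
rInit = 21 ≔ get RB (var 20) ⨾ 22 ≔ get REL (var 20) ⨾ 23 ≔ num 0ℤ ⨾ 24 ≔ num 0ℤ ⨾ 25 ≔ var 21 ⨾
  RW [ 25 ]≔ num 0ℤ ⨾ RM [ 25 ]≔ num 0ℤ

-- Chain tables: for each start rel z, scan the grid points in increasing order.  Variables: 20 = z,
-- 21 = start of row z, 22 = rel z, (23 , 24) = current entry, 25 = its index, 26 = position, 27 = e, 28 = i.
rPhase : Com
rPhase = for #jobs 20 (rInit ⨾ for #cells 26 (rSelect ⨾ rStore))

-- A syntactic check that the results of the setup survive: these are the variables 0 to 5 and the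
-- twelve columns from `REL` to `NXT`.
confined : Com → Bool
confined skip           = true
confined (x ≔ E)        = not (x Nat.<ᵇ 6)
confined (c [ x ]≔ E)   = not (toℕ c Nat.<ᵇ 12)
confined (output x E)   = true
confined (if≤ x E C D)  = confined C ∧ confined D
confined (for d x C)    = not (x Nat.<ᵇ 6) ∧ confined C
confined (C ⨾ D)        = confined C ∧ confined D

static : Loc → Bool
static (sc x)    = x Nat.<ᵇ 6
static (arr c _) = toℕ c Nat.<ᵇ 12
static (raw _)   = false

∧-true : ∀ {x y} → x ∧ y ≡ true → x ≡ true × y ≡ true
∧-true {true} {true} _ = refl , refl

not-static : ∀ x y z → not (y Nat.<ᵇ z) ≡ true → (x Nat.<ᵇ z) ≡ true → (x ≡ᵇ y) ≡ false
not-static x y z p q = ≡ᵇ-false {x} {y} λ { refl → contradiction (trans (cong not (sym q)) p) (λ ()) }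

confined-static : ∀ C l → confined C ≡ true → static l ≡ true → writes C l ≡ false
confined-static skip l p q = refl
confined-static (x ≔ E) (sc y) p q = not-static y x 6 p q
confined-static (x ≔ E) (arr c i) p q = refl
confined-static (c [ x ]≔ E) (sc y) p q = refl
confined-static (c [ x ]≔ E) (arr d i) p q = not-static (toℕ d) (toℕ c) 12 p q
confined-static (output x E) (sc y) p q = refl
confined-static (output x E) (arr d i) p q = refl
confined-static (if≤ x E C D) l p q = let (p₁ , p₂) = ∧-true {confined C} p in
  cong₂ _∨_ (confined-static C l p₁ q) (confined-static D l p₂ q)
confined-static (for d x C) (sc y) p q = let (p₁ , p₂) = ∧-true {not (x Nat.<ᵇ 6)} p in
  cong₂ _∨_ (not-static y x 6 p₁ q) (confined-static C (sc y) p₂ q)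
confined-static (for d x C) (arr c i) p q = confined-static C (arr c i) (proj₂ (∧-true {not (x Nat.<ᵇ 6)} p)) q
confined-static (C ⨾ D) l p q = let (p₁ , p₂) = ∧-true {confined C} p in
  cong₂ _∨_ (confined-static C l p₁ q) (confined-static D l p₂ q)

module Phases (b n p : ℕ) (0<p : 0 < p) (rel dl wt : ℕ → ℤ) where
  open Recursion n p 0<p rel dl wt public
  open Tables n p 0<p rel dl wt public
  open Tabulated public
  open import Data.Nat.DivMod using (_%_; [m+kn]%n≡m%n; m<n⇒m%n≡m)

  β : Bound → ℕ
  β = bounds n M

  open Semantics b β public
  open Frame b β public

  tab-≗ : ∀ {s t} → (∀ l → static l ≡ true → t l ≡ s l) → Tabulated s → Tabulated t
  tab-≗ {s} {t} f τ = record
    { n-ok    = trans (f (sc 3) refl) (n-ok τ)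
    ; cells-ok = trans (f (sc 5) refl) (cells-ok τ)
    ; rel-ok  = λ j l → trans (f (arr REL j) refl) (rel-ok τ j l)
    ; dl-ok   = λ j l → trans (f (arr DL j) refl) (dl-ok τ j l)
    ; wt-ok   = λ j l → trans (f (arr WT j) refl) (wt-ok τ j l)
    ; pow-ok  = λ j l → trans (f (arr POW j) refl) (pow-ok τ j l)
    ; base-ok = λ z l → trans (f (arr RB z) refl) (base-ok τ z l)
    ; jord-ok = λ k l → subst (λ x → (∃[ j ] j < n × rank dl n j ≡ k × x ≡ + j) ⊎ ((∀ j → j < n → rank dl n j ≢ k) × x ≡ + n))
        (sym (f (arr JORD k) refl)) (jord-ok τ k l)
    ; val-ok  = λ e l → trans (f (arr VAL e) refl) (val-ok τ e l)
    ; ea-ok   = λ e l → trans (f (arr EA e) refl) (ea-ok τ e l)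
    ; ei-ok   = λ e l → trans (f (arr EI e) refl) (ei-ok τ e l)
    ; top-ok  = λ e l → trans (f (arr TOP e) refl) (top-ok τ e l)
    ; ord-ok  = λ q l → subst (λ x → (∃[ e ] e < M × rank key M e ≡ q × x ≡ + e) ⊎ ((∀ e → e < M → rank key M e ≢ q) × x ≡ 0ℤ))
        (sym (f (arr ORD q) refl)) (ord-ok τ q l)
    ; next-ok = λ e l → subst (Next e) (sym (f (arr NXT e) refl)) (next-ok τ e l) }

  tab : ∀ C {s} → confined C ≡ true → Tabulated s → Tabulated (⟦ C ⟧ s)
  tab C {s} p = tab-≗ (λ l q → frame C l s (confined-static C l p q))

  idx : ℕ → ℕ → ℕ
  idx z q = q + z * suc M

  idx-injective : ∀ {z q z′ q′} → q ≤ M → q′ ≤ M → idx z q ≡ idx z′ q′ → z ≡ z′ × q ≡ q′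
  idx-injective {z} {q} {z′} {q′} q≤ q′≤ e = NP.*-cancelʳ-≡ z z′ (suc M) (NP.+-cancelˡ-≡ q _ _ (trans e (cong (_+ z′ * suc M) (sym q≡)))) , q≡
    where
    rem : ∀ z q → q ≤ M → idx z q % suc M ≡ q
    rem z q q≤ = trans ([m+kn]%n≡m%n q z (suc M)) (m<n⇒m%n≡m (s≤s q≤))
    q≡ : q ≡ q′
    q≡ = trans (sym (rem z q q≤)) (trans (cong (_% suc M) e) (rem z′ q′ q′≤))

  RowOk : ℕ → State → ℕ → ℕ → Set
  RowOk k t z q = Best (Chain k (rel z) q) (t (arr RW (idx z q))) (t (arr RM (idx z q)))

  BlockOk : ℕ → State → ℕ → Set
  BlockOk k t e = Best (Block k (job-of e) (index-of e)) (t (arr AW e)) (t (arr AM e))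

  Zero : State → Set
  Zero t = ∀ q → q ≤ M → t (arr RW (idx n q)) ≡ 0ℤ × t (arr RM (idx n q)) ≡ 0ℤ

  row-≡ : ∀ {k s t} z q → t (arr RW (idx z q)) ≡ s (arr RW (idx z q)) → t (arr RM (idx z q)) ≡ s (arr RM (idx z q)) →
    RowOk k s z q → RowOk k t z q
  row-≡ {k} z q e e′ = subst₂ (Best (Chain k (rel z) q)) (sym e) (sym e′)

  block-≡ : ∀ {k s t} e → t (arr AW e) ≡ s (arr AW e) → t (arr AM e) ≡ s (arr AM e) → BlockOk k s e → BlockOk k t e
  block-≡ {k} e q q′ = subst₂ (Best (Block k (job-of e) (index-of e))) (sym q) (sym q′)

  rank≡pos : ∀ e → rank key M e ≡ pos (job-of e) (index-of e)
  rank≡pos e = cong (rank key M) (point-split e)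

  minus-index : ∀ e → + e -ℤ + index-of e ≡ + point (job-of e) 0
  minus-index e = begin
    + e -ℤ + index-of e                                       ≡⟨ cong (λ z → + z -ℤ + index-of e) (point-split e) ⟩
    + (job-of e * m) +ℤ + index-of e -ℤ + index-of e          ≡⟨ cancel (+ (job-of e * m)) (+ index-of e) ⟩
    + (job-of e * m)                                          ≡⟨ cong +_ (sym (NP.+-identityʳ _)) ⟩
    + point (job-of e) 0                                      ∎
    where
    open ≡-Reasoning
    cancel : ∀ x y → x +ℤ y -ℤ y ≡ x
    cancel = IntSolver.solve-∀

  -- The chain tables are rewritten in place. Only earlier rows, and the entries up to `q` in row
  -- `z`, are known to belong to the current round; the others may be left from the previous one.
  record Scan (k z q : ℕ) (t : State) : Set where
    field
      tabs  : Tabulated t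
      base≡ : t (sc 21) ≡ + (z * suc M)
      rel≡  : t (sc 22) ≡ rel z
      at≡   : t (sc 25) ≡ + idx z q
      cur   : Best (Chain k (rel z) q) (t (sc 23)) (t (sc 24))
      thisRow : ∀ q′ → q′ ≤ q → RowOk k t z q′
      rows  : ∀ z′ q′ → z′ < z → q′ ≤ M → RowOk k t z′ q′
      blocks : ∀ e → e < M → BlockOk k t e
      sentinel : Zero t
  open Scan

  select-ok : ∀ {k z q t} → z < n → q < M → Scan k z q t → t (sc 26) ≡ + q →
    Best (Chain k (rel z) (suc q)) (⟦ rSelect ⟧ t (sc 23)) (⟦ rSelect ⟧ t (sc 24))
  select-ok {k} {z} {q} {t} z<n q<M σ e₂₆ with ord-ok (tabs σ) q q<M
  ... | inj₂ (none , v) = if-case Q (t₂ (sc 28) ≤ᵇℤ 0ℤ) (λ _ → best-skip none′ (cur σ))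
      (λ gt → ⊥-elim (gt (subst (λ x → T (x ≤ᵇℤ 0ℤ)) (sym e₂₈) tt)))
    where
    Q : State → Set
    Q s = Best (Chain k (rel z) (suc q)) (s (sc 23)) (s (sc 24))
    t₂ = ⟦ 27 ≔ get ORD (var 26) ⨾ 28 ≔ get EI (var 27) ⟧ t
    e₂₇ : t (arr ORD ∣ t (sc 26) ∣) ≡ 0ℤ
    e₂₇ = trans (cong (λ x → t (arr ORD ∣ x ∣)) e₂₆) v
    e₂₈ : t₂ (sc 28) ≡ 0ℤ
    e₂₈ = trans (cong (λ x → t (arr EI ∣ x ∣)) e₂₇) (ei-ok (tabs σ) 0 (NP.≤-trans (s≤s z≤n) q<M))
    none′ : ∀ a i → a < n → 0 < i → i ≤ n → rel z ≤ℤ rel a → pos a i ≢ q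
    none′ a i a<n _ i≤n _ = none (point a i) (point<M a<n i≤n)
  ... | inj₁ (e , e<M , r , v) = if-case Q (t₂ (sc 28) ≤ᵇℤ 0ℤ)
      (λ le → best-skip (λ a′ i′ a′<n 0<i′ i′≤n _ e′ → NP.<⇒≱ 0<i′
          (subst (_≤ 0) (sym (proj₂ (same a′<n i′≤n e′))) (ZP.drop‿+≤+ (subst (_≤ℤ 0ℤ) e₂₈ (ZP.≤ᵇ⇒≤ le))))) (cur σ))
      (λ gt → if-case Q (t (sc 22) ≤ᵇℤ t₃ (sc 29))
        (λ le → try (ZP.drop‿+<+ (subst (0ℤ <ℤ_) e₂₈ (≤ᵇ-false gt))) (subst₂ _≤ℤ_ (rel≡ σ) e₂₉ (ZP.≤ᵇ⇒≤ le)))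
        (λ gt → best-skip (λ a′ i′ a′<n _ i′≤n x≤ e′ → ZP.<⇒≱ (subst₂ _<ℤ_ e₂₉ (rel≡ σ) (≤ᵇ-false gt))
          (subst (λ z′ → rel z ≤ℤ rel z′) (proj₁ (same a′<n i′≤n e′)) x≤)) (cur σ)))
    where
    Q : State → Set
    Q s = Best (Chain k (rel z) (suc q)) (s (sc 23)) (s (sc 24))
    a = job-of e
    i = index-of e
    a<n = job-of< e<M
    i≤n = index-of≤ e
    pos≡ : pos a i ≡ q
    pos≡ = trans (sym (rank≡pos e)) r
    same : ∀ {a′ i′} → a′ < n → i′ ≤ n → pos a′ i′ ≡ q → a′ ≡ a × i′ ≡ i
    same {a′} {i′} a′<n i′≤n e′ = point-injective a′ i′ a i i′≤n i≤n
      (pos-injective (point<M a′<n i′≤n) (point<M a<n i≤n) (trans e′ (sym pos≡)))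
    t₂ = ⟦ 27 ≔ get ORD (var 26) ⨾ 28 ≔ get EI (var 27) ⟧ t
    t₃ = ⟦ 29 ≔ get REL (get EA (var 27)) ⟧ t₂
    e₂₇ : t (arr ORD ∣ t (sc 26) ∣) ≡ + e
    e₂₇ = trans (cong (λ x → t (arr ORD ∣ x ∣)) e₂₆) v
    e₂₈ : t₂ (sc 28) ≡ + i
    e₂₈ = trans (cong (λ x → t (arr EI ∣ x ∣)) e₂₇) (ei-ok (tabs σ) e e<M)
    e₂₉ : t₃ (sc 29) ≡ rel a
    e₂₉ = trans (cong (λ x → t (arr REL ∣ t (arr EA ∣ x ∣) ∣)) e₂₇)
      (trans (cong (λ x → t (arr REL ∣ x ∣)) (ea-ok (tabs σ) e e<M)) (rel-ok (tabs σ) a a<n))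
    t₄ = ⟦ 30 ≔ plus (get TOP (minus (var 27) 28)) 21 ⨾ 31 ≔ get AW (var 27) ⨾ 31 ≔ plus (get RW (var 30)) 31 ⟧ t₃
    e₃₀ : t₄ (sc 30) ≡ + idx z (top a 0)
    e₃₀ = cong₂ _+ℤ_ (trans (cong (λ x → t (arr TOP ∣ x ∣)) (trans (cong₂ _-ℤ_ e₂₇ e₂₈) (minus-index e)))
      (top-ok (tabs σ) (point a 0) (point<M a<n z≤n))) (base≡ σ)
    e₃₁ : t₄ (sc 31) ≡ t (arr RW (idx z (top a 0))) +ℤ t (arr AW e)
    e₃₁ = cong₂ _+ℤ_ (cong (λ x → t (arr RW ∣ x ∣)) e₃₀) (cong (λ x → t (arr AW ∣ x ∣)) e₂₇)
    e₂₄ : t (arr RM ∣ t₄ (sc 30) ∣) +ℤ t (arr AM ∣ t (arr ORD ∣ t (sc 26) ∣) ∣) ≡ t (arr RM (idx z (top a 0))) +ℤ t (arr AM e)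
    e₂₄ = cong₂ _+ℤ_ (cong (λ x → t (arr RM ∣ x ∣)) e₃₀) (cong (λ x → t (arr AM ∣ x ∣)) e₂₇)
    try : 0 < i → rel z ≤ℤ rel a → Q (⟦ rTry ⟧ t₃)
    try 0<i z≤a = if-case Q (t₄ (sc 31) ≤ᵇℤ t (sc 23))
      (λ le → best-last-keep a<n 0<i i≤n z≤a pos≡ βC βB (subst (_≤ℤ t (sc 23)) e₃₁ (ZP.≤ᵇ⇒≤ le)) (cur σ))
      (λ gt → subst₂ (Best (Chain k (rel z) (suc q))) (sym e₃₁) (sym e₂₄)
        (best-last-new a<n 0<i i≤n z≤a pos≡ βC βB (subst (t (sc 23) <ℤ_) e₃₁ (≤ᵇ-false gt)) (cur σ)))
      where
      -- A block of positive length starts strictly before its end, so the entry that is read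
      -- belongs to the part of the row already rewritten in this round.
      top≤q : top a 0 ≤ q
      top≤q = subst (top a 0 ≤_) pos≡ (NP.≮⇒≥ λ lt → ZP.<⇒≱ (val-mono-< a 0<i)
        (pos<top⇒≤ a i a 0 a<n i≤n a<n z≤n lt))
      βC : RowOk k t z (top a 0)
      βC = thisRow σ (top a 0) top≤q
      βB : BlockOk k t e
      βB = blocks σ e e<M

  store-ok : ∀ {k z q t} → z < n → q < M → Scan k z q t → Scan k z (suc q) (⟦ rSelect ⨾ rStore ⟧ (t [ sc 26 ↦ + q ]))
  store-ok {k} {z} {q} {t} z<n q<M σ = record
    { tabs  = tab (26 ≔ num (+ q) ⨾ rSelect ⨾ rStore) refl (tabs σ)
    ; base≡ = trans (frame (rSelect ⨾ rStore) (sc 21) t₀ refl) (base≡ σ)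
    ; rel≡  = trans (frame (rSelect ⨾ rStore) (sc 22) t₀ refl) (rel≡ σ)
    ; at≡   = at′
    ; cur   = new
    ; thisRow = row′
    ; rows  = λ z′ q′ z′<z q′≤M → old z′ q′ q′≤M (λ e → NP.<⇒≢ z′<z (proj₁ e)) (rows σ z′ q′ z′<z q′≤M)
    ; blocks = λ e e<M → block-≡ {k} {t} {t₂} e (frame (rSelect ⨾ rStore) (arr AW e) t₀ refl) (frame (rSelect ⨾ rStore) (arr AM e) t₀ refl) (blocks σ e e<M)
    ; sentinel = λ q′ q′≤M → let (ne , ne′) = other n q′ q′≤M (λ e → NP.<⇒≢ z<n (sym (proj₁ e))) in
        trans ne (proj₁ (sentinel σ q′ q′≤M)) , trans ne′ (proj₂ (sentinel σ q′ q′≤M)) }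
    where
    t₀ = t [ sc 26 ↦ + q ]
    t₁ = ⟦ rSelect ⟧ t₀
    t₂ = ⟦ rStore ⟧ t₁
    σ₀ : Scan k z q t₀
    σ₀ = record { tabs = tab (26 ≔ num (+ q)) refl (tabs σ) ; base≡ = base≡ σ ; rel≡ = rel≡ σ ; at≡ = at≡ σ ; cur = cur σ
      ; thisRow = thisRow σ ; rows = rows σ ; blocks = blocks σ ; sentinel = sentinel σ }
    at′ : t₂ (sc 25) ≡ + idx z (suc q)
    at′ = cong (1ℤ +ℤ_) (trans (frame rSelect (sc 25) t₀ refl) (at≡ σ))
    new : Best (Chain k (rel z) (suc q)) (t₁ (sc 23)) (t₁ (sc 24))
    new = select-ok z<n q<M σ₀ refl
    other : ∀ z′ q′ → q′ ≤ M → ¬ (z′ ≡ z × q′ ≡ suc q) →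
      t₂ (arr RW (idx z′ q′)) ≡ t (arr RW (idx z′ q′)) × t₂ (arr RM (idx z′ q′)) ≡ t (arr RM (idx z′ q′))
    other z′ q′ q′≤M ne rewrite at′ | ≡ᵇ-false {idx z′ q′} {idx z (suc q)} (λ e → ne (idx-injective q′≤M q<M e)) =
      frame rSelect (arr RW (idx z′ q′)) t₀ refl , frame rSelect (arr RM (idx z′ q′)) t₀ refl
    old : ∀ z′ q′ → q′ ≤ M → ¬ (z′ ≡ z × q′ ≡ suc q) → RowOk k t z′ q′ → RowOk k t₂ z′ q′
    old z′ q′ q′≤M ne = let (e , e′) = other z′ q′ q′≤M ne in row-≡ {k} {t} {t₂} z′ q′ e e′
    row′ : ∀ q′ → q′ ≤ suc q → RowOk k t₂ z q′
    row′ q′ q′≤ with NP.m≤n⇒m<n∨m≡n q′≤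
    ... | inj₁ lt   = old z q′ (NP.≤-trans (NP.≤-pred lt) (NP.<⇒≤ q<M)) (λ e → NP.<⇒≢ lt (proj₂ e)) (thisRow σ q′ (NP.≤-pred lt))
    ... | inj₂ refl = subst₂ (Best (Chain k (rel z) (suc q))) (sym RW-read) (sym RM-read) new
      where
      RW-read : t₂ (arr RW (idx z (suc q))) ≡ t₁ (sc 23)
      RW-read rewrite at′ = table-same (λ x → t₁ (arr RW x)) (idx z (suc q)) (t₁ (sc 23))
      RM-read : t₂ (arr RM (idx z (suc q))) ≡ t₁ (sc 24)
      RM-read rewrite at′ = table-same (λ x → t₁ (arr RM x)) (idx z (suc q)) (t₁ (sc 24))

  record Stage (k : ℕ) (t : State) : Set where
    field
      tabs   : Tabulated t
      blocks : ∀ e → e < M → BlockOk k t e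
      sentinel : Zero t

  Rows : ℕ → State → ℕ → Set
  Rows k t z = ∀ z′ q′ → z′ < z → q′ ≤ M → RowOk k t z′ q′

  chain-zero : ∀ {k x L} → Chain k x 0 L → L ≡ []
  chain-zero [] = refl
  chain-zero (snoc _ _ _ _ () _ _)

  rPhase-ok : ∀ {k t} → Stage k t → Stage k (⟦ rPhase ⟧ t) × Rows k (⟦ rPhase ⟧ t) n
  rPhase-ok {k} {t} σ = loop-inv (λ z t → Stage k t × Rows k t z) #jobs 20 (rInit ⨾ for #cells 26 (rSelect ⨾ rStore)) t
    (σ , λ _ _ ()) each
    where
    each : ∀ z t → z < n → Stage k t × Rows k t z →
      let t′ = ⟦ rInit ⨾ for #cells 26 (rSelect ⨾ rStore) ⟧ (t [ sc 20 ↦ + z ]) in Stage k t′ × Rows k t′ (suc z)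
    each z t z<n (σ , rs) = record { tabs = Scan.tabs σ′ ; blocks = Scan.blocks σ′ ; sentinel = Scan.sentinel σ′ } , rows′
      where
      t₁ = ⟦ rInit ⟧ (t [ sc 20 ↦ + z ])
      base : t₁ (sc 21) ≡ + (z * suc M)
      base = base-ok (Stage.tabs σ) z (NP.<⇒≤ z<n)
      other : ∀ z′ q′ → q′ ≤ M → z′ ≢ z → t₁ (arr RW (idx z′ q′)) ≡ t (arr RW (idx z′ q′)) × t₁ (arr RM (idx z′ q′)) ≡ t (arr RM (idx z′ q′))
      other z′ q′ q′≤M ne rewrite base-ok (Stage.tabs σ) z (NP.<⇒≤ z<n)
        | ≡ᵇ-false {idx z′ q′} {idx z 0} (λ e → ne (proj₁ (idx-injective q′≤M z≤n e))) = refl , refl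
      start-row : ∀ q′ → q′ ≤ 0 → RowOk k t₁ z q′
      start-row zero z≤n rewrite base-ok (Stage.tabs σ) z (NP.<⇒≤ z<n) =
        subst₂ (Best (Chain k (rel z) 0)) (sym (table-same (λ x → t (arr RW x)) (z * suc M) 0ℤ))
          (sym (table-same (λ x → t (arr RM x)) (z * suc M) 0ℤ)) (best-empty [] chain-zero)
      start : Scan k z 0 t₁
      start = record
        { tabs = tab (20 ≔ num (+ z) ⨾ rInit) refl (Stage.tabs σ)
        ; base≡ = base ; rel≡ = rel-ok (Stage.tabs σ) z z<n ; at≡ = base ; cur = best-empty [] chain-zero
        ; thisRow = start-row
        ; rows = λ z′ q′ z′<z q′≤M → let (e , e′) = other z′ q′ q′≤M (NP.<⇒≢ z′<z) in row-≡ {k} {t} {t₁} z′ q′ e e′ (rs z′ q′ z′<z q′≤M)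
        ; blocks = Stage.blocks σ
        ; sentinel = λ q′ q′≤M → let (e , e′) = other n q′ q′≤M (λ e → NP.<⇒≢ z<n (sym e)) in
            trans e (proj₁ (Stage.sentinel σ q′ q′≤M)) , trans e′ (proj₂ (Stage.sentinel σ q′ q′≤M)) }
      σ′ : Scan k z M (⟦ for #cells 26 (rSelect ⨾ rStore) ⟧ t₁)
      σ′ = loop-inv (Scan k z) #cells 26 (rSelect ⨾ rStore) t₁ start (λ q t q<M → store-ok z<n q<M)
      rows′ : Rows k (⟦ for #cells 26 (rSelect ⨾ rStore) ⟧ t₁) (suc z)
      rows′ z′ q′ z′< q′≤M with NP.m≤n⇒m<n∨m≡n (NP.≤-pred z′<)
      ... | inj₁ lt   = Scan.rows σ′ z′ q′ lt q′≤M
      ... | inj₂ refl = Scan.thisRow σ′ q′ q′≤M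

-- Computing the block tables

aTry : Com
aTry =
  28 ≔ get RB (var 22) ⨾ 28 ≔ plus (get TOP (var 26)) 28 ⨾
  -- `NXT` picks the row of the first release time after `val a h`; if there is none, this is row
  -- `n`, whose zeros describe the empty chain.
  29 ≔ get RB (get NXT (var 26)) ⨾ 29 ≔ plus (get TOP (var 20)) 29 ⨾
  30 ≔ get RW (var 29) ⨾ 30 ≔ plus (get RW (var 28)) 30 ⨾ 30 ≔ plus (var 36) 30 ⨾ 31 ≔ get AW (var 20) ⨾
  if≤ 30 (var 31) skip
    (AW [ 20 ]≔ var 30 ⨾ 32 ≔ get RM (var 29) ⨾ 32 ≔ plus (get RM (var 28)) 32 ⨾ AM [ 20 ]≔ plus (var 37) 32)

aStep : Com
aStep = if≤ 23 (var 25) skip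
  (26 ≔ plus (minus (var 20) 23) 25 ⨾ 27 ≔ get VAL (var 26) ⨾ if≤ 34 (var 27) aTry skip)

aRead : Com
aRead = 21 ≔ get VAL (var 20) ⨾ 22 ≔ get EA (var 20) ⨾ 23 ≔ get EI (var 20) ⨾ 24 ≔ get REL (var 22)

aEntry : Com
aEntry = aRead ⨾ if≤ 24 (var 34) (if≤ 21 (var 35) (for #jobs 25 aStep) skip) skip

-- Block tables: let the job of deadline rank k run last.  Variables: 20 = e, 22 = a, 23 = i, 25 = h,
-- 33 … 37 = the job with its release time, deadline, weight and bit, 40 = k.
aPhase : Com
aPhase = 33 ≔ get JORD (var 40) ⨾ if≤ 3 (var 33) skip
  (34 ≔ get REL (var 33) ⨾ 35 ≔ get DL (var 33) ⨾ 36 ≔ get WT (var 33) ⨾ 37 ≔ get POW (var 33) ⨾ for #cells 20 aEntry)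

module BlockPhase (b n p : ℕ) (0<p : 0 < p) (rel dl wt : ℕ → ℤ) where
  open Phases b n p 0<p rel dl wt public

  plus-index : ∀ e h → + e -ℤ + index-of e +ℤ + h ≡ + point (job-of e) h
  plus-index e h = trans (cong (_+ℤ + h) (minus-index e)) (cong (λ z → + (z + h)) (NP.+-identityʳ (job-of e * m)))

  Tables-ok : ℕ → State → Set
  Tables-ok k t = Tabulated t × Rows k t n × Zero t

  tables-frame : ∀ {k} C {s} → confined C ≡ true → (∀ i → writes C (arr RW i) ≡ false) → (∀ i → writes C (arr RM i) ≡ false) →
    Tables-ok k s → Tables-ok k (⟦ C ⟧ s)
  tables-frame {k} C {s} c w w′ (τ , rs , zs) = tab C c τ ,
    (λ z q z<n q≤M → row-≡ {k} {s} {⟦ C ⟧ s} z q (frame C _ s (w _)) (frame C _ s (w′ _)) (rs z q z<n q≤M)) ,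
    λ q q≤M → trans (frame C _ s (w _)) (proj₁ (zs q q≤M)) , trans (frame C _ s (w′ _)) (proj₂ (zs q q≤M))

  -- No release time lies strictly between `key e` and that of the job found, so both starts admit
  -- the same chains. If no job is released after `key e`, only the empty chain is left, and the
  -- sentinel row records it.
  next-row : ∀ {k e q t} → Tables-ok k t → q ≤ M → (nx : Next e (t (arr NXT e))) →
    Best (Chain k (sucℤ (key e)) q) (t (arr RW (idx (Next.z nx) q))) (t (arr RM (idx (Next.z nx) q)))
  next-row {k} {e} {q} {t} (τ , rs , zs) q≤M (next z _ (inj₂ (z<n , e<z , least))) =
    best-iso (chain-restart (λ a _ z≤a → ZP.≤-trans (ZP.i<j⇒suc[i]≤j e<z) z≤a))
             (chain-restart (λ a a<n e<a → least a a<n (suc≤⇒< e<a))) (rs z q z<n q≤M)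
  next-row {k} {e} {q} {t} (τ , rs , zs) q≤M (next z _ (inj₁ (refl , none))) =
    subst₂ (Best (Chain k (sucℤ (key e)) q)) (sym (proj₁ (zs q q≤M))) (sym (proj₂ (zs q q≤M)))
      (best-empty [] only)
    where
    only : ∀ {q L} → Chain k (sucℤ (key e)) q L → L ≡ []
    only [] = refl
    only (snoc {a} a<n _ _ e<a _ _ _) = contradiction (none a a<n) (ZP.<⇒≱ (suc≤⇒< e<a))

  hit : ∀ (g : ℕ → ℤ) {x y e} → x ≡ + e → (if e ≡ᵇ ∣ x ∣ then y else g e) ≡ y
  hit g {y = y} {e} refl = table-same g e y

  miss : ∀ (g : ℕ → ℤ) {x y e f} → x ≡ + e → f ≢ e → (if f ≡ᵇ ∣ x ∣ then y else g f) ≡ g f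
  miss g {y = y} refl f≢e = update-other g y f≢e

  module Entry {k j : ℕ} (j<n : j < n) (jrk≡ : jrk j ≡ k) {e : ℕ} (e<M : e < M) where

    a = job-of e
    i = index-of e
    a<n = job-of< e<M
    i≤n = index-of≤ e
    open NewBlock j<n jrk≡ a i

    record Filling (h : ℕ) (t : State) : Set where
      field
        tables : Tables-ok k t
        e≡     : t (sc 20) ≡ + e
        a≡     : t (sc 22) ≡ + a
        i≡     : t (sc 23) ≡ + i
        rel≡   : t (sc 34) ≡ rel j
        wt≡    : t (sc 36) ≡ wt j
        pow≡   : t (sc 37) ≡ power j
        cur    : Best (UpTo h) (t (arr AW e)) (t (arr AM e))
    open Filling

    Elsewhere : State → State → Set
    Elsewhere s t = ∀ f → f ≢ e → t (arr AW f) ≡ s (arr AW f) × t (arr AM f) ≡ s (arr AM f)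

    Outcome : ℕ → State → State → Set
    Outcome h s t = Best (UpTo h) (t (arr AW e)) (t (arr AM e)) × Elsewhere s t

    step-ok : ∀ {h t} → rel a ≤ℤ rel j → val a i ≤ℤ dl j → Filling h t → h < n → Outcome (suc h) t (⟦ aStep ⟧ (t [ sc 25 ↦ + h ]))
    step-ok {h} {t} a≤j i≤d φ h<n = if-case (Outcome (suc h) t) (t (sc 23) ≤ᵇℤ + h)
      (λ le → best-pass (λ L N → NP.<⇒≱ (New.h<i N) (ZP.drop‿+≤+ (subst (_≤ℤ + h) (i≡ φ) (ZP.≤ᵇ⇒≤ le)))) (cur φ) , λ _ _ → refl , refl)
      (λ gt → if-case (Outcome (suc h) t) (t (sc 34) ≤ᵇℤ t₁ (sc 27))
        (λ le → try (ZP.drop‿+<+ (subst (+ h <ℤ_) (i≡ φ) (≤ᵇ-false gt))) (subst₂ _≤ℤ_ (rel≡ φ) e₂₇ (ZP.≤ᵇ⇒≤ le)))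
        (λ gt′ → best-pass (λ L N → ZP.<⇒≱ (subst₂ _<ℤ_ e₂₇ (rel≡ φ) (≤ᵇ-false gt′)) (New.j≤h N)) (cur φ) , λ _ _ → refl , refl))
      where
      t₁ = ⟦ 26 ≔ plus (minus (var 20) 23) 25 ⨾ 27 ≔ get VAL (var 26) ⟧ (t [ sc 25 ↦ + h ])
      τ = proj₁ (tables φ)
      h≤n = NP.<⇒≤ h<n
      f = point a h
      f<M : f < M
      f<M = point<M a<n h≤n
      e₂₆ : t₁ (sc 26) ≡ + f
      e₂₆ = trans (cong₂ (λ x y → x -ℤ y +ℤ + h) (e≡ φ) (i≡ φ)) (plus-index e h)
      e₂₇ : t₁ (sc 27) ≡ val a h
      e₂₇ = trans (cong (λ x → t (arr VAL ∣ x ∣)) e₂₆) (trans (val-ok τ f f<M) (key-point a h h≤n))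
      nx : Next f (t (arr NXT f))
      nx = next-ok τ f f<M
      z = Next.z nx
      next≤n : z ≤ n
      next≤n with Next.least nx
      ... | inj₁ (q , _)   = NP.≤-reflexive q
      ... | inj₂ (z<n , _) = NP.<⇒≤ z<n
      t₂ = ⟦ 28 ≔ get RB (var 22) ⨾ 28 ≔ plus (get TOP (var 26)) 28 ⨾
             29 ≔ get RB (get NXT (var 26)) ⨾ 29 ≔ plus (get TOP (var 20)) 29 ⨾
             30 ≔ get RW (var 29) ⨾ 30 ≔ plus (get RW (var 28)) 30 ⨾ 30 ≔ plus (var 36) 30 ⨾ 31 ≔ get AW (var 20) ⟧ t₁
      e₂₈ : t₂ (sc 28) ≡ + idx a (top a h)
      e₂₈ = cong₂ _+ℤ_ (trans (cong (λ x → t (arr TOP ∣ x ∣)) e₂₆) (top-ok τ f f<M))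
        (trans (cong (λ x → t (arr RB ∣ x ∣)) (a≡ φ)) (base-ok τ a (NP.<⇒≤ a<n)))
      e₂₉ : t₂ (sc 29) ≡ + idx z (top a i)
      e₂₉ = cong₂ _+ℤ_ (trans (cong (λ x → t (arr TOP ∣ x ∣)) (e≡ φ)) (trans (top-ok τ e e<M) (cong (λ x → + countUpTo key M x) (point-split e))))
        (trans (cong (λ x → t (arr RB ∣ x ∣)) (trans (cong (λ x → t (arr NXT ∣ x ∣)) e₂₆) (Next.x≡ nx))) (base-ok τ z next≤n))
      u u′ v v′ : ℤ
      u  = t (arr RW (idx a (top a h)))
      u′ = t (arr RM (idx a (top a h)))
      v  = t (arr RW (idx z (top a i)))
      v′ = t (arr RM (idx z (top a i)))
      βJ : Best (Chain k (rel a) (top a h)) u u′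
      βJ = proj₁ (proj₂ (tables φ)) a (top a h) a<n (top≤M f)
      βK : Best (Chain k (sucℤ (val a h)) (top a i)) v v′
      βK = subst (λ x → Best (Chain k (sucℤ x) (top a i)) v v′) (key-point a h h≤n) (next-row (tables φ) (top≤M (point a i)) nx)
      e₃₀ : t₂ (sc 30) ≡ wt j +ℤ (u +ℤ v)
      e₃₀ = cong₂ _+ℤ_ (wt≡ φ) (cong₂ _+ℤ_ (cong (λ x → t (arr RW ∣ x ∣)) e₂₈) (cong (λ x → t (arr RW ∣ x ∣)) e₂₉))
      e₃₁ : t₂ (sc 31) ≡ t (arr AW e)
      e₃₁ = cong (λ x → t (arr AW ∣ x ∣)) (e≡ φ)
      mask : t (sc 37) +ℤ (t (arr RM ∣ t₂ (sc 28) ∣) +ℤ t (arr RM ∣ t₂ (sc 29) ∣)) ≡ power j +ℤ (u′ +ℤ v′)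
      mask = cong₂ _+ℤ_ (pow≡ φ) (cong₂ _+ℤ_ (cong (λ x → t (arr RM ∣ x ∣)) e₂₈) (cong (λ x → t (arr RM ∣ x ∣)) e₂₉))
      W : Com
      W = AW [ 20 ]≔ var 30 ⨾ 32 ≔ get RM (var 29) ⨾ 32 ≔ plus (get RM (var 28)) 32 ⨾ AM [ 20 ]≔ plus (var 37) 32
      written : ∀ x y → t₂ (sc 30) ≡ x → t (sc 37) +ℤ (t (arr RM ∣ t₂ (sc 28) ∣) +ℤ t (arr RM ∣ t₂ (sc 29) ∣)) ≡ y →
        Best (UpTo (suc h)) x y → Outcome (suc h) t (⟦ W ⟧ t₂)
      written x y ex ey β = subst₂ (Best (UpTo (suc h)))
          (sym (trans (hit (λ g → t (arr AW g)) (e≡ φ)) ex)) (sym (trans (hit (λ g → t (arr AM g)) (e≡ φ)) ey)) β ,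
        λ g g≢e → miss (λ g → t (arr AW g)) (e≡ φ) g≢e , miss (λ g → t (arr AM g)) (e≡ φ) g≢e
      try : h < i → rel j ≤ℤ val a h → Outcome (suc h) t (⟦ aTry ⟧ t₁)
      try h<i j≤h = if-case (Outcome (suc h) t) (t₂ (sc 30) ≤ᵇℤ t₂ (sc 31))
        (λ le → best-new-keep h<i a≤j j≤h i≤d βJ βK (subst₂ _≤ℤ_ e₃₀ e₃₁ (ZP.≤ᵇ⇒≤ le)) (cur φ) , λ _ _ → refl , refl)
        (λ gt → written _ _ e₃₀ mask (best-new h<i a≤j j≤h i≤d βJ βK (subst₂ _<ℤ_ e₃₁ e₃₀ (≤ᵇ-false gt)) (cur φ)))

    loop-ok : ∀ {t} → rel a ≤ℤ rel j → val a i ≤ℤ dl j → Filling 0 t → Outcome n t (⟦ for #jobs 25 aStep ⟧ t)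
    loop-ok {t} a≤j i≤d φ = let (φ′ , el) = loop-inv (λ h s → Filling h s × Elsewhere t s) #jobs 25 aStep t (φ , λ _ _ → refl , refl) each in
      cur φ′ , el
      where
      each : ∀ h s → h < n → Filling h s × Elsewhere t s → Filling (suc h) (⟦ aStep ⟧ (s [ sc 25 ↦ + h ])) × Elsewhere t (⟦ aStep ⟧ (s [ sc 25 ↦ + h ]))
      each h s h<n (ψ , el) = record
        { tables = tables-frame (25 ≔ num (+ h) ⨾ aStep) refl (λ _ → refl) (λ _ → refl) (tables ψ)
        ; e≡   = trans (frame aStep (sc 20) s₀ refl) (e≡ ψ)
        ; a≡   = trans (frame aStep (sc 22) s₀ refl) (a≡ ψ)
        ; i≡   = trans (frame aStep (sc 23) s₀ refl) (i≡ ψ)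
        ; rel≡ = trans (frame aStep (sc 34) s₀ refl) (rel≡ ψ)
        ; wt≡  = trans (frame aStep (sc 36) s₀ refl) (wt≡ ψ)
        ; pow≡ = trans (frame aStep (sc 37) s₀ refl) (pow≡ ψ)
        ; cur  = proj₁ out } ,
        λ f f≢e → trans (proj₁ (proj₂ out f f≢e)) (proj₁ (el f f≢e)) , trans (proj₂ (proj₂ out f f≢e)) (proj₂ (el f f≢e))
        where
        s₀ = s [ sc 25 ↦ + h ]
        out = step-ok a≤j i≤d ψ h<n

  -- The block tables are overwritten in place, so entries below `e` already admit rank `k` while
  -- the others do not. This is harmless, since a new entry combines its own old value with chain
  -- entries only.
  record Blocking (k j e : ℕ) (t : State) : Set where
    field
      tables : Tables-ok k t
      rel≡   : t (sc 34) ≡ rel j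
      dl≡    : t (sc 35) ≡ dl j
      wt≡    : t (sc 36) ≡ wt j
      pow≡   : t (sc 37) ≡ power j
      done-below : ∀ f → f < e → f < M → BlockOk (suc k) t f
      todo   : ∀ f → e ≤ f → f < M → BlockOk k t f
  open Blocking

  entry-ok : ∀ {k j e t} → j < n → jrk j ≡ k → e < M → Blocking k j e t → Blocking k j (suc e) (⟦ aEntry ⟧ (t [ sc 20 ↦ + e ]))
  entry-ok {k} {j} {e} {t} j<n jrk≡ e<M β = record
    { tables = tables-frame (20 ≔ num (+ e) ⨾ aEntry) refl (λ _ → refl) (λ _ → refl) (tables β)
    ; rel≡ = trans (frame aEntry (sc 34) t₀ refl) (rel≡ β)
    ; dl≡  = trans (frame aEntry (sc 35) t₀ refl) (dl≡ β)
    ; wt≡  = trans (frame aEntry (sc 36) t₀ refl) (wt≡ β)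
    ; pow≡ = trans (frame aEntry (sc 37) t₀ refl) (pow≡ β)
    ; done-below = below
    ; todo = λ f e<f f<M → let (q , q′) = proj₂ result f (λ z → NP.<⇒≢ e<f (sym z)) in
        block-≡ {k} {t} {t′} f q q′ (todo β f (NP.<⇒≤ e<f) f<M) }
    where
    t₀ = t [ sc 20 ↦ + e ]
    t₁ = ⟦ aRead ⟧ t₀
    t′ = ⟦ aEntry ⟧ t₀
    module E = Entry j<n jrk≡ e<M
    open E using (a; i; a<n; i≤n; Elsewhere)
    module N = NewBlock j<n jrk≡ a i
    τ = proj₁ (tables β)
    e₂₁ : t₁ (sc 21) ≡ val a i
    e₂₁ = val-ok τ e e<M
    e₂₄ : t₁ (sc 24) ≡ rel a
    e₂₄ = trans (cong (λ x → t (arr REL ∣ x ∣)) (ea-ok τ e e<M)) (rel-ok τ a a<n)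
    Result : State → Set
    Result s = Best (Block (suc k) a i) (s (arr AW e)) (s (arr AM e)) × Elsewhere t s
    start : Best (Block k a i) (t (arr AW e)) (t (arr AM e))
    start = todo β e NP.≤-refl e<M
    φ : E.Filling 0 t₁
    φ = record
      { tables = tables-frame (20 ≔ num (+ e) ⨾ aRead) refl (λ _ → refl) (λ _ → refl) (tables β)
      ; e≡ = refl ; a≡ = ea-ok τ e e<M ; i≡ = ei-ok τ e e<M ; rel≡ = rel≡ β ; wt≡ = wt≡ β ; pow≡ = pow≡ β
      ; cur = N.best-start start }
    result : Result t′
    result = if-case Result (t₁ (sc 24) ≤ᵇℤ t (sc 34))
      (λ a≤j → if-case Result (t₁ (sc 21) ≤ᵇℤ t (sc 35))
        (λ i≤d → let (c , el) = E.loop-ok {t₁} (subst₂ _≤ℤ_ e₂₄ (rel≡ β) (ZP.≤ᵇ⇒≤ a≤j)) (subst₂ _≤ℤ_ e₂₁ (dl≡ β) (ZP.≤ᵇ⇒≤ i≤d)) φ in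
          N.best-end i≤n c , el)
        (λ i>d → N.best-none (λ h L w → ZP.<⇒≱ (subst₂ _<ℤ_ (dl≡ β) e₂₁ (≤ᵇ-false i>d)) (N.New.i≤d w)) start , λ _ _ → refl , refl))
      (λ a>j → N.best-none (λ h L w → ZP.<⇒≱ (subst₂ _<ℤ_ (rel≡ β) e₂₄ (≤ᵇ-false a>j)) (N.New.a≤j w)) start , λ _ _ → refl , refl)
    below : ∀ f → f < suc e → f < M → BlockOk (suc k) t′ f
    below f f< f<M with NP.m≤n⇒m<n∨m≡n (NP.≤-pred f<)
    ... | inj₁ f<e  = let (q , q′) = proj₂ result f (NP.<⇒≢ f<e) in block-≡ {suc k} {t} {t′} f q q′ (done-below β f f<e f<M)
    ... | inj₂ refl = proj₁ result

  aPhase-ok : ∀ {k t} → k < n → t (sc 40) ≡ + k → Stage k t → Rows k t n → Stage (suc k) (⟦ aPhase ⟧ t)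
  aPhase-ok {k} {t} k<n e₄₀ σ rs with jord-ok (Stage.tabs σ) k k<n
  ... | inj₂ (none , v) = if-case (Stage (suc k)) (t (sc 3) ≤ᵇℤ t₁ (sc 33))
      (λ _ → record { tabs = tab (33 ≔ get JORD (var 40)) refl (Stage.tabs σ)
        ; blocks = λ e e<M → best-iso (block-mono (NP.n≤1+n k)) back (Stage.blocks σ e e<M) ; sentinel = Stage.sentinel σ })
      (λ gt → ⊥-elim (gt (subst₂ (λ x y → T (x ≤ᵇℤ y)) (sym (n-ok (Stage.tabs σ))) (sym e₃₃) (ZP.≤⇒≤ᵇ (ZP.≤-refl {+ n})))))
    where
    t₁ = ⟦ 33 ≔ get JORD (var 40) ⟧ t
    e₃₃ : t₁ (sc 33) ≡ + n
    e₃₃ = trans (cong (λ x → t (arr JORD ∣ x ∣)) e₄₀) v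
    back : ∀ {a i L} → Block (suc k) a i L → Block k a i L
    back empty = empty
    back (block {j} j<n lt h<i a≤j j≤h i≤d CJ CK) with NP.m≤n⇒m<n∨m≡n (NP.≤-pred lt)
    ... | inj₁ l = block j<n l h<i a≤j j≤h i≤d CJ CK
    ... | inj₂ q = contradiction q (none j j<n)
  ... | inj₁ (j , j<n , jrk≡ , v) = if-case (Stage (suc k)) (t (sc 3) ≤ᵇℤ t₁ (sc 33))
      (λ le → contradiction (ZP.drop‿+≤+ (ZP.≤ᵇ⇒≤ (subst₂ (λ x y → T (x ≤ᵇℤ y)) (n-ok (Stage.tabs σ)) e₃₃ le))) (NP.<⇒≱ j<n))
      (λ _ → record { tabs = proj₁ (tables final) ; blocks = λ e e<M → done-below final e e<M e<M ; sentinel = proj₂ (proj₂ (tables final)) })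
    where
    t₁ = ⟦ 33 ≔ get JORD (var 40) ⟧ t
    t₂ = ⟦ 34 ≔ get REL (var 33) ⨾ 35 ≔ get DL (var 33) ⨾ 36 ≔ get WT (var 33) ⨾ 37 ≔ get POW (var 33) ⟧ t₁
    e₃₃ : t₁ (sc 33) ≡ + j
    e₃₃ = trans (cong (λ x → t (arr JORD ∣ x ∣)) e₄₀) v
    τ = Stage.tabs σ
    final : Blocking k j M (⟦ for #cells 20 aEntry ⟧ t₂)
    final = loop-inv (Blocking k j) #cells 20 aEntry t₂ (record
      { tables = tables-frame (33 ≔ get JORD (var 40) ⨾ 34 ≔ get REL (var 33) ⨾ 35 ≔ get DL (var 33) ⨾ 36 ≔ get WT (var 33) ⨾ 37 ≔ get POW (var 33))
          refl (λ _ → refl) (λ _ → refl) (τ , rs , Stage.sentinel σ)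
      ; rel≡ = trans (cong (λ x → t (arr REL ∣ x ∣)) e₃₃) (rel-ok τ j j<n)
      ; dl≡  = trans (cong (λ x → t (arr DL ∣ x ∣)) e₃₃) (dl-ok τ j j<n)
      ; wt≡  = trans (cong (λ x → t (arr WT ∣ x ∣)) e₃₃) (wt-ok τ j j<n)
      ; pow≡ = trans (cong (λ x → t (arr POW ∣ x ∣)) e₃₃) (pow-ok τ j j<n)
      ; done-below = λ _ ()
      ; todo = λ f _ f<M → Stage.blocks σ f f<M })
      (λ e s e<M → entry-ok j<n jrk≡ e<M)

-- Main loop, choice of the best chain and decoding

sweep : Com
sweep = for #jobs 40 (rPhase ⨾ aPhase) ⨾ rPhase

pick : Com
pick = 21 ≔ get RB (var 20) ⨾ 21 ≔ plus (var 5) 21 ⨾ 22 ≔ get RW (var 21) ⨾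
  if≤ 22 (var 41) skip (41 ≔ var 22 ⨾ 42 ≔ get RM (var 21))

collect : Com
collect = 41 ≔ num 0ℤ ⨾ 42 ≔ num 0ℤ ⨾ for #jobs 20 pick

-- Bits are removed from the highest down. The powers below `2 ^ c` sum to less than `2 ^ c`, so
-- comparing the remaining mask with this power decides whether job `c` is present.
bit : Com
bit = 43 ≔ minus (var 43) 45 ⨾ 44 ≔ minus (var 44) 45 ⨾ 46 ≔ get POW (var 43) ⨾
  if≤ 46 (var 42) (42 ≔ minus (var 42) 46 ⨾ output 44 (num 1ℤ)) (output 44 (num 0ℤ))

decode : Com
decode = 43 ≔ var 3 ⨾ 44 ≔ plus (plus (plus (plus (num (+ 2)) 3) 3) 3) 3 ⨾ 45 ≔ num 1ℤ ⨾ for #jobs 20 bit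

optimize : Com
optimize = setup ⨾ sweep ⨾ collect ⨾ decode

-- Sums over sets of jobs and bit masks

sumTo : (ℕ → ℤ) → ℕ → ℤ
sumTo h zero    = 0ℤ
sumTo h (suc c) = h c +ℤ sumTo h c

sumTo-cong : ∀ {h g} n → (∀ j → j < n → h j ≡ g j) → sumTo h n ≡ sumTo g n
sumTo-cong zero e = refl
sumTo-cong (suc n) e = cong₂ _+ℤ_ (e n NP.≤-refl) (sumTo-cong n (λ j j<n → e j (NP.m<n⇒m<1+n j<n)))

sumTo-zero : ∀ n → sumTo (λ _ → 0ℤ) n ≡ 0ℤ
sumTo-zero zero = refl
sumTo-zero (suc n) = trans (ZP.+-identityˡ _) (sumTo-zero n)

sumTo-insert : ∀ {h g} n j x → j < n → h j ≡ 0ℤ → g j ≡ x → (∀ i → i ≢ j → g i ≡ h i) → sumTo g n ≡ x +ℤ sumTo h n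
sumTo-insert {h} {g} (suc n) j x j< hj gj e with NP.m≤n⇒m<n∨m≡n (NP.≤-pred j<)
... | inj₂ refl = cong₂ _+ℤ_ gj (trans (sumTo-cong n (λ i i<n → e i (NP.<⇒≢ i<n)))
  (sym (trans (cong (_+ℤ sumTo h n) hj) (ZP.+-identityˡ _))))
... | inj₁ j<n = trans (cong₂ _+ℤ_ (e n (λ q → NP.<⇒≢ j<n (sym q))) (sumTo-insert {h} {g} n j x j<n hj gj e)) (swap (h n) x (sumTo h n))
  where
  swap : ∀ a b c → a +ℤ (b +ℤ c) ≡ b +ℤ (a +ℤ c)
  swap = IntSolver.solve-∀

sumTo-shift : ∀ h n → sumTo h (suc n) ≡ h 0 +ℤ sumTo (λ j → h (suc j)) n
sumTo-shift h zero = refl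
sumTo-shift h (suc n) = trans (cong (h (suc n) +ℤ_) (sumTo-shift h n)) (swap (h (suc n)) (h 0) (sumTo (λ j → h (suc j)) n))
  where
  swap : ∀ a b c → a +ℤ (b +ℤ c) ≡ b +ℤ (a +ℤ c)
  swap = IntSolver.solve-∀

select : (ℕ → Bool) → (ℕ → ℤ) → ℕ → ℤ
select χ ω j = if χ j then ω j else 0ℤ

-- Induction on the list: its head is switched off in the characteristic function and accounts for
-- one summand. The lemma serves both the weights and, with `power` for `ω`, the masks.
wsum-select : ∀ ω n {L} (χ : ℕ → Bool) → Unique L → All (_< n) L → (∀ j → j ∈ L → χ j ≡ true) → (∀ j → j ∉ L → χ j ≡ false) →
  wsum ω L ≡ sumTo (select χ ω) n
wsum-select ω n {[]} χ _ _ _ off = sym (trans (sumTo-cong n (λ j _ → cong (λ c → if c then ω j else 0ℤ) (off j (λ ())))) (sumTo-zero n))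
wsum-select ω n {j ∷ L} χ (j∉ ∷ u) (j<n ∷ l) on off =
  trans (cong (ω j +ℤ_) (wsum-select ω n χ′ u l in-χ′ out-χ′))
    (sym (sumTo-insert n j (ω j) j<n (cong (λ c → if c then ω j else 0ℤ) (χ′-j)) (cong (λ c → if c then ω j else 0ℤ) (on j (here refl)))
      (λ i i≢j → cong (λ c → if c then ω i else 0ℤ) (sym (χ′-other i i≢j)))))
  where
  χ′ : ℕ → Bool
  χ′ i = if i ≡ᵇ j then false else χ i
  χ′-j : χ′ j ≡ false
  χ′-j with j ≡ᵇ j | NP.≡⇒≡ᵇ j j refl
  ... | true | _ = refl
  χ′-other : ∀ i → i ≢ j → χ′ i ≡ χ i
  χ′-other i i≢j rewrite ≡ᵇ-false i≢j = refl
  in-χ′ : ∀ i → i ∈ L → χ′ i ≡ true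
  in-χ′ i i∈ = trans (χ′-other i (λ e → All.lookup j∉ i∈ (sym e))) (on i (there i∈))
  out-χ′ : ∀ i → i ∉ L → χ′ i ≡ false
  out-χ′ i i∉ with i NP.≟ j
  ... | yes refl = χ′-j
  ... | no i≢j = trans (χ′-other i i≢j) (off i (λ { (here e) → i≢j e ; (there q) → i∉ q }))

bits-≥0 : ∀ χ c → 0ℤ ≤ℤ sumTo (select χ power) c
bits-≥0 χ zero = ZP.≤-refl
bits-≥0 χ (suc c) with χ c
... | true  = ZP.+-mono-≤ {0ℤ} {power c} (+≤+ z≤n) (bits-≥0 χ c)
... | false = ZP.+-mono-≤ {0ℤ} {0ℤ} ZP.≤-refl (bits-≥0 χ c)

bits-< : ∀ χ c → sumTo (select χ power) c <ℤ power c
bits-< χ zero = +<+ (s≤s z≤n)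
bits-< χ (suc c) = ZP.≤-<-trans (ZP.+-monoˡ-≤ (sumTo (select χ power) c) (bound (χ c)))
  (ZP.<-≤-trans (ZP.+-monoʳ-< (power c) (bits-< χ c)) (ZP.≤-reflexive (cong (λ z → + (2 ^ c + z)) (sym (NP.+-identityʳ (2 ^ c))))))
  where
  bound : ∀ q → (if q then power c else 0ℤ) ≤ℤ power c
  bound true  = ZP.≤-refl
  bound false = +≤+ z≤n

module Optimum (b n p : ℕ) (0<p : 0 < p) (rel dl wt : ℕ → ℤ) where
  open BlockPhase b n p 0<p rel dl wt public

  sweep-ok : ∀ {t} → Stage 0 t → Stage n (⟦ sweep ⟧ t) × Rows n (⟦ sweep ⟧ t) n
  sweep-ok {t} σ = rPhase-ok (loop-inv Stage #jobs 40 (rPhase ⨾ aPhase) t σ each)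
    where
    each : ∀ k t → k < n → Stage k t → Stage (suc k) (⟦ rPhase ⨾ aPhase ⟧ (t [ sc 40 ↦ + k ]))
    each k t k<n σ = let (σ′ , rs) = rPhase-ok {k} {t₀} σ₀ in aPhase-ok k<n (frame rPhase (sc 40) t₀ refl) σ′ rs
      where
      t₀ = t [ sc 40 ↦ + k ]
      σ₀ : Stage k t₀
      σ₀ = record { tabs = tab (40 ≔ num (+ k)) refl (Stage.tabs σ) ; blocks = Stage.blocks σ ; sentinel = Stage.sentinel σ }

  record Collected (i : ℕ) (t : State) : Set where
    field
      tables : Tabulated t × Rows n t n
      {L}    : List ℕ
      {x}    : ℤ
      chain  : Chain n x M L
      value≡ : t (sc 41) ≡ wsum wt L
      mask≡  : t (sc 42) ≡ wsum power L
      upper  : ∀ z → z < i → ∀ L → Chain n (rel z) M L → wsum wt L ≤ℤ t (sc 41)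

  collect-ok : ∀ {t} → Tabulated t → Rows n t n → Collected n (⟦ collect ⟧ t)
  collect-ok {t} τ rs = loop-inv Collected #jobs 20 pick _
    (record { tables = tab (41 ≔ num 0ℤ ⨾ 42 ≔ num 0ℤ) refl τ , rs ; L = [] ; x = 0ℤ ; chain = [] ; value≡ = refl ; mask≡ = refl ; upper = λ _ () })
    each
    where
    each : ∀ z t → z < n → Collected z t → Collected (suc z) (⟦ pick ⟧ (t [ sc 20 ↦ + z ]))
    each z t z<n γ = if-case (Collected (suc z)) (t₁ (sc 22) ≤ᵇℤ t (sc 41))
      (λ le → record { tables = tables₁ ; chain = chain ; value≡ = value≡ ; mask≡ = mask≡
        ; upper = above ZP.≤-refl (subst (_≤ℤ t (sc 41)) e₂₂ (ZP.≤ᵇ⇒≤ le)) })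
      (λ gt → let (L′ , C′ , q , q′) = Best.attained row-z ; lt = subst (t (sc 41) <ℤ_) e₂₂ (≤ᵇ-false gt) in
        record { tables = tab (41 ≔ var 22 ⨾ 42 ≔ get RM (var 21)) refl (proj₁ tables₁) , proj₂ tables₁ ; chain = C′
          ; value≡ = trans e₂₂ q ; mask≡ = trans (cong (λ x → t (arr RM ∣ x ∣)) e₂₁) q′
          ; upper = λ z′ z′< L C → ZP.≤-trans (above (ZP.<⇒≤ lt) ZP.≤-refl z′ z′< L C) (ZP.≤-reflexive (sym e₂₂)) })
      where
      open Collected γ
      t₁ = ⟦ 21 ≔ get RB (var 20) ⨾ 21 ≔ plus (var 5) 21 ⨾ 22 ≔ get RW (var 21) ⟧ (t [ sc 20 ↦ + z ])
      τ′ = proj₁ tables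
      tables₁ : Tabulated t₁ × Rows n t₁ n
      tables₁ = tab (20 ≔ num (+ z) ⨾ 21 ≔ get RB (var 20) ⨾ 21 ≔ plus (var 5) 21 ⨾ 22 ≔ get RW (var 21)) refl τ′ , proj₂ tables
      e₂₁ : t₁ (sc 21) ≡ + idx z M
      e₂₁ = cong₂ _+ℤ_ (cells-ok τ′) (base-ok τ′ z (NP.<⇒≤ z<n))
      e₂₂ : t₁ (sc 22) ≡ t (arr RW (idx z M))
      e₂₂ = cong (λ x → t (arr RW ∣ x ∣)) e₂₁
      row-z : RowOk n t z M
      row-z = proj₂ tables z M z<n NP.≤-refl
      above : ∀ {v} → t (sc 41) ≤ℤ v → t (arr RW (idx z M)) ≤ℤ v → ∀ z′ → z′ < suc z → ∀ L → Chain n (rel z′) M L → wsum wt L ≤ℤ v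
      above le le′ z′ z′< L C with NP.m≤n⇒m<n∨m≡n (NP.≤-pred z′<)
      ... | inj₁ lt   = ZP.≤-trans (upper z′ lt L C) le
      ... | inj₂ refl = ZP.≤-trans (Best.maximal row-z L C) le′

  out : ℕ → ℕ
  out j = 2 + 3 * n + j

  output-≡ : ∀ {t v} x a → t (sc x) ≡ + a → 5 ≤ a → a < B → ∀ l → ⟦ output x (num v) ⟧ t l ≡ (t [ raw a ↦ v ]) l
  output-≡ {t} {v} x a e 5≤a a<B l rewrite e with 5 Nat.≤ᵇ a | NP.≤⇒≤ᵇ 5≤a | B Nat.≤ᵇ a in eq
  ... | true | _ | false = refl
  ... | true | _ | true  = contradiction (NP.≤ᵇ⇒≤ B a (subst T (sym eq) tt)) (NP.<⇒≱ a<B)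

  flag : Bool → ℤ
  flag c = if c then 1ℤ else 0ℤ

  module Decode (χ : ℕ → Bool) (0<n : 0 < n) (room : 2 + 4 * n ≤ B) where

    record Decoding (c : ℕ) (t : State) : Set where
      field
        tables : Tabulated t
        c≡     : t (sc 43) ≡ + c
        out≡   : t (sc 44) ≡ + out c
        one    : t (sc 45) ≡ 1ℤ
        rest   : t (sc 42) ≡ sumTo (select χ power) c
        written : ∀ j → c ≤ j → j < n → t (raw (out j)) ≡ flag (χ j)

    5≤out : ∀ c → 5 ≤ out c
    5≤out c = NP.≤-trans (NP.+-monoʳ-≤ 2 (NP.*-monoʳ-≤ 3 0<n)) (NP.m≤m+n _ c)

    out<B : ∀ c → c < n → out c < B
    out<B c c<n = NP.<-≤-trans (NP.+-monoʳ-< (2 + 3 * n) c<n) (NP.≤-trans (NP.≤-reflexive (lemma n)) room)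
      where
      lemma : ∀ n → 2 + 3 * n + n ≡ 2 + 4 * n
      lemma = NatSolver.solve-∀

    bit-ok : ∀ c t i → c < n → Decoding (suc c) t → Decoding c (⟦ bit ⟧ (t [ sc 20 ↦ + i ]))
    bit-ok c t i c<n δ = if-case (Decoding c) (t₁ (sc 46) ≤ᵇℤ t (sc 42))
      (λ le → write (42 ≔ minus (var 42) 46) 1ℤ refl refl refl refl
        (trans (cong₂ _-ℤ_ rest e₄₆) (trans (cong (λ q → (if q then power c else 0ℤ) +ℤ sumTo (select χ power) c -ℤ power c) (set le))
          (cancel (power c) (sumTo (select χ power) c)))) (sym (cong flag (set le))) (λ _ → refl))
      (λ gt → write skip 0ℤ refl refl refl refl
        (trans rest (trans (cong (λ q → (if q then power c else 0ℤ) +ℤ sumTo (select χ power) c) (unset gt)) (ZP.+-identityˡ _)))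
        (sym (cong flag (unset gt))) (λ _ → refl))
      where
      open Decoding δ
      t₁ = ⟦ 43 ≔ minus (var 43) 45 ⨾ 44 ≔ minus (var 44) 45 ⨾ 46 ≔ get POW (var 43) ⟧ (t [ sc 20 ↦ + i ])
      e₄₃ : t₁ (sc 43) ≡ + c
      e₄₃ = cong₂ _-ℤ_ c≡ one
      e₄₄ : t₁ (sc 44) ≡ + out c
      e₄₄ = trans (cong₂ _-ℤ_ out≡ one) (cong (λ z → + z -ℤ 1ℤ) (NP.+-suc (2 + 3 * n) c))
      e₄₆ : t₁ (sc 46) ≡ power c
      e₄₆ = trans (cong (λ x → t (arr POW ∣ x ∣)) e₄₃) (pow-ok tables c c<n)
      cancel : ∀ x y → x +ℤ y -ℤ x ≡ y
      cancel = IntSolver.solve-∀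
      set : T (t₁ (sc 46) ≤ᵇℤ t (sc 42)) → χ c ≡ true
      set le with χ c in eq
      ... | true  = refl
      ... | false = contradiction (subst₂ _≤ℤ_ e₄₆ (trans rest (cong (λ q → (if q then power c else 0ℤ) +ℤ sumTo (select χ power) c) eq)) (ZP.≤ᵇ⇒≤ le))
        (ZP.<⇒≱ (ZP.≤-<-trans (ZP.≤-reflexive (ZP.+-identityˡ _)) (bits-< χ c)))
      unset : ¬ T (t₁ (sc 46) ≤ᵇℤ t (sc 42)) → χ c ≡ false
      unset gt with χ c in eq
      ... | false = refl
      ... | true  = contradiction (≤ᵇ-false gt) (ZP.≤⇒≯ (subst₂ _≤ℤ_ (sym e₄₆)
        (sym (trans rest (cong (λ q → (if q then power c else 0ℤ) +ℤ sumTo (select χ power) c) eq)))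
        (ZP.≤-trans (ZP.≤-reflexive (sym (ZP.+-identityʳ (power c)))) (ZP.+-monoʳ-≤ (power c) (bits-≥0 χ c)))))
      write : ∀ C v → confined C ≡ true → writes C (sc 43) ≡ false → writes C (sc 44) ≡ false → writes C (sc 45) ≡ false →
        ⟦ C ⟧ t₁ (sc 42) ≡ sumTo (select χ power) c → v ≡ flag (χ c) →
        (∀ a → writes C (raw a) ≡ false) → Decoding c (⟦ C ⨾ output 44 (num v) ⟧ t₁)
      write C v cf w₁ w₂ w₃ r f w₄ = record
        { tables = tab (20 ≔ num (+ i) ⨾ 43 ≔ minus (var 43) 45 ⨾ 44 ≔ minus (var 44) 45 ⨾ 46 ≔ get POW (var 43) ⨾ C ⨾ output 44 (num v))
            (trans (cong (_∧ true) cf) refl) tables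
        ; c≡   = trans (after (sc 43)) (trans (frame C (sc 43) t₁ w₁) e₄₃)
        ; out≡ = trans (after (sc 44)) (trans (frame C (sc 44) t₁ w₂) e₄₄)
        ; one  = trans (after (sc 45)) (trans (frame C (sc 45) t₁ w₃) one)
        ; rest = trans (after (sc 42)) r
        ; written = written′ }
        where
        after : ∀ l → ⟦ C ⨾ output 44 (num v) ⟧ t₁ l ≡ (⟦ C ⟧ t₁ [ raw (out c) ↦ v ]) l
        after = output-≡ {⟦ C ⟧ t₁} {v} 44 (out c) (trans (frame C (sc 44) t₁ w₂) e₄₄) (5≤out c) (out<B c c<n)
        written′ : ∀ j → c ≤ j → j < n → ⟦ C ⨾ output 44 (num v) ⟧ t₁ (raw (out j)) ≡ flag (χ j)
        written′ j c≤j j<n with NP.m≤n⇒m<n∨m≡n c≤j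
        ... | inj₂ refl = trans (after (raw (out c))) (trans (table-same (λ a → ⟦ C ⟧ t₁ (raw a)) (out c) v) f)
        ... | inj₁ c<j  = trans (after (raw (out j))) (trans (update-other (λ a → ⟦ C ⟧ t₁ (raw a)) v
            (λ e → NP.<⇒≢ c<j (sym (NP.+-cancelˡ-≡ (2 + 3 * n) j c e))))
            (trans (frame C (raw (out j)) t₁ w₄′) (written j c<j j<n)))
          where w₄′ = w₄ (out j)

    decode-ok : ∀ {t} → Tabulated t → t (sc 42) ≡ sumTo (select χ power) n → ∀ j → j < n → ⟦ decode ⟧ t (raw (out j)) ≡ flag (χ j)
    decode-ok {t} τ e j j<n = Decoding.written (subst (λ c → Decoding c (⟦ decode ⟧ t)) (NP.n∸n≡0 n) all) j z≤n j<n
      where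
      all : Decoding (n ∸ n) (⟦ decode ⟧ t)
      -- Loops count upwards while the bits are read downwards, so after `i` iterations the bits
      -- below `n ∸ i` remain. The output address starts one past the last flag, at `out n`.
      all = loop-inv (λ i → Decoding (n ∸ i)) #jobs 20 bit _ (record
        { tables = tab (43 ≔ var 3 ⨾ 44 ≔ plus (plus (plus (plus (num (+ 2)) 3) 3) 3) 3 ⨾ 45 ≔ num 1ℤ) refl τ
        ; c≡ = n-ok τ ; out≡ = trans (cong (λ x → + 2 +ℤ x +ℤ x +ℤ x +ℤ x) (n-ok τ)) (cong +_ (lemma n)) ; one = refl ; rest = e
        ; written = λ j n≤j j<n → contradiction n≤j (NP.<⇒≱ j<n) })
        (λ i t i<n δ → bit-ok (n ∸ suc i) t i (NP.∸-monoʳ-< {n} (s≤s z≤n) i<n) (subst (λ c → Decoding c t) (NP.+-∸-assoc 1 i<n) δ))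
        where
        lemma : ∀ n → 2 + n + n + n + n ≡ 2 + 3 * n + n
        lemma = NatSolver.solve-∀

-- From the tables to the theorem

pow4 : ∀ x → (2 * x) ^ 4 ≡ 16 * x ^ 4
pow4 = expanded
  where
  expanded : ∀ x → 2 * x * (2 * x * (2 * x * (2 * x * 1))) ≡ 16 * (x * (x * (x * (x * 1))))
  expanded = NatSolver.solve-∀

-- The chain of a feasible set can start at the earliest release time, so one of the rows of the
-- chain table accounts for it.
argmin : ∀ n (f : ℕ → ℤ) → 0 < n → ∃[ z ] z < n × (∀ j → j < n → f z ≤ℤ f j)
argmin (suc zero) f _ = 0 , s≤s z≤n , λ { zero _ → ZP.≤-refl ; (suc _) (s≤s ()) }
argmin (suc (suc n)) f _ with argmin (suc n) f (s≤s z≤n)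
... | z , z<n , least with f z ZP.≤? f (suc n)
...   | yes le = z , NP.m<n⇒m<1+n z<n , λ j j< → case NP.m≤n⇒m<n∨m≡n (NP.≤-pred j<) of λ
        { (inj₁ lt) → least j lt ; (inj₂ refl) → le }
...   | no gt = suc n , NP.≤-refl , λ j j< → case NP.m≤n⇒m<n∨m≡n (NP.≤-pred j<) of λ
        { (inj₁ lt) → ZP.≤-trans (ZP.<⇒≤ (ZP.≰⇒> gt)) (least j lt) ; (inj₂ refl) → ZP.≤-refl }

sum-tabulate : ∀ k (h : ℕ → ℤ) (g : Fin k → ℤ) → (∀ i → g i ≡ h (toℕ i)) → foldr _+ℤ_ 0ℤ (Data.List.tabulate g) ≡ sumTo h k
sum-tabulate zero h g e = refl
sum-tabulate (suc k) h g e = trans (cong₂ _+ℤ_ (e Fin.zero) (sum-tabulate k (λ j → h (suc j)) (λ i → g (Fin.suc i)) (λ i → e (Fin.suc i))))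
  (sym (sumTo-shift h k))

weight-sum : ∀ n jobs (J : Subset n) (χ : ℕ → Bool) (ω : ℕ → ℤ) → (∀ i → Vec.lookup J i ≡ χ (toℕ i)) → (∀ i → ω (toℕ i) ≡ w (jobs i)) →
  weight n jobs J ≡ sumTo (select χ ω) n
weight-sum n jobs J χ ω eχ eω = trans (cong (foldr _+ℤ_ 0ℤ) (LP.map-tabulate {n = n} id (λ j → if Vec.lookup J j then w (jobs j) else 0ℤ)))
  (sum-tabulate n (select χ ω) (λ j → if Vec.lookup J j then w (jobs j) else 0ℤ) (λ i → cong₂ (λ c x → if c then x else 0ℤ) (eχ i) (sym (eω i))))

slots : ℕ → List (ℕ × List ℤ) → List ℤ
slots j []             = []
slots j ((k , ts) ∷ E) with j NP.≟ k
... | yes _ = ts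
... | no _  = slots j E

slots-∈ : ∀ j E {t} → t ∈ slots j E → t ∈ concatMap proj₂ E
slots-∈ j ((k , ts) ∷ E) t∈ with j NP.≟ k
... | yes _ = MemP.∈-++⁺ˡ t∈
... | no _  = MemP.∈-++⁺ʳ ts (slots-∈ j E t∈)

slots-unique : ∀ j E → Unique (concatMap proj₂ E) → Unique (slots j E)
slots-unique j [] u = []
slots-unique j ((k , ts) ∷ E) u with j NP.≟ k
... | yes _ = unique-takeˡ ts u
... | no _  = slots-unique j E (unique-dropˡ ts u)

slots-disjoint : ∀ i j E → i ≢ j → Unique (concatMap proj₂ E) → ∀ t → t ∈ slots i E → t ∉ slots j E
slots-disjoint i j ((k , ts) ∷ E) i≢j u t t∈ t∈′ with i NP.≟ k | j NP.≟ k
... | yes refl | yes refl = i≢j refl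
... | yes _ | no _  = unique-disjoint ts u t∈ (slots-∈ j E t∈′)
... | no _  | yes _ = unique-disjoint ts u t∈′ (slots-∈ i E t∈)
... | no _  | no _  = slots-disjoint i j E i≢j (unique-dropˡ ts u) t t∈ t∈′

slots-all : ∀ {R : ℕ → List ℤ → Set} j E → R j [] → All (λ e → R (proj₁ e) (proj₂ e)) E → R j (slots j E)
slots-all j [] r [] = r
slots-all j ((k , ts) ∷ E) r (q ∷ qs) with j NP.≟ k
... | yes refl = q
... | no _     = slots-all j E r qs

slots-length : ∀ {p} j E → j ∈ map proj₁ E → All (λ e → length (proj₂ e) ≡ p) E → length (slots j E) ≡ p
slots-length j ((k , ts) ∷ E) j∈ (q ∷ qs) with j NP.≟ k
... | yes _ = q
... | no j≢k with j∈
...   | here e   = contradiction e j≢k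
...   | there j∈ = slots-length j E j∈ qs

-- Gives a name to the function tabulated by outSet, whose helper isZero is local to Defs.
outSet-tabulates : ∀ n m → ∃[ f ] outSet n m ≡ Vec.tabulate f
outSet-tabulates n m = _ , refl

outSet-lookup : ∀ n m (χ : ℕ → Bool) → (∀ j → j < n → m (2 + 3 * n + j) ≡ (if χ j then 1ℤ else 0ℤ)) →
  ∀ i → Vec.lookup (outSet n m) i ≡ χ (toℕ i)
outSet-lookup n m χ e i = trans (VP.lookup∘tabulate (proj₁ (outSet-tabulates n m)) i) flagged
  where
  flagged : proj₁ (outSet-tabulates n m) i ≡ χ (toℕ i)
  flagged rewrite e (toℕ i) (FP.toℕ<n i) with χ (toℕ i)
  ... | true  = refl
  ... | false = refl

module Input {n : ℕ} (p : ℕ) (jobs : Fin n → Job) where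

  triple : Fin n → List ℤ
  triple j = r (jobs j) ∷ d (jobs j) ∷ w (jobs j) ∷ []

  nth-triple : ∀ {k} (g : Fin k → Fin n) (i : Fin k) → let xs = concatMap triple (Data.List.tabulate g) in
    nth xs (toℕ i * 3) ≡ r (jobs (g i)) × nth xs (1 + toℕ i * 3) ≡ d (jobs (g i)) × nth xs (2 + toℕ i * 3) ≡ w (jobs (g i))
  nth-triple g Fin.zero    = refl , refl , refl
  nth-triple g (Fin.suc i) = nth-triple (λ i → g (Fin.suc i)) i

  length-triples : ∀ {k} (g : Fin k → Fin n) → length (concatMap triple (Data.List.tabulate g)) ≡ k * 3
  length-triples {zero}  g = refl
  length-triples {suc k} g = cong (λ z → 3 + z) (length-triples (λ i → g (Fin.suc i)))

  μ : Mem
  μ = nth (inputList n p jobs)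

  μ-rel : ∀ i → μ (2 + toℕ i * 3) ≡ r (jobs i)
  μ-rel i = proj₁ (nth-triple id i)

  μ-dl : ∀ i → μ (3 + toℕ i * 3) ≡ d (jobs i)
  μ-dl i = proj₁ (proj₂ (nth-triple id i))

  μ-wt : ∀ i → μ (4 + toℕ i * 3) ≡ w (jobs i)
  μ-wt i = proj₂ (proj₂ (nth-triple id i))

  μ-beyond : ∀ a → 2 + n * 3 ≤ a → μ a ≡ 0ℤ
  μ-beyond a le = nth-beyond (inputList n p jobs) a (subst (_≤ a) (cong (λ z → 2 + z) (sym (length-triples id))) le)

module Conversion {n p : ℕ} (jobs : Fin n → Job) (0<p : 0 < p) (rel dl wt : ℕ → ℤ)
  (rel≡ : ∀ i → rel (toℕ i) ≡ r (jobs i)) (dl≡ : ∀ i → dl (toℕ i) ≡ d (jobs i)) (wt≡ : ∀ i → wt (toℕ i) ≡ w (jobs i)) where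
  open Recursion n p 0<p rel dl wt

  schedulable⇒feasible : ∀ {x Hi L} (J : Subset n) (χ : ℕ → Bool) → (∀ i → Vec.lookup J i ≡ χ (toℕ i)) →
    (∀ j → χ j ≡ true → j ∈ L) → Schedulable x Hi L → Feasible n p jobs J
  schedulable⇒feasible J χ look χ⇒ (E , refl , σ) = record
    { S        = λ i → slots (toℕ i) E
    ; unique   = λ i → slots-unique (toℕ i) E (Scheduled.units-unique σ)
    ; inWindow = λ i → subst₂ (λ x y → All (λ t → x ≤ℤ t × t <ℤ y) (slots (toℕ i) E)) (rel≡ i) (dl≡ i)
        (slots-all {λ j ts → All (λ t → rel j ≤ℤ t × t <ℤ dl j) ts} (toℕ i) E []
          (All.map (λ q → All.map (λ { (x , y , _) → x , y }) (proj₂ q)) (Scheduled.entries σ)))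
    ; disjoint = λ i j i≢j → slots-disjoint (toℕ i) (toℕ j) E (λ e → i≢j (FP.toℕ-injective e)) (Scheduled.units-unique σ) } ,
    λ i i∈ → slots-length (toℕ i) E (χ⇒ (toℕ i) (trans (sym (look i)) (VP.[]=⇒lookup i∈))) (All.map proj₁ (Scheduled.entries σ))

  module FromFeasible (J : Subset n) (feasible : Feasible n p jobs J) where

    σ = proj₁ feasible

    χ : ℕ → Bool
    χ j with j NP.<? n
    ... | yes j<n = Vec.lookup J (fromℕ< j<n)
    ... | no _    = false

    units : ℕ → List ℤ
    units j with j NP.<? n
    ... | yes j<n = S σ (fromℕ< j<n)
    ... | no _    = []

    χ-toℕ : ∀ i → Vec.lookup J i ≡ χ (toℕ i)
    χ-toℕ i with toℕ i NP.<? n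
    ... | yes lt = cong (Vec.lookup J) (sym (FP.fromℕ<-toℕ i lt))
    ... | no ge  = contradiction (FP.toℕ<n i) ge

    units-toℕ : ∀ i → units (toℕ i) ≡ S σ i
    units-toℕ i with toℕ i NP.<? n
    ... | yes lt = cong (S σ) (FP.fromℕ<-toℕ i lt)
    ... | no ge  = contradiction (FP.toℕ<n i) ge

    Q : ℕ → Set
    Q j = χ j ≡ true

    index : ∀ {j} → Q j → ∃[ i ] toℕ i ≡ j × Vec.lookup J i ≡ true
    index {j} q with j NP.<? n
    ... | yes j<n = fromℕ< j<n , FP.toℕ-fromℕ< j<n , q
    index {j} () | no _

    Q⇒<n : ∀ {j} → Q j → j < n
    Q⇒<n q = let (i , e , _) = index q in subst (_< n) e (FP.toℕ<n i)

    completing : Completeness.Completing order Q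
    completing = record
      { units = units
      ; |units| = λ j q → on j q (λ j → length (units j) ≡ p)
          (λ i i∈ → trans (cong length (units-toℕ i)) (proj₂ feasible i (VP.lookup⇒[]= i J i∈)))
      ; units-unique = λ j q → on j q (λ j → Unique (units j)) (λ i _ → subst Unique (sym (units-toℕ i)) (unique σ i))
      ; window = λ j q → on j q (λ j → All (λ t → rel j ≤ℤ t × t <ℤ dl j) (units j))
          (λ i _ → subst₂ (λ x y → All (λ t → x ≤ℤ t × t <ℤ y) (units (toℕ i))) (sym (rel≡ i)) (sym (dl≡ i))
            (subst (All _) (sym (units-toℕ i)) (inWindow σ i)))
      ; units-disjoint = λ i j q q′ i≢j t∈ t∈′ → apart i j q q′ i≢j t∈ t∈′ }
      where
      on : ∀ j → Q j → (R : ℕ → Set) → (∀ i → Vec.lookup J i ≡ true → R (toℕ i)) → R j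
      on j q R f = let (i , e , i∈) = index q in subst R e (f i i∈)
      apart : ∀ i j → Q i → Q j → i ≢ j → ∀ {t} → t ∈ units i → t ∉ units j
      apart i j q q′ i≢j {t} t∈ t∈′ with index q | index q′
      ... | a , refl , _ | c , refl , _ = disjoint σ a c (λ e → i≢j (cong toℕ e)) t
        (subst (t ∈_) (units-toℕ a) t∈) (subst (t ∈_) (units-toℕ c) t∈′)

    open Completeness.FromSchedule order {Q} (λ j → χ j Bool.≟ true) Q⇒<n completing

    chain : ∀ {x} → (∀ j → j < n → x ≤ℤ rel j) → ∃[ L ] Chain n x M L × weight n jobs J ≡ wsum wt L
    chain x≤ = let (L , u , L⇒Q , Q⇒L , C) = chain-of-schedule x≤ in
      L , C , trans (weight-sum n jobs J χ wt χ-toℕ wt≡)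
        (sym (wsum-select wt n χ u (All.tabulate (λ j∈ → Q⇒<n (L⇒Q j∈))) (λ j → L⇒Q) (λ j j∉ → Bool.¬-not (λ q → j∉ (Q⇒L q)))))

module Positive (n p : ℕ) (0<n : 0 < n) (0<p : 0 < p) (jobs : Fin n → Job) where
  open Input p jobs
  open import Data.List.Membership.DecPropositional NP._≟_ using (_∈?_)

  b : ℕ
  b = p + n + n + n + n + n ∸ 5

  B≡ : p + n + n + n + n + n ≡ 5 + b
  B≡ = sym (NP.m+[n∸m]≡n (NP.≤-trans (NP.n≤1+n 5)
    (NP.+-mono-≤ (NP.+-mono-≤ (NP.+-mono-≤ (NP.+-mono-≤ (NP.+-mono-≤ 0<p 0<n) 0<n) 0<n) 0<n) 0<n)))

  -- The output ends at register `2 + 4 n`, and `p + n ≥ 2` because both are positive. This is why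
  -- the base adds five copies of `n` to `p`: four would fall short when `p = 1`.
  room : 2 + 4 * n ≤ 5 + b
  room = subst (2 + 4 * n ≤_) (trans (arith p n) B≡) (NP.+-monoˡ-≤ (4 * n) (NP.+-mono-≤ 0<p 0<n))
    where
    arith : ∀ p n → p + n + 4 * n ≡ p + n + n + n + n + n
    arith = NatSolver.solve-∀

  input-room : 2 + n * 3 ≤ 5 + b
  input-room = NP.≤-trans (NP.+-monoʳ-≤ 2 (subst (_≤ 4 * n) (NP.*-comm 3 n) (NP.*-monoˡ-≤ n (NP.n≤1+n 3)))) room

  module R = Run countCells optimize b n p (n * suc n) B≡ 0<n μ refl refl
    (λ a → μ-beyond (5 + b + a) (NP.≤-trans input-room (NP.m≤m+n (5 + b) a)))

  s₁ : State
  s₁ = R.S₁.⟦ countCells ⟧ R.saved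

  unchanged : ∀ l → writes countCells l ≡ false → s₁ l ≡ R.saved l
  unchanged l = Frame.frame b (bounds n 0) countCells l R.saved

  cells≡ : s₁ (sc 5) ≡ + (n * suc n)
  cells≡ = Setups.countCells-ok b (bounds n 0) R.saved n refl

  module SR = SetupRun b n p 0<p s₁ input-room
    (trans (unchanged (sc 0) refl) (sym (unchanged (raw 2) refl)))
    (trans (unchanged (sc 1) refl) (sym (unchanged (raw 3) refl)))
    (trans (unchanged (sc 2) refl) (sym (unchanged (raw 4) refl)))
    (unchanged (sc 3) refl) (unchanged (sc 4) refl) cells≡

  open Optimum b n p 0<p SR.rel SR.dl SR.wt
  module C = Conversion jobs 0<p SR.rel SR.dl SR.wt
    (λ i → trans (unchanged (raw (2 + toℕ i * 3)) refl) (μ-rel i))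
    (λ i → trans (unchanged (raw (3 + toℕ i * 3)) refl) (μ-dl i))
    (λ i → trans (unchanged (raw (4 + toℕ i * 3)) refl) (μ-wt i))

  still-zero : ∀ c i → writes setup (arr c i) ≡ false → ⟦ setup ⟧ s₁ (arr c i) ≡ 0ℤ
  still-zero c i e = trans (frame setup (arr c i) s₁ e) (unchanged (arr c i) refl)

  initially : Stage 0 (⟦ setup ⟧ s₁)
  initially = record
    { tabs = SR.tabulated
    ; blocks = λ e e<M → subst₂ (Best.Best SR.wt (Block 0 (job-of e) (index-of e))) (sym (still-zero AW e refl)) (sym (still-zero AM e refl))
        (best-empty empty block-zero)
    ; sentinel = λ q _ → still-zero RW (idx n q) refl , still-zero RM (idx n q) refl }

  swept : State
  swept = ⟦ sweep ⟧ (⟦ setup ⟧ s₁)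

  collected : Collected n (⟦ collect ⟧ swept)
  collected = let (σ , rows) = sweep-ok initially in collect-ok (Stage.tabs σ) rows

  optimize-≡ : ⟦ optimize ⟧ s₁ ≡ ⟦ decode ⟧ (⟦ collect ⟧ swept)
  optimize-≡ = refl

  module Result (t : State) (γ : Collected n t) (m : Mem) (sim : R.Phase₂._∼_ (⟦ decode ⟧ t) m) where
    open Collected γ

    χ : ℕ → Bool
    χ j = does (j ∈? L)

    χ-in : ∀ j → j ∈ L → χ j ≡ true
    χ-in j j∈ = dec-true (j ∈? L) j∈

    χ-out : ∀ j → j ∉ L → χ j ≡ false
    χ-out j j∉ = dec-false (j ∈? L) j∉

    χ⇒∈ : ∀ j → χ j ≡ true → j ∈ L
    χ⇒∈ j e with j ∈? L
    ... | yes j∈ = j∈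

    L<n : All (_< n) L
    L<n = All.map proj₁ (chain-jobs chain)

    output-ok : ∀ j → j < n → ⟦ decode ⟧ t (raw (2 + 3 * n + j)) ≡ (if χ j then 1ℤ else 0ℤ)
    output-ok = Decode.decode-ok χ 0<n room (proj₁ tables)
      (trans mask≡ (wsum-select power n χ (chain-unique chain) L<n χ-in χ-out))

    J : Subset n
    J = outSet n m

    J-lookup : ∀ i → Vec.lookup J i ≡ χ (toℕ i)
    J-lookup = outSet-lookup n m χ (λ j j<n → trans
      (R.Phase₂._∼_.cells sim (raw (2 + 3 * n + j)) (Decode.5≤out χ 0<n room j , Decode.out<B χ 0<n room j j<n)) (output-ok j j<n))

    weight-J : weight n jobs J ≡ wsum SR.wt L
    weight-J = trans (weight-sum n jobs J χ SR.wt J-lookup (λ i → trans (unchanged (raw (4 + toℕ i * 3)) refl) (μ-wt i)))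
      (sym (wsum-select SR.wt n χ (chain-unique chain) L<n χ-in χ-out))

    maximum : MaxWeightFeasible n p jobs J
    maximum = C.schedulable⇒feasible J χ J-lookup χ⇒∈ (chain-schedulable chain) , bound
      where
      bound : ∀ J′ → Feasible n p jobs J′ → weight n jobs J′ ≤ℤ weight n jobs J
      bound J′ feasible =
        let (z , z<n , least) = argmin n SR.rel 0<n
            (L′ , C′ , e) = C.FromFeasible.chain J′ feasible least in
        ZP.≤-trans (ZP.≤-reflexive e) (ZP.≤-trans (upper z z<n L′ C′) (ZP.≤-reflexive (trans value≡ (sym weight-J))))

  module Cost₁ = CostBound (suc n) (s≤s z≤n) (bounds n 0) (NP.n≤1+n n) NP.≤-refl z≤n
  module Cost₂ = CostBound (suc n) (s≤s z≤n) (bounds n (n * suc n)) (NP.n≤1+n n) NP.≤-refl (NP.*-monoˡ-≤ (suc n) (NP.n≤1+n n))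

  -- Both commands have degree at most 4; 45 bounds the prologue and 6 is the length of `setCells`.
  -- The factor 16 comes from `n + 1 ≤ 2 n`. The factors enter as variables with equations, so that
  -- the arithmetic treats them as opaque constants.
  time-≤ : ∀ {f₁ f₂} → f₁ ≡ factor countCells → f₂ ≡ factor optimize →
    45 + (cost (bounds n 0) countCells + (6 + cost (bounds n (n * suc n)) optimize)) ≤ ((f₁ + f₂) * 16 + 51) * n ^ 4 + ((f₁ + f₂) * 16 + 51)
  time-≤ {f₁} {f₂} e₁ e₂ = begin
    45 + (c₁ + (6 + c₂))                     ≡⟨ rearrange c₁ c₂ ⟩
    c₁ + c₂ + 51                             ≤⟨ NP.+-monoˡ-≤ 51 (NP.+-mono-≤ bound₁ bound₂) ⟩
    f₁ * N⁴ + f₂ * N⁴ + 51                   ≡⟨ cong (_+ 51) (sym (NP.*-distribʳ-+ N⁴ f₁ f₂)) ⟩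
    (f₁ + f₂) * N⁴ + 51                      ≤⟨ NP.+-monoˡ-≤ 51 (NP.*-monoʳ-≤ (f₁ + f₂) N⁴≤) ⟩
    (f₁ + f₂) * (16 * n ^ 4) + 51            ≡⟨ cong (_+ 51) (sym (NP.*-assoc (f₁ + f₂) 16 (n ^ 4))) ⟩
    (f₁ + f₂) * 16 * n ^ 4 + 51              ≤⟨ NP.+-mono-≤ (NP.*-monoˡ-≤ (n ^ 4) (NP.m≤m+n ((f₁ + f₂) * 16) 51)) (NP.m≤n+m 51 ((f₁ + f₂) * 16)) ⟩
    ((f₁ + f₂) * 16 + 51) * n ^ 4 + ((f₁ + f₂) * 16 + 51) ∎
    where
    open NP.≤-Reasoning
    N⁴ = suc n ^ 4
    c₁ = cost (bounds n 0) countCells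
    c₂ = cost (bounds n (n * suc n)) optimize
    rearrange : ∀ x y → 45 + (x + (6 + y)) ≡ x + y + 51
    rearrange = NatSolver.solve-∀
    degree₁ : degree countCells ⊔ 4 ≡ 4
    degree₁ = refl
    degree₂ : degree optimize ≡ 4
    degree₂ = refl
    bound₁ : c₁ ≤ f₁ * N⁴
    bound₁ = subst₂ (λ f k → c₁ ≤ f * suc n ^ k) (sym e₁) degree₁
      (Cost₁.raise (factor countCells) (NP.m≤m⊔n (degree countCells) 4) (Cost₁.cost-≤ countCells))
    bound₂ : c₂ ≤ f₂ * N⁴
    bound₂ = subst₂ (λ f k → c₂ ≤ f * suc n ^ k) (sym e₂) degree₂ (Cost₂.cost-≤ optimize)
    N⁴≤ : N⁴ ≤ 16 * n ^ 4
    N⁴≤ = NP.≤-trans (NP.^-monoˡ-≤ 4 (NP.+-mono-≤ 0<n (NP.≤-reflexive (sym (NP.+-identityʳ n))))) (NP.≤-reflexive (pow4 n))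

  solved : Σ ℕ λ t → t ≤ 45 + (cost (bounds n 0) countCells + (6 + cost (bounds n (n * suc n)) optimize))
    × Halted (program countCells optimize) (run (program countCells optimize) t (initConfig n p jobs))
    × MaxWeightFeasible n p jobs (outSet n (mem (run (program countCells optimize) t (initConfig n p jobs))))
  solved = from (R.run-program cells≡)
    where
    from : Exec (program countCells optimize) 0 μ (length (program countCells optimize))
      (45 + (cost (bounds n 0) countCells + (6 + cost (bounds n (n * suc n)) optimize))) (R.Phase₂._∼_ (⟦ optimize ⟧ s₁)) → _
    from (exec′ t t≤ m e sim) = t , t≤ ,
      subst (Halted (program countCells optimize)) (sym e) (R.halts m) ,
      subst (λ c → MaxWeightFeasible n p jobs (outSet n (mem c))) (sym e) (Result.maximum (⟦ collect ⟧ swept) collected m (subst (λ s → R.Phase₂._∼_ s m) optimize-≡ sim))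

module NoJobs (p : ℕ) (jobs : Fin 0 → Job) (C₁ C₂ : Com) where

  P : Program
  P = program C₁ C₂

  μ : Mem
  μ = nth (inputList 0 p jobs)

  open Correctness 0 (bounds 0 0) P

  -- Without jobs the base is `p`, and the prologue stores register 2 there before it tests register
  -- 0. Register 2 then holds 0, so register 0 is 0 whether or not the store hits it.
  either-zero : ∀ q → (if q then 0ℤ else 0ℤ) ≡ 0ℤ
  either-zero true  = refl
  either-zero false = refl

  stops : Exec P 0 μ 1 9 (λ _ → ⊤)
  stops = jump refl
    ▹ λ { _ refl → straight (add 1 1 0 ∷ add 1 1 0 ∷ add 1 1 0 ∷ add 1 1 0 ∷ add 1 1 0 ∷ store 1 2 ∷ const 2 0ℤ ∷ [])
        (refl , refl , refl , refl , refl , refl , refl , tt)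
    ▹ λ { m e → weaken NP.≤-refl (λ _ → tt) (jump-≤ {l = 1} refl (at-most m e)) }}
    where
    at-most : ∀ m → m ≡ effects (add 1 1 0 ∷ add 1 1 0 ∷ add 1 1 0 ∷ add 1 1 0 ∷ add 1 1 0 ∷ store 1 2 ∷ const 2 0ℤ ∷ []) μ →
      T (m 0 ≤ᵇℤ m 2)
    at-most m refl = subst (λ z → T (z ≤ᵇℤ 0ℤ)) (sym (either-zero (0 ≡ᵇ p + 0 + 0 + 0 + 0 + 0))) tt

  solved : Σ ℕ λ t → t ≤ 9 × Halted P (run P t (initConfig 0 p jobs)) ×
    MaxWeightFeasible 0 p jobs (outSet 0 (mem (run P t (initConfig 0 p jobs))))
  solved = from stops
    where
    from : Exec P 0 μ 1 9 (λ _ → ⊤) → _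
    from (exec′ t t≤ m e _) = t , t≤ , subst (Halted P) (sym e) tt ,
      (record { S = λ () ; unique = λ () ; inWindow = λ () ; disjoint = λ () } , λ ()) , λ _ _ → ZP.≤-refl


-- The additive constant of the time bound pays for an instance without jobs, where the power of `n`
-- vanishes.
constant-≤ : ∀ f x → 9 ≤ (f * 16 + 51) * x + (f * 16 + 51)
constant-≤ f x = NP.≤-trans (NP.m≤m+n 9 42) (NP.≤-trans (NP.m≤n+m 51 (f * 16)) (NP.m≤n+m (f * 16 + 51) ((f * 16 + 51) * x)))

theorem1 : Σ Program λ prog → Σ ℕ λ c →
    ∀ (n p : ℕ) (jobs : Fin n → Job) → 1 ≤ p → (∀ j → 0ℤ ≤ℤ w (jobs j)) →
    Σ ℕ λ t → (t ≤ c * n ^ 4 + c)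
      × Halted prog (run prog t (initConfig n p jobs))
      × MaxWeightFeasible n p jobs (outSet n (mem (run prog t (initConfig n p jobs))))
theorem1 = program countCells optimize , f * 16 + 51 , λ
  { zero    p jobs 1≤p _ → let (t , t≤ , rest) = NoJobs.solved p jobs countCells optimize in
      t , NP.≤-trans t≤ (constant-≤ f (0 ^ 4)) , rest
  ; (suc n) p jobs 1≤p _ → let (t , t≤ , rest) = Positive.solved (suc n) p (s≤s z≤n) 1≤p jobs in
      t , NP.≤-trans t≤ (Positive.time-≤ (suc n) p (s≤s z≤n) 1≤p jobs {factor countCells} {factor optimize} refl refl) , rest }
  where
  f = factor countCells + factor optimize
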